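{- Let $G$ be an edge-weighted graph with constant doubling dimension $d$. For any $\varepsilon \in (0,1)$, one can construct a spanning $(1+\varepsilon)$-tree cover for $G$ consisting of $\varepsilon^{ -\tilde{O}(d)}$ trees.
   Context: The doubling dimension of a graph $G$ is the doubling dimension of its shortest-path metric $d_G$; a metric has doubling dimension $d$ if every ball of radius $r>0$ can be covered by at most $2^d$ balls of radius $r/2$. A spanning $t$-tree cover of $G$ is a collection $\mathcal{T}$ of trees, each of which is a spanning subgraph of $G$ (using only edges of $G$, with their weights), such that for every pair of vertices $u,v$ there is $T \in \mathcal{T}$ with $d_T(u,v) \le t \cdot d_G(u,v)$. The notation $\tilde{O}(g)$ hides factors polylogarithmic in $g$.
   Formalization: The edge weights of G and the parameter ε are taken to be rational numbers instead of real numbers. -}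

module Defs where

open import Data.Nat as ℕ using (ℕ; zero; suc)
open import Data.Nat.Logarithm using (⌊log₂_⌋)
open import Data.Fin using (Fin)
open import Data.Bool using (Bool; true)
open import Data.List using (List; []; _∷_; length)
open import Data.List.Membership.Propositional using (_∈_)
open import Data.List.Relation.Unary.Unique.Propositional using (Unique)
open import Data.Product using (Σ; ∃; ∃-syntax; _×_; _,_)
open import Data.Rational as ℚ using (ℚ; 0ℚ; 1ℚ; ½; _≤_; _<_; _+_; _*_)
open import Relation.Binary.PropositionalEquality using (_≡_)
import Data.Empty
import Data.Bool

_^ℚ_ : ℚ → ℕ → ℚ
q ^ℚ zero  = 1ℚ
q ^ℚ suc n = q * (q ^ℚ n)

record WGraph (n : ℕ) : Set where
  field
    adj    : Fin n → Fin n → Bool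
    w      : Fin n → Fin n → ℚ
    adj-sym   : ∀ u v → adj u v ≡ adj v u
    w-sym     : ∀ u v → w u v ≡ w v u
    adj-irrefl : ∀ u → adj u u ≡ Data.Bool.false
    w-pos     : ∀ u v → adj u v ≡ true → 0ℚ < w u v
open WGraph public

data Walk {n : ℕ} (A : Fin n → Fin n → Bool) : Fin n → Fin n → Set where
  here : ∀ {u} → Walk A u u
  step : ∀ {u v x} → A u v ≡ true → Walk A v x → Walk A u x

walkWeight : ∀ {n} {A : Fin n → Fin n → Bool} (w : Fin n → Fin n → ℚ) {u v : Fin n}
           → Walk A u v → ℚ
walkWeight w here = 0ℚ
walkWeight w (step {u} {v} _ p) = w u v + walkWeight w p

-- d_A(u,v) ≤ r  (the shortest-path distance is attained by some walk, since
-- the graph is finite with positive weights, so this is exactly d ≤ r).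
DistLe : ∀ {n} → (Fin n → Fin n → Bool) → (Fin n → Fin n → ℚ) → Fin n → Fin n → ℚ → Set
DistLe A w u v r = Σ (Walk A u v) λ p → walkWeight w p ≤ r

Connected : ∀ {n} → (Fin n → Fin n → Bool) → Set
Connected {n} A = (u v : Fin n) → Walk A u v

DoublingDim≤ : ∀ {n} → WGraph n → ℕ → Set
DoublingDim≤ {n} G d =
  (c : Fin n) (r : ℚ) → 0ℚ < r →
  Σ (List (Fin n)) λ cs →
    (length cs ℕ.≤ 2 ℕ.^ d) ×
    ((x : Fin n) → DistLe (adj G) (w G) c x r →
       Σ (Fin n) λ c' → (c' ∈ cs) × DistLe (adj G) (w G) c' x (½ * r))

record SpanningSubgraph {n : ℕ} (G : WGraph n) : Set where
  field
    tadj     : Fin n → Fin n → Bool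
    tadj-sym : ∀ u v → tadj u v ≡ tadj v u
    tadj-sub : ∀ u v → tadj u v ≡ true → adj G u v ≡ true
open SpanningSubgraph public

data Path {n : ℕ} (A : Fin n → Fin n → Bool) : List (Fin n) → Set where
  single : ∀ v → Path A (v ∷ [])
  cons   : ∀ {u v vs} → A u v ≡ true → Path A (v ∷ vs) → Path A (u ∷ v ∷ vs)

last : ∀ {n} → Fin n → List (Fin n) → Fin n
last v [] = v
last v (x ∷ xs) = last x xs

HasCycle : ∀ {n} → (Fin n → Fin n → Bool) → Set
HasCycle {n} A = Σ (Fin n) λ v → Σ (List (Fin n)) λ vs →
  Path A (v ∷ vs) × Unique (v ∷ vs) × (2 ℕ.≤ length vs) × (A (last v vs) v ≡ true)

record SpanningTree {n : ℕ} (G : WGraph n) : Set where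
  field
    sub       : SpanningSubgraph G
    connected : Connected (tadj sub)
    acyclic   : HasCycle (tadj sub) → Data.Empty.⊥
open SpanningTree public

-- Spanning t-tree cover: for all u v there is T with d_T(u,v) ≤ t · d_G(u,v).
-- Since d_G(u,v) is attained by a walk, this says: for every walk p of G from
-- u to v, some tree T has a walk from u to v of weight ≤ t · weight(p).
IsTreeCover : ∀ {n} (G : WGraph n) → ℚ → List (SpanningTree G) → Set
IsTreeCover {n} G t Ts =
  (u v : Fin n) → Σ (SpanningTree G) λ T → (T ∈ Ts) ×
    ((p : Walk (adj G) u v) → DistLe (tadj (sub T)) (w G) u v (t * walkWeight (w G) p))

-- Partitions of the vertices at scales h₀ < h₁ < …, each a large constant power of 2 times the
-- previous, serve all distances d with 2^b h < d ≤ 2^(b+1) h, where 2^b ≈ 544/ε: moving both ends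
-- of such a pair to the representatives u, v of their classes costs O(h) ≤ ε d.  A far-apart set
-- of net points at scale 2^b h, one colour of a bounded colouring, lets each of its points q own
-- a spot: the union of the classes near q, containing a shortest path between any two
-- representatives near q.  The next partition is grown out of spots and remaining classes, one
-- shortest-path strand at a time, so that its clusters are connected and of radius O(h).
--
-- The tree is built from the coarsest partition downwards.  Its committed part meets every class
-- in a piece that is geodesic inside the class.  On refining, strands are added along shortest
-- paths until they hit the committed part; adding them colour by colour, where the doubling
-- dimension bounds the number of colours, keeps every vertex within O(h) of the committed part
-- along the final tree.  In every spot, one pair (u , v) of representatives is served first, by
-- an almost shortest path.  All pairs are served by varying the offset of the scales, the colour
-- of the net points, and the positions of u and v in the list of representatives near q:
-- (1/ε)^O(d) choices.
module Submission where

-- A strand stops at a vertex `y` as soon as the class of `y` is touched. `y` itself may stay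
-- uncommitted, and its link to the committed piece of its class appears only at finer scales, so
-- lengths cannot be measured while the tree grows. Every bound therefore speaks of an arbitrary
-- completion `f`, given the promise `Jump` that moving inside a finer class is cheap in `f`. The
-- promise is proved by climbing from the finest partition, where it is trivial, although each tree
-- is built in the opposite direction (`Completes`).
--
-- The promise has to reproduce itself: jumps of 80h at height h must yield jumps of 80h′ at the
-- next height h′. A way through one level uses many jumps, since strands break at touched units and
-- end on other strands. Colours bound both effects, so the cost grows by a factor polynomial in the
-- numbers of colours and of phases, and h′/h is chosen to outweigh it; this is why about (d + 1) b
-- offsets are needed.
--
-- The bound on the jumps comes from the order in which the clusters were grown. A clustering is
-- therefore kept as a log, a `Script`, which the refinement replays.

module Development where

  open import Data.Nat
  open import Data.Nat.Properties
  open import Data.Bool using (Bool; true; false; if_then_else_; _∧_; _∨_; T)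
  open import Data.Bool.Properties using () renaming (_≟_ to _≟ᵇ_)
  open import Data.Unit using (⊤; tt)
  open import Data.Empty using (⊥)
  open import Data.Fin as Fin using (Fin; toℕ)
  import Data.Fin.Properties as Finₚ
  open import Data.Product using (Σ; ∃; ∃-syntax; Σ-syntax; _×_; _,_; proj₁; proj₂)
  open import Data.Sum using (_⊎_; inj₁; inj₂; [_,_]′)
  open import Data.List using (List; []; _∷_; length; map; filter; _++_; cartesianProduct; allFin; upTo)
  import Data.List.Properties as Listₚ
  open import Data.List.Membership.Propositional using (_∈_; _∉_; find; lose)
  open import Data.List.Membership.Propositional.Properties using (∈-filter⁺; ∈-filter⁻; ∈-map⁺; ∈-allFin; ∈-upTo⁺; ∈-upTo⁻; ∈-cartesianProduct⁺; ∈-++⁺ˡ; ∈-++⁺ʳ; ∈-++⁻; ∈-∃++)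
  open import Data.List.Relation.Unary.Any as Any using (Any; here; there)
  open import Data.List.Relation.Unary.All as All using (All; []; _∷_)
  import Data.List.Relation.Unary.All.Properties as Allₚ
  open import Data.List.Relation.Unary.AllPairs as AllPairs using (AllPairs; []; _∷_)
  import Data.List.Relation.Unary.AllPairs.Properties as AllPairsₚ
  open import Relation.Nullary using (¬_; Dec; yes; no; contradiction)
  open import Relation.Nullary.Decidable using (_×-dec_; _⊎-dec_; ¬?; map′; ⌊_⌋; isYes)
  open import Relation.Binary.PropositionalEquality hiding (J)
  open import Function using (_∘_; id; case_of_)
  import Data.List.Relation.Unary.Unique.Propositional.Properties as Uniqueₚ
  open import Data.Maybe using (Maybe; just; nothing)
  open import Data.Maybe.Properties using (just-injective)
  open import Data.Nat.Tactic.RingSolver using (solve-∀)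
  open import Data.List.Relation.Unary.Unique.Propositional using (Unique)
  open import Data.Nat.DivMod using (m%n<n; m≡m%n+[m/n]*n; m*[n/m]≡n)
  open import Data.Nat.Divisibility using (_∣_)
  open import Data.Nat.ListAction using (product)
  open import Data.Nat.ListAction.Properties using (∈⇒∣product; product≢0)
  import Data.Integer as ℤ
  import Data.Integer.Properties as ℤₚ
  open import Data.Rational as ℚ using (ℚ; mkℚ; 0ℚ; 1ℚ; ½)
  import Data.Rational.Properties as ℚₚ
  open import Data.Rational.Unnormalised as ℚᵘ using (mkℚᵘ; *≡*; *≤*)
  import Data.Rational.Unnormalised.Properties as ℚᵘₚ
  import Defs as D

  -- Linear arithmetic over ℕ: a goal is accepted when, after adding up the
  -- hypotheses, every coefficient on the small side is dominated.

  data Lin : Set where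
    var#  : ℕ → Lin
    #_    : ℕ → Lin
    _⊕_   : Lin → Lin → Lin
    _⊛_   : ℕ → Lin → Lin

  infix  9 #_
  infixr 8 _⊛_
  infixl 7 _⊕_
  infix  6 _⊑_
  infix  4 _⊢_

  record Ineq : Set where
    constructor _⊑_
    field smaller larger : Lin
  open Ineq

  record Claim : Set where
    constructor _⊢_
    field
      hyps : List Ineq
      goal : Ineq
  open Claim

  Env : Set
  Env = List ℕ

  look : Env → ℕ → ℕ
  look []       _       = 0
  look (x ∷ _)  zero    = x
  look (_ ∷ xs) (suc i) = look xs i

  ⟦_⟧ : Lin → Env → ℕ
  ⟦ var# i ⟧ ρ = look ρ i
  ⟦ # k ⟧ ρ    = k
  ⟦ a ⊕ b ⟧ ρ  = ⟦ a ⟧ ρ + ⟦ b ⟧ ρ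
  ⟦ k ⊛ a ⟧ ρ  = k * ⟦ a ⟧ ρ

  ⟦_⟧ⁱ : Ineq → Env → Set
  ⟦ a ⊑ b ⟧ⁱ ρ = ⟦ a ⟧ ρ ≤ ⟦ b ⟧ ρ

  Implies : List Ineq → Ineq → Env → Set
  Implies []       g ρ = ⟦ g ⟧ⁱ ρ
  Implies (h ∷ hs) g ρ = ⟦ h ⟧ⁱ ρ → Implies hs g ρ

  module Normal where
    Coeffs : Set
    Coeffs = ℕ × List ℕ

    sumWith : List ℕ → Env → ℕ
    sumWith []       _       = 0
    sumWith (_ ∷ _)  []      = 0
    sumWith (c ∷ cs) (x ∷ ρ) = c * x + sumWith cs ρ

    evalC : Coeffs → Env → ℕ
    evalC (k , cs) ρ = k + sumWith cs ρ

    addL : List ℕ → List ℕ → List ℕ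
    addL []       ds       = ds
    addL (c ∷ cs) []       = c ∷ cs
    addL (c ∷ cs) (d ∷ ds) = (c + d) ∷ addL cs ds

    unit : ℕ → List ℕ
    unit zero    = 1 ∷ []
    unit (suc i) = 0 ∷ unit i

    norm : Lin → Coeffs
    norm (var# i) = 0 , unit i
    norm (# k)    = k , []
    norm (a ⊕ b)  = proj₁ (norm a) + proj₁ (norm b) , addL (proj₂ (norm a)) (proj₂ (norm b))
    norm (k ⊛ a)  = k * proj₁ (norm a) , map (k *_) (proj₂ (norm a))

    private
      swap4 : ∀ a b c d → (a + b) + (c + d) ≡ (a + c) + (b + d)
      swap4 a b c d = begin
        (a + b) + (c + d) ≡⟨ +-assoc a b (c + d) ⟩
        a + (b + (c + d)) ≡⟨ cong (a +_) (sym (+-assoc b c d)) ⟩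
        a + ((b + c) + d) ≡⟨ cong (λ z → a + (z + d)) (+-comm b c) ⟩
        a + ((c + b) + d) ≡⟨ cong (a +_) (+-assoc c b d) ⟩
        a + (c + (b + d)) ≡⟨ sym (+-assoc a c (b + d)) ⟩
        (a + c) + (b + d) ∎
        where open ≡-Reasoning

    sum-add : ∀ cs ds ρ → sumWith (addL cs ds) ρ ≡ sumWith cs ρ + sumWith ds ρ
    sum-add []       ds       ρ       = refl
    sum-add (c ∷ cs) []       ρ       = sym (+-identityʳ _)
    sum-add (c ∷ cs) (d ∷ ds) []      = refl
    sum-add (c ∷ cs) (d ∷ ds) (x ∷ ρ) =
      trans (cong₂ _+_ (*-distribʳ-+ x c d) (sum-add cs ds ρ))
            (swap4 (c * x) (d * x) (sumWith cs ρ) (sumWith ds ρ))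

    sum-unit : ∀ i ρ → sumWith (unit i) ρ ≡ look ρ i
    sum-unit zero    []      = refl
    sum-unit zero    (x ∷ ρ) = trans (+-identityʳ _) (+-identityʳ x)
    sum-unit (suc i) []      = refl
    sum-unit (suc i) (x ∷ ρ) = sum-unit i ρ

    sum-scale : ∀ k cs ρ → sumWith (map (k *_) cs) ρ ≡ k * sumWith cs ρ
    sum-scale k []       ρ       = sym (*-zeroʳ k)
    sum-scale k (c ∷ cs) []      = sym (*-zeroʳ k)
    sum-scale k (c ∷ cs) (x ∷ ρ) =
      trans (cong₂ _+_ (*-assoc k c x) (sum-scale k cs ρ)) (sym (*-distribˡ-+ k (c * x) _))

    norm-sound : ∀ a ρ → evalC (norm a) ρ ≡ ⟦ a ⟧ ρ
    norm-sound (var# i) ρ = sum-unit i ρ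
    norm-sound (# k)    ρ = +-identityʳ k
    norm-sound (a ⊕ b)  ρ =
      trans (cong (proj₁ (norm a) + proj₁ (norm b) +_) (sum-add (proj₂ (norm a)) (proj₂ (norm b)) ρ))
      (trans (swap4 (proj₁ (norm a)) _ _ _) (cong₂ _+_ (norm-sound a ρ) (norm-sound b ρ)))
    norm-sound (k ⊛ a)  ρ =
      trans (cong (k * proj₁ (norm a) +_) (sum-scale k (proj₂ (norm a)) ρ))
      (trans (sym (*-distribˡ-+ k (proj₁ (norm a)) _)) (cong (k *_) (norm-sound a ρ)))

    dominatedL : List ℕ → List ℕ → Bool
    dominatedL []       ds       = true
    dominatedL (c ∷ cs) []       = (c ≤ᵇ 0) ∧ dominatedL cs []
    dominatedL (c ∷ cs) (d ∷ ds) = (c ≤ᵇ d) ∧ dominatedL cs ds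

    dominated : Coeffs → Coeffs → Bool
    dominated (k , cs) (l , ds) = (k ≤ᵇ l) ∧ dominatedL cs ds

    private
      T-∧ : ∀ {a b} → T (a ∧ b) → T a × T b
      T-∧ {true} t = tt , t

    dominatedL-sound : ∀ cs ds ρ → T (dominatedL cs ds) → sumWith cs ρ ≤ sumWith ds ρ
    dominatedL-sound []       ds       ρ       t = z≤n
    dominatedL-sound (c ∷ cs) []       []      t = z≤n
    dominatedL-sound (c ∷ cs) []       (x ∷ ρ) t
      with ≤ᵇ⇒≤ c 0 (proj₁ (T-∧ {c ≤ᵇ 0} t))
    ... | z≤n = dominatedL-sound cs [] ρ (proj₂ (T-∧ {c ≤ᵇ 0} t))
    dominatedL-sound (c ∷ cs) (d ∷ ds) []      t = z≤n
    dominatedL-sound (c ∷ cs) (d ∷ ds) (x ∷ ρ) t =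
      +-mono-≤ (*-monoˡ-≤ x (≤ᵇ⇒≤ c d (proj₁ (T-∧ {c ≤ᵇ d} t))))
               (dominatedL-sound cs ds ρ (proj₂ (T-∧ {c ≤ᵇ d} t)))

    dominated-sound : ∀ p q ρ → T (dominated p q) → evalC p ρ ≤ evalC q ρ
    dominated-sound (k , cs) (l , ds) ρ t =
      +-mono-≤ (≤ᵇ⇒≤ k l (proj₁ (T-∧ {k ≤ᵇ l} t))) (dominatedL-sound cs ds ρ (proj₂ (T-∧ {k ≤ᵇ l} t)))

    -- A hypothesis l ≤ g enters crosswise, turning a ≤ b into a + g ≤ b + l: since b + l ≤ b + g,
    -- the summand g cancels. Each listed hypothesis is used once, with weight 1, so callers supply
    -- the multiples they need.
    check : List Ineq → Lin → Lin → Bool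
    check []             a b = dominated (norm a) (norm b)
    check ((l ⊑ g) ∷ hs) a b = check hs (a ⊕ g) (b ⊕ l)

    check-sound : ∀ hs a b ρ → T (check hs a b) → Implies hs (a ⊑ b) ρ
    check-sound hs a b ρ t = go hs a b t id
      where
      go : ∀ hs a' b' → T (check hs a' b') → (⟦ a' ⟧ ρ ≤ ⟦ b' ⟧ ρ → ⟦ a ⟧ ρ ≤ ⟦ b ⟧ ρ) → Implies hs (a ⊑ b) ρ
      go [] a' b' t k =
        k (subst₂ _≤_ (norm-sound a' ρ) (norm-sound b' ρ) (dominated-sound (norm a') (norm b') ρ t))
      go ((l ⊑ g) ∷ hs) a' b' t k h =
        go hs (a' ⊕ g) (b' ⊕ l) t
          (λ le → k (+-cancelʳ-≤ (⟦ g ⟧ ρ) _ _ (≤-trans le (+-monoʳ-≤ (⟦ b' ⟧ ρ) h))))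

  open Normal using (check; check-sound)

  LinFun : ℕ → Set
  LinFun zero    = Claim
  LinFun (suc n) = Lin → LinFun n

  applyVars : ∀ n → ℕ → LinFun n → Claim
  applyVars zero    _ c = c
  applyVars (suc n) i f = applyVars n (suc i) (f (var# i))

  ForAll : ℕ → (Env → Set) → Set
  ForAll zero    P = P []
  ForAll (suc n) P = ∀ x → ForAll n (λ ρ → P (x ∷ ρ))

  lin : ∀ n (f : LinFun n) →
        let c = applyVars n 0 f in
        {_ : T (check (hyps c) (smaller (goal c)) (larger (goal c)))} →
        ForAll n (Implies (hyps c) (goal c))
  lin n f {t} = intro n _ (λ ρ → check-sound (hyps c) (smaller (goal c)) (larger (goal c)) ρ t)
    where
    c = applyVars n 0 f
    intro : ∀ n (P : Env → Set) → (∀ ρ → P ρ) → ForAll n P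
    intro zero    P p = p []
    intro (suc n) P p = λ x → intro n _ (λ ρ → p (x ∷ ρ))

  -- Powers of two, list lookup and the choice of the scale ratio

  scaled : ℕ → ℕ → ℕ
  scaled g zero    = g
  scaled g (suc i) = 2 * scaled g i

  nth : ∀ {A : Set} → List A → ℕ → Maybe A
  nth []       _       = nothing
  nth (x ∷ _)  zero    = just x
  nth (_ ∷ xs) (suc i) = nth xs i

  nth-∈ : ∀ {A : Set} (xs : List A) i {x} → nth xs i ≡ just x → x ∈ xs
  nth-∈ (x ∷ xs) zero    refl = here refl
  nth-∈ (x ∷ xs) (suc i) e    = there (nth-∈ xs i e)

  ∈-nth : ∀ {A : Set} {xs : List A} {x} → x ∈ xs → ∃[ i ] i < length xs × nth xs i ≡ just x
  ∈-nth (here refl) = 0 , s≤s z≤n , refl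
  ∈-nth (there m)   = let i , lt , e = ∈-nth m in suc i , s≤s lt , e

  length-cartesianProduct : ∀ {A B : Set} (xs : List A) (ys : List B) →
                            length (cartesianProduct xs ys) ≡ length xs * length ys
  length-cartesianProduct []       ys = refl
  length-cartesianProduct (x ∷ xs) ys = trans (Listₚ.length-++ (map (x ,_) ys))
    (cong₂ _+_ (Listₚ.length-map (x ,_) ys) (length-cartesianProduct xs ys))

  scaled-^ : ∀ g i → scaled g i ≡ 2 ^ i * g
  scaled-^ g zero    = sym (*-identityˡ g)
  scaled-^ g (suc i) = trans (cong (2 *_) (scaled-^ g i)) (sym (*-assoc 2 (2 ^ i) g))

  n<2^n : ∀ n → n < 2 ^ n
  n<2^n zero    = s≤s z≤n
  n<2^n (suc n) = lin 2 (λ n p → (# 1 ⊕ n ⊑ p ∷ # 1 ⊕ n ⊑ p ∷ []) ⊢ # 1 ⊕ (# 1 ⊕ n) ⊑ 2 ⊛ p)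
                      n (2 ^ n) (n<2^n n) (n<2^n n)

  1≤2^ : ∀ n → 1 ≤ 2 ^ n
  1≤2^ n = m^n>0 2 n

  -- The number of doublings from one level to the next, for 2 ^ m colours.
  doublings : ℕ → ℕ
  doublings m = suc (m + (m + m)) + (suc (m + (m + m)) + 8)

  module Numerics (m : ℕ) where

    M i x : ℕ
    M = 2 ^ m
    i = doublings m
    x = 2 ^ i

    M³ : ℕ
    M³ = M * (M * M)

    -- With e = 3m + 1 the exponent is e + (e + 8): the first summand pays for 2 ^ e = 2 M³, the
    -- second outgrows the linear factor i + 3 = 2e + 11. The cube comes from the three places where
    -- colours multiply a cost: `γ`, `λ′` and `kmax`.
    enough : (i + 3) * (2 * M³) ≤ x
    enough = begin
      (i + 3) * (2 * M³)     ≡⟨ cong ((i + 3) *_) (sym pow) ⟩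
      (i + 3) * 2 ^ e        ≤⟨ *-monoˡ-≤ (2 ^ e) bound ⟩
      2 ^ (e + 8) * 2 ^ e    ≡⟨ *-comm (2 ^ (e + 8)) (2 ^ e) ⟩
      2 ^ e * 2 ^ (e + 8)    ≡⟨ sym (^-distribˡ-+-* 2 e (e + 8)) ⟩
      x                      ∎
      where
      open ≤-Reasoning
      e : ℕ
      e = suc (m + (m + m))
      pow : 2 ^ e ≡ 2 * M³
      pow = cong (2 *_) (trans (^-distribˡ-+-* 2 m (m + m)) (cong (M *_) (^-distribˡ-+-* 2 m m)))
      half : e + 7 < 2 ^ (e + 7)
      half = n<2^n (e + 7)
      bound : i + 3 ≤ 2 ^ (e + 8)
      bound = subst (λ k → i + 3 ≤ 2 ^ k) (sym (+-suc e 7))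
        (lin 2 (λ e p → (# 1 ⊕ (e ⊕ # 7) ⊑ p ∷ # 1 ⊕ (e ⊕ # 7) ⊑ p ∷ []) ⊢ e ⊕ (e ⊕ # 8) ⊕ # 3 ⊑ 2 ⊛ p)
          e (2 ^ (e + 7)) half half)

    1≤M : 1 ≤ M
    1≤M = 1≤2^ m

    M*-≥ : ∀ a → a ≤ M * a
    M*-≥ a = ≤-trans (≤-reflexive (sym (*-identityˡ a))) (*-monoˡ-≤ a 1≤M)

    kmax : ℕ
    kmax = suc i * M + 1

    -- A cluster has radius at most 4h′ from the lengths of its strands, plus the amount bounded
    -- here, which is lost inside units. The total 8h′ gives the diameter 16h′ of a `Grain`.
    conn-fits : ∀ s → kmax * (3 * (2 * (64 * s))) + 2 * (64 * s) ≤ 4 * (x * (64 * s))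
    conn-fits s = begin
      kmax * (3 * (2 * (64 * s))) + 2 * (64 * s) ≡⟨ regroup kmax (64 * s) ⟩
      (kmax * 3 + 1) * (2 * (64 * s))            ≤⟨ *-monoˡ-≤ (2 * (64 * s)) small ⟩
      2 * x * (2 * (64 * s))                     ≡⟨ double x (64 * s) ⟩
      4 * (x * (64 * s))                         ∎
      where
      open ≤-Reasoning
      regroup : ∀ k t → k * (3 * (2 * t)) + 2 * t ≡ (k * 3 + 1) * (2 * t)
      regroup = solve-∀
      double : ∀ x t → 2 * x * (2 * t) ≡ 4 * (x * t)
      double = solve-∀
      expand : ∀ i p → (i + 3) * (2 * p) ≡ 2 * (i * p) + 6 * p
      expand = solve-∀
      M≤M³ : M ≤ M³
      M≤M³ = ≤-trans (M*-≥ M) (M*-≥ (M * M))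
      small : kmax * 3 + 1 ≤ 2 * x
      small = subst (_≤ 2 * x) (cong (_+ 1) (*-comm 3 kmax))
        (lin 5 (λ m p im ip x → (3 ⊛ m ⊑ 3 ⊛ p ∷ 3 ⊛ im ⊑ 3 ⊛ ip ∷ # 4 ⊑ 4 ⊛ p ∷
                   2 ⊛ (2 ⊛ ip ⊕ 6 ⊛ p) ⊑ 2 ⊛ x ∷ []) ⊢ 3 ⊛ (m ⊕ im ⊕ # 1) ⊕ # 1 ⊑ 2 ⊛ x)
          M M³ (i * M) (i * M³) x (*-monoʳ-≤ 3 M≤M³) (*-monoʳ-≤ 3 (*-monoʳ-≤ i M≤M³))
          (*-monoʳ-≤ 4 (≤-trans 1≤M M≤M³))
          (*-monoʳ-≤ 2 (subst (_≤ x) (expand i M³) enough)))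

    module Cost (h s : ℕ) (h≤s : h ≤ s) where

      -- The costs of `Level`: `α` is a jump in a finest class and `γ` one in a spot; `J` is a jump
      -- in a spot together with the drift of a potential there; `λ′` pays for all colours of one
      -- event, and `κ` for one step of rank.
      D α W γ J λ′ κ : ℕ
      D  = 2 * (64 * s)
      α  = 80 * h
      W  = D + α
      γ  = α + (M * W + (W + (W + D)))
      J  = γ + D
      λ′ = M * 2 * J
      κ  = J + λ′

      s₁ s₂ s₃ : ℕ
      s₁ = M * s
      s₂ = M * s₁
      s₃ = M * s₂

      α≤ : α ≤ 80 * s
      α≤ = *-monoʳ-≤ 80 h≤s

      W≤ : W ≤ 208 * s
      W≤ = lin 2 (λ a s → (a ⊑ 80 ⊛ s ∷ []) ⊢ 2 ⊛ 64 ⊛ s ⊕ a ⊑ 208 ⊛ s) α s α≤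

      MW≤ : M * W ≤ 208 * s₁
      MW≤ = ≤-trans (*-monoʳ-≤ M W≤) (≤-reflexive (swap M s))
        where
        swap : ∀ m s → m * (208 * s) ≡ 208 * (m * s)
        swap = solve-∀

      γ≤ : γ ≤ 832 * s₁
      γ≤ = lin 5 (λ a mw w s t → (a ⊑ 80 ⊛ s ∷ mw ⊑ 208 ⊛ t ∷ w ⊕ w ⊑ 416 ⊛ s ∷ 624 ⊛ s ⊑ 624 ⊛ t ∷ []) ⊢
               a ⊕ (mw ⊕ (w ⊕ (w ⊕ 2 ⊛ 64 ⊛ s))) ⊑ 832 ⊛ t) α (M * W) W s s₁
             α≤ MW≤ (lin 2 (λ w s → (2 ⊛ w ⊑ 2 ⊛ 208 ⊛ s ∷ []) ⊢ w ⊕ w ⊑ 416 ⊛ s) W s (*-monoʳ-≤ 2 W≤))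
             (*-monoʳ-≤ 624 (M*-≥ s))

      J≤ : J ≤ 960 * s₁
      J≤ = lin 3 (λ g s t → (g ⊑ 832 ⊛ t ∷ 128 ⊛ s ⊑ 128 ⊛ t ∷ []) ⊢ g ⊕ 2 ⊛ 64 ⊛ s ⊑ 960 ⊛ t) γ s s₁
             γ≤ (*-monoʳ-≤ 128 (M*-≥ s))

      λ′≤ : λ′ ≤ 1920 * s₂
      λ′≤ = ≤-trans (*-monoʳ-≤ (M * 2) J≤) (≤-reflexive (swap M s₁))
        where
        swap : ∀ m s → m * 2 * (960 * s) ≡ 1920 * (m * s)
        swap = solve-∀

      κ≤ : κ ≤ 2880 * s₂
      κ≤ = lin 4 (λ j l t u → (j ⊑ 960 ⊛ t ∷ l ⊑ 1920 ⊛ u ∷ 960 ⊛ t ⊑ 960 ⊛ u ∷ []) ⊢ j ⊕ l ⊑ 2880 ⊛ u) J λ′ s₁ s₂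
             J≤ λ′≤ (*-monoʳ-≤ 960 (M*-≥ s₁))

      κ-sum : kmax * κ ≤ 2880 * (s₃ + i * s₃ + s₂)
      κ-sum = ≤-trans (*-monoʳ-≤ kmax κ≤) (≤-reflexive (expand i M s₂))
        where
        expand : ∀ i m u → (suc i * m + 1) * (2880 * u) ≡ 2880 * (m * u + i * (m * u) + u)
        expand = solve-∀

      -- All terms are raised to multiples of `s₃` and i `s₃`, and then compared with 44 · 64 = 2816
      -- copies of `enough`.
      cost-fits : γ + γ + kmax * κ + λ′ ≤ 44 * (x * (64 * s))
      cost-fits = lin 9 (λ g k l t u v iv y xs →
          (2 ⊛ g ⊑ 2 ⊛ 832 ⊛ t ∷ k ⊑ 2880 ⊛ (v ⊕ iv ⊕ u) ∷ l ⊑ 1920 ⊛ u ∷ 1664 ⊛ t ⊑ 1664 ⊛ u ∷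
           6464 ⊛ u ⊑ 6464 ⊛ v ∷ 2816 ⊛ (2 ⊛ iv ⊕ 6 ⊛ v) ⊑ 2816 ⊛ xs ∷ 2816 ⊛ xs ⊑ 44 ⊛ y ∷ []) ⊢
          g ⊕ g ⊕ k ⊕ l ⊑ 44 ⊛ y)
        γ (kmax * κ) λ′ s₁ s₂ s₃ (i * s₃) (x * (64 * s)) (x * s)
        (*-monoʳ-≤ 2 γ≤) κ-sum λ′≤ (*-monoʳ-≤ 1664 (M*-≥ s₁)) (*-monoʳ-≤ 6464 (M*-≥ s₂))
        (*-monoʳ-≤ 2816 (subst (_≤ x * s) (expand i M s) (*-monoˡ-≤ s enough))) (≤-reflexive (regroup x s))
        where
        expand : ∀ i m s → (i + 3) * (2 * (m * (m * m))) * s ≡ 2 * (i * (m * (m * (m * s)))) + 6 * (m * (m * (m * s)))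
        expand = solve-∀
        regroup : ∀ x s → 2816 * (x * s) ≡ 44 * (x * (64 * s))
        regroup = solve-∀

  least : {P : ℕ → Set} → (∀ k → Dec (P k)) → ∀ m → P m → ∃[ k ] P k × (∀ j → P j → k ≤ j)
  least {P} P? m pm with P? 0
  ... | yes p0 = 0 , p0 , λ _ _ → z≤n
  least {P} P? zero pm | no ¬p0 = contradiction pm ¬p0
  least {P} P? (suc m) pm | no ¬p0 with least {λ k → P (suc k)} (λ k → P? (suc k)) m pm
  ... | k , pk , min = suc k , pk , λ { zero p → contradiction p ¬p0 ; (suc j) p → s≤s (min j p) }

  summand≤ : ∀ {a b c} → a + b ≡ c → b ≤ c
  summand≤ {a} {b} refl = m≤n+m b a

  -- Routes, distance to a target set, and pointers along shortest routes

  module Routes {n : ℕ} (w : Fin n → Fin n → ℕ) (w-pos : ∀ u v → 1 ≤ w u v)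
                (w-sym : ∀ u v → w u v ≡ w v u) where

    V : Set
    V = Fin n

    Rel : Set₁
    Rel = V → V → Set

    data Route (E : Rel) : V → V → ℕ → Set where
      nil : ∀ {u} → Route E u u 0
      _∷_ : ∀ {u v x ℓ} → E u v → Route E v x ℓ → Route E u x (w u v + ℓ)

    _++ʳ_ : ∀ {E x y z k ℓ} → Route E x y k → Route E y z ℓ → Route E x z (k + ℓ)
    nil ++ʳ s = s
    _++ʳ_ {E} {x} {_} {z} {_} {ℓ} (_∷_ {v = v} {ℓ = k} e r) s =
      subst (Route E x z) (sym (+-assoc (w x v) k ℓ)) (e ∷ (r ++ʳ s))

    mapʳ : ∀ {E F : Rel} → (∀ {u v} → E u v → F u v) → ∀ {x y ℓ} → Route E x y ℓ → Route F x y ℓ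
    mapʳ f nil     = nil
    mapʳ f (e ∷ r) = f e ∷ mapʳ f r

    reverseʳ : ∀ {E : Rel} → (∀ {u v} → E u v → E v u) → ∀ {x y ℓ} → Route E x y ℓ → Route E y x ℓ
    reverseʳ _ nil = nil
    reverseʳ {E} s {x} {y} (_∷_ {v = v} {ℓ = ℓ} e r) =
      subst (Route E y x) (trans (cong (ℓ +_) (trans (+-identityʳ _) (w-sym v x))) (+-comm ℓ (w x v)))
        (reverseʳ s r ++ʳ (s e ∷ nil))

    module Build (E : Rel) (E? : ∀ u v → Dec (E u v)) (T : V → Set) (T? : ∀ v → Dec (T v))
                 (reach : ∀ x → ∃[ t ] ∃[ ℓ ] T t × Route E x t ℓ) where

      -- The fuel makes the search structurally recursive and hence decidable. Every weight is at
      -- least 1, so fuel `ℓ` suffices for routes of length at most `ℓ`.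
      Within : ℕ → V → ℕ → Set
      Within zero    x ℓ = T x
      Within (suc f) x ℓ = T x ⊎ ∃[ y ] (E x y × w x y ≤ ℓ × Within f y (ℓ ∸ w x y))

      within? : ∀ f x ℓ → Dec (Within f x ℓ)
      within? zero    x ℓ = T? x
      within? (suc f) x ℓ =
        T? x ⊎-dec Finₚ.any? (λ y → E? x y ×-dec (w x y ≤? ℓ) ×-dec within? f y (ℓ ∸ w x y))

      within⁺ : ∀ {x t k} f ℓ → T t → Route E x t k → k ≤ ℓ → ℓ ≤ f → Within f x ℓ
      within⁺ zero    ℓ Tt nil     _ _ = Tt
      within⁺ (suc f) ℓ Tt nil     _ _ = inj₁ Tt
      within⁺ {x} zero zero Tt (_∷_ {v = v} {ℓ = k} e r) k≤ℓ _ =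
        contradiction (≤-trans (w-pos x v) (≤-trans (m≤m+n _ k) k≤ℓ)) λ ()
      within⁺ {x} (suc f) ℓ Tt (_∷_ {v = v} {ℓ = k} e r) k≤ℓ ℓ≤f =
        inj₂ (v , e , ≤-trans (m≤m+n _ k) k≤ℓ ,
              within⁺ f (ℓ ∸ w x v) Tt r
                (subst (_≤ ℓ ∸ w x v) (m+n∸m≡n (w x v) k) (∸-monoˡ-≤ (w x v) k≤ℓ))
                (≤-trans (∸-mono ℓ≤f (w-pos x v)) ≤-refl))

      within⁻ : ∀ f {x} ℓ → Within f x ℓ → ∃[ t ] ∃[ k ] T t × k ≤ ℓ × Route E x t k
      within⁻ zero    ℓ Tx = _ , 0 , Tx , z≤n , nil
      within⁻ (suc f) ℓ (inj₁ Tx) = _ , 0 , Tx , z≤n , nil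
      within⁻ (suc f) {x} ℓ (inj₂ (y , e , w≤ℓ , h)) with within⁻ f (ℓ ∸ w x y) h
      ... | t , k , Tt , k≤ , r =
        t , w x y + k , Tt , subst (w x y + k ≤_) (m+[n∸m]≡n w≤ℓ) (+-monoʳ-≤ (w x y) k≤) , e ∷ r

      private
        best : ∀ x → ∃[ k ] Within k x k × (∀ j → Within j x j → k ≤ j)
        best x with reach x
        ... | t , ℓ , Tt , r = least (λ k → within? k x k) ℓ (within⁺ ℓ ℓ Tt r ≤-refl ≤-refl)

      φ : V → ℕ
      φ x = proj₁ (best x)

      φ-min : ∀ {x t ℓ} → T t → Route E x t ℓ → φ x ≤ ℓ
      φ-min {x} {ℓ = ℓ} Tt r = proj₂ (proj₂ (best x)) ℓ (within⁺ ℓ ℓ Tt r ≤-refl ≤-refl)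

      φ-route : ∀ x → ∃[ t ] T t × Route E x t (φ x)
      φ-route x with within⁻ (φ x) (φ x) (proj₁ (proj₂ (best x)))
      ... | t , k , Tt , k≤ , r = t , Tt , subst (Route E x t) (≤-antisym k≤ (φ-min Tt r)) r

      φ-lip : ∀ {x y ℓ} → Route E x y ℓ → φ x ≤ ℓ + φ y
      φ-lip {y = y} r with φ-route y
      ... | _ , Tt , s = φ-min Tt (r ++ʳ s)

      private
        next : ∀ x → ¬ T x → ∃[ y ] E x y × φ x ≡ w x y + φ y
        next x ¬Tx with φ x in eq | φ-route x
        ... | _ | t , Tt , nil = contradiction Tt ¬Tx
        ... | _ | t , Tt , _∷_ {v = y} {ℓ = ℓ} e r =
          y , e , cong (w x y +_) (≤-antisym
            (+-cancelˡ-≤ (w x y) _ _ (subst (_≤ w x y + φ y) eq (≤-trans (φ-lip (e ∷ nil))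
               (≤-reflexive (cong (_+ φ y) (+-identityʳ (w x y)))))))
            (φ-min Tt r))

      private
        step : ∀ x → Dec (T x) → ∃[ y ] (¬ T x → E x y × φ x ≡ w x y + φ y)
        step x (yes Tx) = x , λ ¬Tx → contradiction Tx ¬Tx
        step x (no ¬Tx) = proj₁ (next x ¬Tx) , λ _ → proj₂ (next x ¬Tx)

      nx : V → V
      nx x = proj₁ (step x (T? x))

      nx-step : ∀ x → ¬ T x → E x (nx x) × φ x ≡ w x (nx x) + φ (nx x)
      nx-step x = proj₂ (step x (T? x))

    -- `φ` is the distance to `T` within `E`, and `nx` points along a shortest route. The Lipschitz
    -- law `lipᶠ` is what makes sections of pointer paths geodesic.
    record Flow (E : Rel) (T : V → Set) : Set where
      field
        φ    : V → ℕ
        nx   : V → V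
        zeroᶠ : ∀ {x} → T x → φ x ≡ 0
        stepᶠ : ∀ x → ¬ T x → E x (nx x) × φ x ≡ w x (nx x) + φ (nx x)
        lipᶠ  : ∀ {x y ℓ} → Route E x y ℓ → φ x ≤ ℓ + φ y
        routeᶠ : ∀ x → ∃[ t ] T t × Route E x t (φ x)

      boundᶠ : ∀ {x t ℓ} → T t → Route E x t ℓ → φ x ≤ ℓ
      boundᶠ {x} {t} {ℓ} Tt r =
        subst (φ x ≤_) (trans (cong (ℓ +_) (zeroᶠ Tt)) (+-identityʳ ℓ)) (lipᶠ r)

      descend : ∀ x → ¬ T x → φ (nx x) < φ x
      descend x ¬Tx =
        subst (φ (nx x) <_) (sym (proj₂ (stepᶠ x ¬Tx))) (+-monoˡ-≤ (φ (nx x)) (w-pos x (nx x)))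

    abstract
      flow : (E : Rel) (E? : ∀ u v → Dec (E u v)) (T : V → Set) (T? : ∀ v → Dec (T v)) →
             (∀ x → ∃[ t ] ∃[ ℓ ] T t × Route E x t ℓ) → Flow E T
      flow E E? T T? reach = record
        { φ = φ ; nx = nx ; zeroᶠ = λ Tx → n≤0⇒n≡0 (φ-min Tx nil) ; stepᶠ = nx-step
        ; lipᶠ = φ-lip ; routeᶠ = φ-route }
        where open Build E E? T T? reach

    -- The listed vertices are the ones a strand will commit; the end, the first vertex in `τ`, is
    -- left out of the list.
    data Trace (τ : V → Set) (nx : V → V) : V → List V → V → Set where
      stop : ∀ {x} → τ x → Trace τ nx x [] x
      go   : ∀ {x xs y} → ¬ τ x → Trace τ nx (nx x) xs y → Trace τ nx x (x ∷ xs) y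

    data Chain (P : V → Set) (nx : V → V) : V → V → Set where
      []  : ∀ {x} → Chain P nx x x
      _∷_ : ∀ {x y} → P x → Chain P nx (nx x) y → Chain P nx x y

    map-chain : ∀ {P Q : V → Set} {nx x y} → (∀ {v} → P v → Q v) → Chain P nx x y → Chain Q nx x y
    map-chain f []      = []
    map-chain f (p ∷ c) = f p ∷ map-chain f c

    relax : ∀ {τ τ′ : V → Set} {nx x xs y} → (∀ {v} → τ′ v → τ v) → Trace τ nx x xs y → τ′ y →
            Trace τ′ nx x xs y
    relax sub (stop _)  t = stop t
    relax sub (go ¬h h) t = go (¬h ∘ sub) (relax sub h t)

    module _ {τ : V → Set} {nx : V → V} where

      trace-end : ∀ {x xs y} → Trace τ nx x xs y → τ y
      trace-end (stop t) = t
      trace-end (go _ t) = trace-end t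

      trace-free : ∀ {x xs y v} → Trace τ nx x xs y → v ∈ xs → ¬ τ v
      trace-free (go ¬t _) (here refl) = ¬t
      trace-free (go _ t)  (there m)   = trace-free t m

      trace-start : ∀ {x xs y} → Trace τ nx x xs y → τ x ⊎ x ∈ xs
      trace-start (stop t) = inj₁ t
      trace-start (go _ _) = inj₂ (here refl)

      trace-origin : ∀ {x xs y v} → Trace τ nx x xs y → v ∈ xs → ¬ τ x
      trace-origin (go ¬t _) _ = ¬t

      trace-next : ∀ {x xs y v} → Trace τ nx x xs y → v ∈ xs → nx v ∈ xs ⊎ nx v ≡ y
      trace-next (go _ (stop _)) (here refl) = inj₂ refl
      trace-next (go _ (go _ _)) (here refl) = inj₁ (there (here refl))
      trace-next (go _ t) (there m) with trace-next t m
      ... | inj₁ m′ = inj₁ (there m′)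
      ... | inj₂ e  = inj₂ e

      trace-chain : ∀ {x xs y} → Trace τ nx x xs y → Chain (_∈ xs) nx x y
      trace-chain (stop _) = []
      trace-chain (go _ t) = here refl ∷ map-chain there (trace-chain t)

      chain-to : ∀ {x xs y a} → Trace τ nx x xs y → a ∈ xs → Chain (_∈ xs) nx x a
      chain-to (go _ _) (here refl) = []
      chain-to (go _ t) (there m)   = here refl ∷ map-chain there (chain-to t m)

      chain-from : ∀ {x xs y a} → Trace τ nx x xs y → a ∈ xs → Chain (_∈ xs) nx a y
      chain-from t@(go _ _) (here refl) = trace-chain t
      chain-from (go _ t)   (there m)   = map-chain there (chain-from t m)

    module OnFlow {E T} (F : Flow E T) where
      open Flow F

      abstract
        tracing : (τ : V → Set) → (∀ v → Dec (τ v)) → (∀ {v} → T v → τ v) →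
                  ∀ x → ∃[ xs ] ∃[ y ] Trace τ nx x xs y
        tracing τ τ? T⊆τ x = build (φ x) x ≤-refl
          where
          build : ∀ k x → φ x ≤ k → ∃[ xs ] ∃[ y ] Trace τ nx x xs y
          build k x φ≤ with τ? x
          ... | yes t = [] , x , stop t
          build zero x φ≤ | no ¬t =
            contradiction (≤-trans (descend x (¬t ∘ T⊆τ)) φ≤) λ ()
          build (suc k) x φ≤ | no ¬t with build k (nx x) (s≤s⁻¹ (≤-trans (descend x (¬t ∘ T⊆τ)) φ≤))
          ... | xs , y , t = x ∷ xs , y , go ¬t t

      -- Each pointer lowers `φ` by exactly the weight of its edge, so the length telescopes.
      chain-route : ∀ {P : V → Set} {x y} → (∀ {v} → P v → ¬ T v) → Chain P nx x y →
                    ∃[ ℓ ] Route E x y ℓ × ℓ + φ y ≡ φ x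
      chain-route h [] = 0 , nil , refl
      chain-route {x = x} {y} h (p ∷ c) with chain-route h c | stepᶠ x (h p)
      ... | ℓ , r , eq | e , eq′ =
        w x (nx x) + ℓ , e ∷ r ,
        trans (+-assoc (w x (nx x)) ℓ (φ y)) (trans (cong (w x (nx x) +_) eq) (sym eq′))

      module _ {τ : V → Set} (T⊆τ : ∀ {v} → T v → τ v) where

        free : ∀ {x xs y} → Trace τ nx x xs y → ∀ {v} → v ∈ xs → ¬ T v
        free t m = trace-free t m ∘ T⊆τ

        trace-drop : ∀ {x xs y} → Trace τ nx x xs y → φ y ≤ φ x
        trace-drop t with chain-route (free t) (trace-chain t)
        ... | ℓ , _ , eq = summand≤ eq

        below : ∀ {x xs y a} → Trace τ nx x xs y → a ∈ xs → φ a ≤ φ x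
        below t m with chain-route (free t) (chain-to t m)
        ... | ℓ , _ , eq = summand≤ eq

        above-end : ∀ {x xs y a} → Trace τ nx x xs y → a ∈ xs → φ y < φ a
        above-end {xs = xs} t m with chain-from t m
        ... | [] = contradiction (trace-end t) (trace-free t m)
        ... | _∷_ {x = a} p c with chain-route (free t) c
        ... | ℓ , _ , eq = ≤-<-trans (summand≤ eq) (descend a (free t m))

        -- `φ` decreases strictly along a trace, so comparing potentials tells which of two listed
        -- vertices comes first.
        ordered : ∀ {x xs y a b} → Trace τ nx x xs y → a ∈ xs → b ∈ xs → φ b ≤ φ a → Chain (_∈ xs) nx a b
        ordered (go _ _) (here refl) (here refl) _ = []
        ordered t@(go _ _) (here refl) (there m) _ = chain-to t (there m)
        ordered {x = x} (go ¬t t) (there m) (here refl) le =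
          contradiction (≤-<-trans (below t m) (descend x (¬t ∘ T⊆τ))) (≤⇒≯ le)
        ordered (go _ t) (there m) (there m′) le = map-chain there (ordered t m m′ le)

  -- Pigeonhole, by deleting one occurrence of the largest number.
  covered-by : ∀ m (ks : List ℕ) → (∀ c → c < m → c ∈ ks) → m ≤ length ks
  covered-by zero    ks h = z≤n
  covered-by (suc m) ks h with ∈-∃++ (h m ≤-refl)
  ... | as , bs , refl = begin
    suc m                       ≤⟨ s≤s (covered-by m (as ++ bs) h′) ⟩
    suc (length (as ++ bs))     ≡⟨ cong suc (Listₚ.length-++ as) ⟩
    suc (length as + length bs) ≡⟨ sym (+-suc (length as) (length bs)) ⟩
    length as + suc (length bs) ≡⟨ sym (Listₚ.length-++ as) ⟩
    length (as ++ m ∷ bs)       ∎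
    where
    open ≤-Reasoning
    h′ : ∀ c → c < m → c ∈ as ++ bs
    h′ c c<m with ∈-++⁻ as (h c (m<n⇒m<1+n c<m))
    ... | inj₁ i            = ∈-++⁺ˡ i
    ... | inj₂ (here refl)  = contradiction c<m (<-irrefl refl)
    ... | inj₂ (there i)    = ∈-++⁺ʳ as i

  fresh : ∀ m (ks : List ℕ) → length ks < m → ∃[ c ] c < m × c ∉ ks
  fresh m ks len with Any.any? (λ c → ¬? (Any.any? (c ≟_) ks)) (upTo m)
  ... | yes a with find a
  ... | c , c∈ , c∉ = c , ∈-upTo⁻ c∈ , c∉
  fresh m ks len | no none = contradiction (covered-by m ks all) (<⇒≱ len)
    where
    all : ∀ c → c < m → c ∈ ks
    all c c<m with Any.any? (c ≟_) ks
    ... | yes i  = i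
    ... | no ¬i = contradiction (lose (∈-upTo⁺ c<m) ¬i) none

  length-split : ∀ {A : Set} {P : A → Set} (P? : ∀ x → Dec (P x)) xs →
                 length xs ≡ length (filter P? xs) + length (filter (¬? ∘ P?) xs)
  length-split P? [] = refl
  length-split P? (x ∷ xs) with P? x
  ... | yes _ = cong suc (length-split P? xs)
  ... | no _  = trans (cong suc (length-split P? xs)) (sym (+-suc _ _))

  -- Finite metrics: nets, greedy colourings and packing

  record Network : Set₁ where
    field
      {n}     : ℕ
      w       : Fin n → Fin n → ℕ
      w-pos   : ∀ u v → 1 ≤ w u v
      w-sym   : ∀ u v → w u v ≡ w v u
    open Routes w w-pos w-sym public
    field
      Adj     : Rel
      Adj?    : ∀ u v → Dec (Adj u v)
      Adj-sym : ∀ {u v} → Adj u v → Adj v u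
      connected : ∀ u v → ∃[ ℓ ] Route Adj u v ℓ

  module Metric (G : Network) where

    open Network G public

    toward : ∀ v → Flow Adj (_≡ v)
    toward v = flow Adj Adj? (_≡ v) (Fin._≟ v)
      (λ x → v , proj₁ (connected x v) , refl , proj₂ (connected x v))

    abstract
      d : V → V → ℕ
      d u v = Flow.φ (toward v) u

      d-route : ∀ u v → Route Adj u v (d u v)
      d-route u v with Flow.routeᶠ (toward v) u
      ... | _ , refl , r = r

      d-min : ∀ {u v ℓ} → Route Adj u v ℓ → d u v ≤ ℓ
      d-min {v = v} = Flow.boundᶠ (toward v) refl

      d-refl : ∀ u → d u u ≡ 0
      d-refl u = Flow.zeroᶠ (toward u) refl

      d-tri : ∀ u v x → d u x ≤ d u v + d v x
      d-tri u v x = d-min (d-route u v ++ʳ d-route v x)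

      d-sym : ∀ u v → d u v ≡ d v u
      d-sym u v = ≤-antisym (d-min (reverseʳ Adj-sym (d-route v u))) (d-min (reverseʳ Adj-sym (d-route u v)))

      d-tri′ : ∀ u v x → d u x ≤ d v u + d v x
      d-tri′ u v x = subst (λ k → d u x ≤ k + d v x) (d-sym u v) (d-tri u v x)

    Apart : ℕ → List V → Set
    Apart s = AllPairs (λ x y → s < d x y)

    net : ℕ → List V → List V
    net s [] = []
    net s (x ∷ xs) with Any.any? (λ y → d x y ≤? s) (net s xs)
    ... | yes _ = net s xs
    ... | no _  = x ∷ net s xs

    net-apart : ∀ s xs → Apart s (net s xs)
    net-apart s [] = []
    net-apart s (x ∷ xs) with Any.any? (λ y → d x y ≤? s) (net s xs)
    ... | yes _   = net-apart s xs
    ... | no none = All.map ≰⇒> (Allₚ.¬Any⇒All¬ _ none) ∷ net-apart s xs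

    net-cover : ∀ s xs {x} → x ∈ xs → ∃[ z ] z ∈ net s xs × d x z ≤ s
    net-cover s (x ∷ xs) m with Any.any? (λ y → d x y ≤? s) (net s xs)
    net-cover s (x ∷ xs) (here refl) | yes a with find a
    ... | z , z∈ , le = z , z∈ , le
    net-cover s (x ∷ xs) (there m) | yes _ = net-cover s xs m
    net-cover s (x ∷ xs) (here refl) | no _ = x , here refl , subst (_≤ s) (sym (d-refl x)) z≤n
    net-cover s (x ∷ xs) (there m) | no _ with net-cover s xs m
    ... | z , z∈ , le = z , there z∈ , le

    record Colouring (R : V → V → Set) (Q : ℕ) (vs : List V) : Set where
      field
        colour : V → ℕ
        colour< : ∀ {v} → v ∈ vs → colour v < Q
        proper : ∀ {u v} → u ∈ vs → v ∈ vs → u ≢ v → R u v → colour u ≢ colour v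

    -- Greedy: `x` together with its earlier neighbours is an apart set near `x`, of size at most
    -- `Q`, so the neighbours alone leave a colour free.
    colouring : ∀ {R : V → V → Set} (R? : ∀ u v → Dec (R u v)) (R-refl : ∀ u → R u u)
                (R-sym : ∀ {u v} → R u v → R v u) {s} Q →
                (∀ c ys → Apart s ys → All (R c) ys → length ys ≤ Q) →
                ∀ vs → Apart s vs → Colouring R Q vs
    colouring R? R-refl R-sym Q bound [] _ = record
      { colour = λ _ → 0 ; colour< = λ () ; proper = λ () }
    colouring {R} R? R-refl R-sym Q bound (x ∷ vs) (ax ∷ avs) = record
      { colour = col ; colour< = col< ; proper = prop }
      where
      rec = colouring R? R-refl R-sym Q bound vs avs
      open Colouring rec
      near = filter (R? x) vs
      enough : length (map colour near) < Q
      enough = subst (_< Q) (sym (Listₚ.length-map colour near))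
        (bound x (x ∷ near) (Allₚ.filter⁺ (R? x) ax ∷ AllPairsₚ.filter⁺ (R? x) avs)
               (R-refl x ∷ Allₚ.all-filter (R? x) vs))
      new = fresh Q (map colour near) enough
      col : V → ℕ
      col v with v Fin.≟ x
      ... | yes _ = proj₁ new
      ... | no _  = colour v
      col< : ∀ {v} → v ∈ x ∷ vs → col v < Q
      col< {v} m with v Fin.≟ x
      col< m | yes _ = proj₁ (proj₂ new)
      col< (here refl) | no ne = contradiction refl ne
      col< (there m)   | no _  = colour< m
      clash : ∀ {v} → v ∈ vs → R x v → proj₁ new ≢ colour v
      clash m r eq = proj₂ (proj₂ new) (subst (_∈ map colour near) (sym eq) (∈-map⁺ colour (∈-filter⁺ (R? x) m r)))
      rest : ∀ {v} → v ∈ x ∷ vs → v ≢ x → v ∈ vs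
      rest (here e)  ne = contradiction e ne
      rest (there m) _  = m
      prop : ∀ {u v} → u ∈ x ∷ vs → v ∈ x ∷ vs → u ≢ v → R u v → col u ≢ col v
      prop {u} {v} mu mv ne r with u Fin.≟ x | v Fin.≟ x
      ... | yes refl | yes refl = contradiction refl ne
      ... | yes refl | no nv    = clash (rest mv nv) r
      ... | no nu    | yes refl = clash (rest mu nu) (R-sym r) ∘ sym
      ... | no nu    | no nv    = proper (rest mu nu) (rest mv nv) ne r

    module Doubling (dim : ℕ)
                    (halve : ∀ c h → Σ[ cs ∈ List V ] length cs ≤ 2 ^ dim ×
                                     (∀ x → d c x ≤ 2 * h → ∃[ c′ ] c′ ∈ cs × d c′ x ≤ h)) where

      -- Halving the radius `j` times, at a factor 2 ^ `dim` each, leaves balls of radius `h`, which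
      -- cannot hold two points more than 2h apart.
      packing : ∀ h j c xs → Apart (2 * h) xs → All (λ x → d c x ≤ 2 ^ j * h) xs → length xs ≤ 2 ^ (dim * j)
      packing h j c [] _ _ = z≤n
      packing h zero c (x ∷ []) _ _ = subst (λ k → 1 ≤ 2 ^ k) (sym (*-zeroʳ dim)) ≤-refl
      packing h zero c (x ∷ y ∷ _) ((lt ∷ _) ∷ _) (px ∷ py ∷ _) =
        contradiction lt (≤⇒≯ (≤-trans (d-tri′ x c y)
          (lin 3 (λ a b h → (a ⊑ h ⊕ # 0 ∷ b ⊑ h ⊕ # 0 ∷ []) ⊢ a ⊕ b ⊑ 2 ⊛ h) (d c x) (d c y) h px py)))
      packing h (suc j) c xs ap near = begin
        length xs                     ≤⟨ split (proj₁ cov) xs ap (All.map cover near) ⟩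
        length (proj₁ cov) * 2 ^ (dim * j) ≤⟨ *-monoˡ-≤ (2 ^ (dim * j)) (proj₁ (proj₂ cov)) ⟩
        2 ^ dim * 2 ^ (dim * j)       ≡⟨ sym (^-distribˡ-+-* 2 dim (dim * j)) ⟩
        2 ^ (dim + dim * j)           ≡⟨ cong (2 ^_) (sym (*-suc dim j)) ⟩
        2 ^ (dim * suc j)             ∎
        where
        open ≤-Reasoning
        cov = halve c (2 ^ j * h)
        cover : ∀ {x} → d c x ≤ 2 ^ suc j * h → ∃[ c′ ] c′ ∈ proj₁ cov × d c′ x ≤ 2 ^ j * h
        cover {x} le = proj₂ (proj₂ cov) x (subst (d c x ≤_) (*-assoc 2 (2 ^ j) h) le)
        split : ∀ cs xs → Apart (2 * h) xs → All (λ x → ∃[ c′ ] c′ ∈ cs × d c′ x ≤ 2 ^ j * h) xs →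
                length xs ≤ length cs * 2 ^ (dim * j)
        split [] [] _ _ = z≤n
        split [] (x ∷ xs) _ ((_ , () , _) ∷ _)
        split (c ∷ cs) xs ap cov = begin
          length xs ≡⟨ length-split in? xs ⟩
          length (filter in? xs) + length (filter (¬? ∘ in?) xs)
            ≤⟨ +-mono-≤ (packing h j c (filter in? xs) (AllPairsₚ.filter⁺ in? ap) (Allₚ.all-filter in? xs))
                        (split cs (filter (¬? ∘ in?) xs) (AllPairsₚ.filter⁺ (¬? ∘ in?) ap)
                          (All.zipWith other (Allₚ.all-filter (¬? ∘ in?) xs , Allₚ.filter⁺ (¬? ∘ in?) cov))) ⟩
          2 ^ (dim * j) + length cs * 2 ^ (dim * j) ∎
          where
          in? = λ x → d c x ≤? 2 ^ j * h
          other : ∀ {x} → ¬ (d c x ≤ 2 ^ j * h) × (∃[ c′ ] c′ ∈ c ∷ cs × d c′ x ≤ 2 ^ j * h) →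
                  ∃[ c′ ] c′ ∈ cs × d c′ x ≤ 2 ^ j * h
          other (ne , c′ , here refl , le) = contradiction le ne
          other (_  , c′ , there m , le)   = c′ , m , le

      abstract
        near-colouring : ∀ h j vs → Apart (2 * h) vs →
                         Colouring (λ u v → d u v ≤ 2 ^ j * h) (2 ^ (dim * j)) vs
        near-colouring h j = colouring (λ u v → d u v ≤? 2 ^ j * h)
          (λ u → subst (_≤ 2 ^ j * h) (sym (d-refl u)) z≤n)
          (λ {u} {v} → subst (_≤ 2 ^ j * h) (d-sym u v))
          (2 ^ (dim * j)) (packing h j)

  octave : ∀ g → 1 ≤ g → ∀ D → g < D → ∃[ k ] 2 ^ k * g < D × D ≤ 2 * (2 ^ k * g)
  octave g 1≤g D g<D with least (λ k → D ≤? 2 ^ k * g) D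
    (≤-trans (<⇒≤ (n<2^n D)) (≤-trans (≤-reflexive (sym (*-identityʳ (2 ^ D)))) (*-monoʳ-≤ (2 ^ D) 1≤g)))
  ... | zero  , le , _   = contradiction (≤-trans g<D (≤-trans le (≤-reflexive (*-identityˡ g)))) (n≮n g)
  ... | suc k , le , min = k , ≰⇒> (λ le′ → n≮n k (min k le′)) , ≤-trans le (≤-reflexive (*-assoc 2 (2 ^ k) g))

  record Tree (G : Network) : Set where
    open Network G
    field
      tadj      : V → V → Bool
      tadj-sym  : ∀ u v → tadj u v ≡ tadj v u
      tadj-adj  : ∀ {u v} → tadj u v ≡ true → Adj u v
      connected : D.Connected tadj
      acyclic   : D.HasCycle tadj → ⊥

    Edgeᵗ : Rel
    Edgeᵗ u v = tadj u v ≡ true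

  record TreeFamily (G : Network) (N β : ℕ) : Set where
    open Metric G using (d)
    open Network G using (V; Route)
    field
      trees : List (Tree G)
      size  : length trees ≡ N
      short : ∀ (x y : V) → ∃[ t ] t ∈ trees × ∃[ ℓ ] β * ℓ ≤ (β + 544) * d x y × Route (Tree.Edgeᵗ t) x y ℓ

  -- Partial trees and the strands that extend them

  module States (G : Network) (r : Fin (Network.n G)) where

    open Metric G public

    -- A partial tree: every vertex of S other than the root r has chosen its
    -- parent edge for good.
    record State : Set where
      field
        S      : V → Bool
        par    : V → V
        par-adj : ∀ {x} → S x ≡ true → x ≢ r → Adj x (par x)
        root-in : S r ≡ true
    open State public

    In : State → V → Set
    In s x = S s x ≡ true

    Edge : State → Rel
    Edge s u v = (In s u × u ≢ r × par s u ≡ v) ⊎ (In s v × v ≢ r × par s v ≡ u)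

    edge-adj : ∀ s {u v} → Edge s u v → Adj u v
    edge-adj s (inj₁ (i , ne , refl)) = par-adj s i ne
    edge-adj s (inj₂ (i , ne , refl)) = Adj-sym (par-adj s i ne)

    edge-sym : ∀ s {u v} → Edge s u v → Edge s v u
    edge-sym s (inj₁ e) = inj₂ e
    edge-sym s (inj₂ e) = inj₁ e

    record Joined (s : State) (u v : V) (ℓ : ℕ) : Set where
      constructor joined
      field
        {len} : ℕ
        len≤  : len ≤ ℓ
        route : Route (Edge s) u v len

    joined-refl : ∀ {s u} → Joined s u u 0
    joined-refl = joined z≤n nil

    joined-sym : ∀ {s u v ℓ} → Joined s u v ℓ → Joined s v u ℓ
    joined-sym {s} (joined le r) = joined le (reverseʳ (edge-sym s) r)

    joined-trans : ∀ {s u v x k ℓ} → Joined s u v k → Joined s v x ℓ → Joined s u x (k + ℓ)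
    joined-trans (joined le r) (joined le′ r′) = joined (+-mono-≤ le le′) (r ++ʳ r′)

    joined-≤ : ∀ {s u v k ℓ} → k ≤ ℓ → Joined s u v k → Joined s u v ℓ
    joined-≤ h (joined le r) = joined (≤-trans le h) r

    infix 4 _⊆ˢ_

    record _⊆ˢ_ (s f : State) : Set where
      constructor extends
      field kept : ∀ {x} → In s x → In f x × par f x ≡ par s x
    open _⊆ˢ_ public

    ⊆ˢ-refl : ∀ {s} → s ⊆ˢ s
    ⊆ˢ-refl = extends λ i → i , refl

    ⊆ˢ-trans : ∀ {s t f} → s ⊆ˢ t → t ⊆ˢ f → s ⊆ˢ f
    ⊆ˢ-trans p q = extends λ i →
      proj₁ (kept q (proj₁ (kept p i))) , trans (proj₂ (kept q (proj₁ (kept p i)))) (proj₂ (kept p i))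

    in-mono : ∀ {s f} → s ⊆ˢ f → ∀ {x} → In s x → In f x
    in-mono p i = proj₁ (kept p i)

    edge-mono : ∀ {s f} → s ⊆ˢ f → ∀ {u v} → Edge s u v → Edge f u v
    edge-mono p (inj₁ (i , ne , e)) = inj₁ (proj₁ (kept p i) , ne , trans (proj₂ (kept p i)) e)
    edge-mono p (inj₂ (i , ne , e)) = inj₂ (proj₁ (kept p i) , ne , trans (proj₂ (kept p i)) e)

    joined-mono : ∀ {s f} → s ⊆ˢ f → ∀ {u v ℓ} → Joined s u v ℓ → Joined f u v ℓ
    joined-mono p (joined le r) = joined le (mapʳ (edge-mono p) r)

    Inside : (V → V) → Rel
    Inside key u v = Adj u v × key u ≡ key v

    inside-key : ∀ {key u v ℓ} → Route (Inside key) u v ℓ → key u ≡ key v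
    inside-key nil = refl
    inside-key ((_ , e) ∷ r) = trans e (inside-key r)

    inside-sym : ∀ {key u v} → Inside key u v → Inside key v u
    inside-sym (a , e) = Adj-sym a , sym e

    inside? : ∀ key u v → Dec (Inside key u v)
    inside? key u v = Adj? u v ×-dec (key u Fin.≟ key v)

    Touched : State → (V → V) → V → Set
    Touched s key x = ∃[ p ] In s p × key p ≡ key x

    touched? : ∀ s key x → Dec (Touched s key x)
    touched? s key x = Finₚ.any? (λ p → (S s p ≟ᵇ true) ×-dec (key p Fin.≟ key x))

    touched-mono : ∀ {s f} → s ⊆ˢ f → ∀ {key x} → Touched s key x → Touched f key x
    touched-mono p (q , i , e) = q , proj₁ (kept p i) , e

    -- Inside a class the committed part is a single geodesic strand.
    Geo : State → (V → V) → Set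
    Geo s key = ∀ {p p′ ℓ} → In s p → In s p′ → Route (Inside key) p p′ ℓ → Joined s p p′ ℓ

    -- The price of reaching the strand of a class from any of its vertices.
    Jump : State → State → (V → V) → ℕ → Set
    Jump f s key α = ∀ {x p} → key x ≡ key p → In s p → Joined f x p α

    jump-anti : ∀ {f s t key α} → s ⊆ˢ t → Jump f t key α → Jump f s key α
    jump-anti p j e i = j e (proj₁ (kept p i))

    -- `y` becomes the parent of the last vertex of the strand. Only its class is known to be
    -- touched, so later bounds continue from `y` by a jump to a committed vertex of that class.
    record Extension (s : State) (key : V → V) {E T} (F : Flow E T) (x : V) : Set where
      open Flow F
      field
        s′    : State
        grow  : s ⊆ˢ s′
        xs    : List V
        y     : V
        trace : Trace (Touched s key) nx x xs y
        clear : ∀ {v} → v ∈ xs → ¬ T v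
        new   : ∀ {v} → In s′ v → In s v ⊎ v ∈ xs
        mem   : ∀ {v} → v ∈ xs → In s′ v
        joins : ∀ {a b} → Chain (_∈ xs) nx a b → ∃[ ℓ ] ℓ + φ b ≡ φ a × Joined s′ a b ℓ
        geo   : Geo s key → Geo s′ key
        touch : Touched s′ key x

    module _ (s : State) (key : V → V) {E T} (F : Flow E T)
             (E⊆Adj : ∀ {u v} → E u v → Adj u v)
             (inside⊆E : ∀ {u v} → Inside key u v → E u v) where
      open Flow F
      open OnFlow F

      Halt : V → Set
      Halt v = Touched s key v ⊎ T v

      abstract
        -- New vertices lie in untouched classes, so `geo` never compares an old vertex with a new
        -- one. Two new vertices are joined by a section of the strand whose length is a difference
        -- of potentials, and by `lipᶠ` no route inside the class is shorter.
        extend : ∀ {x xs y} → Trace Halt nx x xs y → Touched s key y → Extension s key F x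
        extend {x} {xs} {y} t ty = record
          { s′ = s′ ; grow = grow ; xs = xs ; y = y ; trace = relax inj₁ t ty ; clear = free inj₂ t ; new = new ; mem = mem
          ; joins = joins ; geo = geo ; touch = touch (trace-start (relax inj₁ t ty)) }
          where
          mem? : ∀ v → Dec (v ∈ xs)
          mem? v = Any.any? (v Fin.≟_) xs
          S′ : V → Bool
          S′ v = S s v ∨ ⌊ mem? v ⌋
          par′ : V → V
          par′ v = if S s v then par s v else nx v
          untouched : ∀ {v} → v ∈ xs → ¬ Touched s key v
          untouched m = trace-free t m ∘ inj₁
          new : ∀ {v} → S′ v ≡ true → In s v ⊎ v ∈ xs
          new {v} e with S s v | mem? v
          ... | true  | _     = inj₁ refl
          ... | false | yes m = inj₂ m
          mem : ∀ {v} → v ∈ xs → S′ v ≡ true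
          mem {v} m with S s v | mem? v
          ... | true  | _     = refl
          ... | false | yes _ = refl
          ... | false | no ¬m = contradiction m ¬m
          unset : ∀ {v} → v ∈ xs → S s v ≡ false
          unset {v} m with S s v in eq
          ... | true  = contradiction (v , eq , refl) (untouched m)
          ... | false = refl
          par-old : ∀ {v} → In s v → par′ v ≡ par s v
          par-old e rewrite e = refl
          par-new : ∀ {v} → v ∈ xs → par′ v ≡ nx v
          par-new m rewrite unset m = refl
          not-root : ∀ {v} → v ∈ xs → v ≢ r
          not-root m refl = untouched m (r , root-in s , refl)
          S-old : ∀ {v} → In s v → S′ v ≡ true
          S-old e rewrite e = refl
          s′ : State
          s′ = record
            { S = S′ ; par = par′ ; root-in = S-old (root-in s)
            ; par-adj = λ {v} e ne → case new {v} e of λ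
                { (inj₁ i) → subst (Adj v) (sym (par-old i)) (par-adj s i ne)
                ; (inj₂ m) → subst (Adj v) (sym (par-new m)) (E⊆Adj (proj₁ (stepᶠ v (free inj₂ t m)))) } }
          grow : s ⊆ˢ s′
          grow = extends λ i → S-old i , par-old i
          joins : ∀ {a b} → Chain (_∈ xs) nx a b → ∃[ ℓ ] ℓ + φ b ≡ φ a × Joined s′ a b ℓ
          joins [] = 0 , refl , joined-refl
          joins {a} {b} (m ∷ c) with joins c
          ... | ℓ , eq , joined le rt =
            w a (nx a) + ℓ ,
            trans (+-assoc (w a (nx a)) ℓ (φ b)) (trans (cong (w a (nx a) +_) eq) (sym (proj₂ (stepᶠ a (free inj₂ t m))))) ,
            joined (+-monoʳ-≤ (w a (nx a)) le) (inj₁ (mem m , not-root m , par-new m) ∷ rt)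
          strand : ∀ {p p′ ℓ} → p ∈ xs → p′ ∈ xs → φ p′ ≤ φ p → Route (Inside key) p p′ ℓ → Joined s′ p p′ ℓ
          strand {p} {p′} m m′ le rt with joins (ordered inj₂ t m m′ le)
          ... | k , eq , jn = joined-≤ (+-cancelʳ-≤ (φ p′) _ _
                  (≤-trans (≤-reflexive eq) (lipᶠ (mapʳ inside⊆E rt)))) jn
          geo : Geo s key → Geo s′ key
          geo g {p} {p′} i i′ rt with new {p} i | new {p′} i′
          ... | inj₁ i₁ | inj₁ i₂ = joined-mono grow (g i₁ i₂ rt)
          ... | inj₁ i₁ | inj₂ m₂ = contradiction (p , i₁ , inside-key rt) (untouched m₂)
          ... | inj₂ m₁ | inj₁ i₂ = contradiction (p′ , i₂ , sym (inside-key rt)) (untouched m₁)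
          ... | inj₂ m₁ | inj₂ m₂ with ≤-total (φ p′) (φ p)
          ... | inj₁ le = strand m₁ m₂ le rt
          ... | inj₂ le = joined-sym (strand m₂ m₁ le (reverseʳ inside-sym rt))
          touch : Touched s key x ⊎ x ∈ xs → Touched s′ key x
          touch (inj₁ h) = touched-mono grow h
          touch (inj₂ m) = x , mem m , refl

      halting : (∀ v → Dec (T v)) → ∀ x → ∃[ xs ] ∃[ y ] Trace Halt nx x xs y
      halting T? = tracing Halt (λ v → touched? s key v ⊎-dec T? v) inj₂

      module _ (T⊆ : ∀ {v} → T v → Touched s key v) where
        extension : ∀ x → Extension s key F x
        extension x with tracing Halt (λ v → map′ inj₁ [ id , T⊆ ]′ (touched? s key v)) inj₂ x
        ... | _ , _ , t = extend t ([ id , T⊆ ]′ (trace-end t))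

    Within-class : (V → V) → ℕ → Set
    Within-class key D = ∀ {x y} → key x ≡ key y → ∃[ ℓ ] ℓ ≤ D × Route (Inside key) x y ℓ

    record Ready (s : State) (key : V → V) : Set where
      field
        touched : ∀ x → Touched s key x
        geo     : Geo s key

    bool-no : ∀ {b} → b ≢ true → b ≡ false
    bool-no {true}  h = contradiction refl h
    bool-no {false} _ = refl

    -- A second trace along the same pointers that stops no later.
    module _ {τ τ′ : V → Set} {nx : V → V} (τ⊆ : ∀ {v} → τ v → τ′ v) where
      shorter : ∀ {x xs xs′ y y′} → Trace τ nx x xs y → Trace τ′ nx x xs′ y′ →
                (∀ {v} → v ∈ xs′ → v ∈ xs) × (y′ ∈ xs ⊎ y′ ≡ y)
      shorter (stop t) (stop _) = (λ ()) , inj₂ refl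
      shorter (stop t) (go ¬t _) = contradiction (τ⊆ t) ¬t
      shorter (go _ _) (stop _) = (λ ()) , inj₁ (here refl)
      shorter (go _ t) (go _ t′) with shorter t t′
      ... | sub , end = (λ { (here e) → here e ; (there m) → there (sub m) }) ,
                        [ inj₁ ∘ there , inj₂ ]′ end

    trace-or-beyond : ∀ {τ P : V → Set} {nx x xs y c} → Trace τ nx x xs y → Chain P nx x c →
                      c ∈ xs ⊎ Chain P nx y c
    trace-or-beyond (stop _) ch = inj₂ ch
    trace-or-beyond (go _ _) [] = inj₁ (here refl)
    trace-or-beyond (go _ t) (_ ∷ ch) with trace-or-beyond t ch
    ... | inj₁ m = inj₁ (there m)
    ... | inj₂ c = inj₂ c

    -- A clustering cl of the units of key, as the log of its construction: each
    -- event is a strand of fresh units that flows into a unit treated before.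
    -- L bounds the length of the way to the seed, rk the number of strands on it.
    module Scripts (key : V → V) where

      reached : (V → Bool) → List V → V → Bool
      reached τ xs v = τ v ∨ ⌊ Any.any? (λ a → key a Fin.≟ key v) xs ⌋

      data Script (cl : V → V) : (V → Bool) → (V → ℕ) → (V → ℕ) → Set₁ where
        seeds : ∀ {seed} → (∀ {u v} → key u ≡ key v → seed u ≡ true → seed v ≡ true) →
                (∀ {v} → seed v ≡ true → key v ≡ key (cl v)) → Script cl seed (λ _ → 0) (λ _ → 0)
        event : ∀ {τ L rk T} → Script cl τ L rk → (F : Flow Adj T) → (∀ {v} → T v → τ v ≡ true) →
                ∀ {x xs y} → Trace (λ v → τ v ≡ true) (Flow.nx F) x xs y → (o k : ℕ) →
                (∀ {v} → key v ≡ key y → L v ≤ o + Flow.φ F v × rk v < k) →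
                (∀ {a} → a ∈ xs → cl a ≡ cl y) →
                Script cl (reached τ xs) (λ v → if τ v then L v else o + Flow.φ F v)
                       (λ v → if τ v then rk v else k)

      reached⁻ : ∀ τ xs {v} → reached τ xs v ≡ true → τ v ≡ true ⊎ ∃[ a ] a ∈ xs × key a ≡ key v
      reached⁻ τ xs {v} e with τ v | Any.any? (λ a → key a Fin.≟ key v) xs
      ... | true  | _     = inj₁ refl
      ... | false | yes m with find m
      ... | a , a∈ , eq = inj₂ (a , a∈ , eq)

      reached⁺ : ∀ τ xs {v} → τ v ≡ true ⊎ (∃[ a ] a ∈ xs × key a ≡ key v) → reached τ xs v ≡ true
      reached⁺ τ xs (inj₁ e) rewrite e = refl
      reached⁺ τ xs {v} (inj₂ (a , m , eq)) with τ v | Any.any? (λ a → key a Fin.≟ key v) xs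
      ... | true  | _      = refl
      ... | false | yes _  = refl
      ... | false | no none = contradiction (lose m eq) none

      closed : ∀ {cl τ L rk} → Script cl τ L rk → ∀ {u v} → key u ≡ key v → τ u ≡ true → τ v ≡ true
      closed (seeds cls _) e t = cls e t
      closed (event {τ = τ} sc F T⊆ {xs = xs} tr o k end same) e t with reached⁻ τ xs t
      ... | inj₁ h            = reached⁺ τ xs (inj₁ (closed sc e h))
      ... | inj₂ (a , m , eq) = reached⁺ τ xs (inj₂ (a , m , trans eq e))

    -- Refining a tree from clusters to their units

    record Split : Set where
      field
        key cl    : V → V
        key⇒cl    : ∀ {u v} → key u ≡ key v → cl u ≡ cl v
        D D′      : ℕ
        unit-conn : Within-class key D
        cl-conn   : Within-class cl D′

    module Stage (P : Split) (γ : ℕ) (s₀ : State) (ready₀ : Ready s₀ (Split.cl P)) where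
      open Split P

      Fits : State → State → Set
      Fits f s = s ⊆ˢ f × Jump f s key γ

      fits-anti : ∀ {f s t} → s ⊆ˢ t → Fits f t → Fits f s
      fits-anti p (q , j) = ⊆ˢ-trans p q , jump-anti p j

      -- What it costs, in any completion f of s, to get from p to the strand of
      -- its class in s₀.
      Cost : State → V → ℕ → Set
      Cost s p b = ∀ f → Fits f s → ∀ {p*} → In s₀ p* → cl p ≡ cl p* → Joined f p p* b

      cost-mono : ∀ {s t p b c} → s ⊆ˢ t → b ≤ c → Cost s p b → Cost t p c
      cost-mono g le co f fit i e = joined-≤ le (co f (fits-anti g fit) i e)

      inside⇒cl : ∀ {u v} → Inside key u v → Inside cl u v
      inside⇒cl (a , e) = a , key⇒cl e

      -- By `Geo` the committed strand is as short as any route inside the class, so the diameter of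
      -- the class bounds it.
      strand-cost : ∀ {s p} → s₀ ⊆ˢ s → In s₀ p → Cost s p D′
      strand-cost g i f (h , _) i* e with cl-conn e
      ... | ℓ , le , rt = joined-mono (⊆ˢ-trans g h) (joined-≤ le (Ready.geo ready₀ i i* rt))

      -- Three legs: along the strand down to its end `y`, a jump of `γ` to the committed vertex `q`
      -- in the unit of `y`, and onwards from `q`.
      leg-cost : ∀ {s E T} {F : Flow E T} {x} (X : Extension s key F x) (let open Extension X) →
                 ∀ {p q e m} → p ∈ xs → Flow.φ F p ≤ m → cl p ≡ cl y → In s q → key q ≡ key y →
                 Cost s q e → Cost s′ p (m + γ + e)
      leg-cost {F = F} X {p} {q} m∈ le e iq kq co f (g , j) i* e* with Extension.joins X (chain-from (Extension.trace X) m∈)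
      ... | ℓ , eq , jn =
        joined-trans (joined-trans (joined-≤ (≤-trans (m≤m+n ℓ _) (≤-trans (≤-reflexive eq) le)) (joined-mono g jn))
                       (j (sym kq) (in-mono grow iq)))
          (co f (fits-anti grow (g , j)) i* (trans (key⇒cl kq) (trans (sym e) e*)))
        where open Extension X

      home : Flow (Inside cl) (In s₀)
      home = flow (Inside cl) (inside? cl) (In s₀) (λ v → S s₀ v ≟ᵇ true) reach
        where
        reach : ∀ x → ∃[ t ] ∃[ ℓ ] In s₀ t × Route (Inside cl) x t ℓ
        reach x with Ready.touched ready₀ x
        ... | p , i , e with cl-conn (sym e)
        ... | ℓ , _ , rt = p , ℓ , i , rt

      home-≤ : ∀ x → Flow.φ home x ≤ D′
      home-≤ x with Ready.touched ready₀ x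
      ... | p , i , e with cl-conn (sym e)
      ... | ℓ , le , rt = ≤-trans (Flow.boundᶠ home i rt) le

      home-extension : ∀ {s} → s₀ ⊆ˢ s → ∀ x → Extension s key home x
      home-extension {s} g = extension s key home proj₁ inside⇒cl (λ {v} i → v , in-mono g i , refl)

      module _ {s T} {F : Flow (Inside cl) T} {x} (X : Extension s key F x) where
        open Extension X
        open OnFlow F
        ext-class : ∀ {p} → p ∈ xs → cl p ≡ cl x
        ext-class m = sym (inside-key (proj₁ (proj₂ (chain-route clear (chain-to trace m)))))
        ext-end : cl y ≡ cl x
        ext-end = sym (inside-key (proj₁ (proj₂ (chain-route clear (trace-chain trace)))))

    record Palette (P : Split) (radius : ℕ) : Set where
      open Split P
      field
        colour  : V → ℕ
        Q       : ℕ
        colour< : ∀ v → colour v < Q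
        colour-far : ∀ {x y} → d x y ≤ radius → key x ≢ key y → colour x ≢ colour y

    module Refine (P : Split) (cl-idem : ∀ v → Split.cl P (Split.cl P v) ≡ Split.cl P v)
                  (C : Palette P (2 * Split.D P)) (γ : ℕ)
                  (s₀ : State) (ready₀ : Ready s₀ (Split.cl P)) where
      open Split P
      open Palette C
      open Scripts key
      open Stage P γ s₀ ready₀

      -- `J` is one jump plus the change `D` of a potential within a unit. An event costs at most
      -- two `J` per colour, in all `λ′`; `κ` is what one step of rank pays for. `BU` is the price
      -- of a base strand: its way home, a jump, and the old strand.
      J λ′ κ BU : ℕ
      J  = γ + D
      λ′ = Q * 2 * J
      κ  = J + λ′
      BU = D′ + γ + D′

      -- The units of the cluster centres are attached to the old strands; they are the seeds of the
      -- script. By `origin`, a cluster whose centre is untouched holds only vertices of `s₀`, so a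
      -- strand from such a centre ends on the old strand, and base strands never chain.
      record Base (vs : List V) : Set where
        field
          s       : State
          grow    : s₀ ⊆ˢ s
          geo     : Geo s key
          origin  : ∀ {p} → In s p → In s₀ p ⊎ Touched s key (cl p)
          cost    : ∀ {p} → In s p → Cost s p BU
          touched : ∀ {v} → v ∈ vs → Touched s key (cl v)

      base-nil : Base []
      base-nil = record
        { s = s₀ ; grow = ⊆ˢ-refl ; geo = λ i i′ rt → Ready.geo ready₀ i i′ (mapʳ inside⇒cl rt)
        ; origin = inj₁ ; touched = λ ()
        ; cost = λ i → cost-mono ⊆ˢ-refl (m≤n+m D′ (D′ + γ)) (strand-cost ⊆ˢ-refl i) }

      base-cons : ∀ v {vs} (bs : Base vs) → Extension (Base.s bs) key home (cl v) → Base (v ∷ vs)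
      base-cons v bs ext = record
        { s = X.s′ ; grow = ⊆ˢ-trans B.grow X.grow ; geo = X.geo B.geo
        ; origin = origin ; cost = cost
        ; touched = λ { (here refl) → X.touch ; (there m) → touched-mono X.grow (B.touched m) } }
        where
        module B = Base bs
        module X = Extension ext
        cl-of : ∀ {p} → p ∈ X.xs → cl p ≡ cl v
        cl-of m = trans (ext-class ext m) (cl-idem v)
        cl-end : cl X.y ≡ cl v
        cl-end = trans (ext-end ext) (cl-idem v)
        origin : ∀ {p} → In X.s′ p → In s₀ p ⊎ Touched X.s′ key (cl p)
        origin i with X.new i
        ... | inj₂ m = inj₂ (subst (Touched X.s′ key) (sym (cl-of m)) X.touch)
        ... | inj₁ j with B.origin j
        ... | inj₁ k = inj₁ k
        ... | inj₂ t = inj₂ (touched-mono X.grow t)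
        cost : ∀ {p} → In X.s′ p → Cost X.s′ p BU
        cost i with X.new i
        ... | inj₁ j = cost-mono X.grow ≤-refl (B.cost j)
        cost {p} i | inj₂ m with trace-end X.trace
        ... | q , iq , kq with B.origin iq
        ... | inj₁ i₀ = leg-cost ext m (home-≤ p) (trans (cl-of m) (sym cl-end)) iq kq
                          (strand-cost B.grow i₀)
        ... | inj₂ t = contradiction (subst (Touched B.s key) (trans (key⇒cl kq) cl-end) t) (trace-origin X.trace m)

      base : ∀ vs → Base vs
      base []       = base-nil
      base (v ∷ vs) = base-cons v (base vs) (home-extension (Base.grow (base vs)) (cl v))

      module Runs (bs : Base (allFin n)) where
        module B = Base bs

        base-cost : ∀ {s p} → B.s ⊆ˢ s → In B.s p → Cost s p BU
        base-cost g i = cost-mono g ≤-refl (B.cost i)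

        record Run (τ : V → Bool) (L rk : V → ℕ) : Set where
          field
            s       : State
            grow    : B.s ⊆ˢ s
            geo     : Geo s key
            touched : ∀ {v} → τ v ≡ true → Touched s key v
            old     : ∀ {p} → In s p → τ p ≡ false → In B.s p
            cost    : ∀ {p} → In s p → τ p ≡ true → Cost s p (BU + L p + rk p * κ + λ′)

        empty? : ∀ (ys : List V) → (∀ {v} → v ∉ ys) ⊎ ∃[ v ] v ∈ ys
        empty? []      = inj₁ λ ()
        empty? (v ∷ _) = inj₂ (v , here refl)

        -- Base strands may have touched units on the way, so the logged strand can only be
        -- committed in pieces, and each gap costs a jump. The pieces are started colour by colour.
        -- A way then meets at most two pieces of each colour, which bounds the jumps by 2 `Q`
        -- however long the strand is.
        module Event {τ L rk T} (sc : Script cl τ L rk) (F : Flow Adj T) (T⊆ : ∀ {v} → T v → τ v ≡ true)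
                     {x xs y} (tr : Trace (λ v → τ v ≡ true) (Flow.nx F) x xs y) (o k : ℕ)
                     (end : ∀ {v} → key v ≡ key y → L v ≤ o + Flow.φ F v × rk v < k)
                     (same : ∀ {a} → a ∈ xs → cl a ≡ cl y) (prev : Run τ L rk) where
          open Flow F
          open OnFlow F
          module P = Run prev

          Reached : V → Set
          Reached v = τ v ≡ true

          -- `o + φ p` and `k` are the length and the rank that the script assigns to the new units;
          -- `m` counts the jumps made inside this event.
          bound : V → ℕ → ℕ
          bound p m = BU + (o + φ p) + k * κ + m * J

          unit-drop : ∀ {u v} → key u ≡ key v → φ u ≤ D + φ v
          unit-drop {v = v} e with unit-conn e
          ... | _ , le , rt = ≤-trans (lipᶠ (mapʳ proj₁ rt)) (+-monoˡ-≤ (φ v) le)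

          record Mid (c : ℕ) : Set where
            field
              s     : State
              grow  : P.s ⊆ˢ s
              geo   : Geo s key
              old   : ∀ {p} → In s p → In P.s p ⊎ p ∈ xs
              cost  : ∀ {p} → In s p → p ∈ xs → Cost s p (bound p (c * 2))
              done  : ∀ {a} → a ∈ xs → colour a < c → Touched s key a

          -- The piece of strand inserted from a at colour c, seen from its vertex p.
          record Piece (c : ℕ) (s : State) (p : V) (todo : List V) : Set where
            field
              a stop′ : V
              p∈    : p ∈ xs
              a∈    : a ∈ xs
              a-col : colour a ≡ c
              lo    : φ stop′ < φ p
              hi    : φ p ≤ φ a
              above : ∀ {b} → b ∈ todo → φ b ≤ φ a
              full  : ∀ {e} → e ∈ xs → φ stop′ < φ e → φ e ≤ φ a → In s e
              -- One jump at this colour, or two; a piece that pays for two descends by at most `D`.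
              price : Cost s p (bound p (1 + c * 2)) ⊎ (φ a ≤ φ stop′ + D × Cost s p (bound p (2 + c * 2)))

          piece-mono : ∀ {c s t p b todo} → s ⊆ˢ t → Piece c s p (b ∷ todo) → Piece c t p todo
          piece-mono g pc = record
            { a = a ; stop′ = stop′ ; p∈ = p∈ ; a∈ = a∈ ; a-col = a-col ; lo = lo ; hi = hi ; above = above ∘ there
            ; full = λ m l h → in-mono g (full m l h)
            ; price = [ inj₁ ∘ cost-mono g ≤-refl , (λ { (q , co) → inj₂ (q , cost-mono g ≤-refl co) }) ]′ price }
            where open Piece pc

          record Round (c : ℕ) (M : Mid c) (todo : List V) : Set where
            field
              s     : State
              grow  : Mid.s M ⊆ˢ s
              geo   : Geo s key
              info  : ∀ {p} → In s p → In (Mid.s M) p ⊎ Piece c s p todo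
              done  : ∀ {a} → a ∈ xs → colour a ≡ c → Touched s key a ⊎ a ∈ todo

          ordered-d : ∀ {a b} → a ∈ xs → b ∈ xs → φ b ≤ φ a → ∀ {m} → φ a ≤ m + φ b → d a b ≤ m
          ordered-d {b = b} ma mb le h with chain-route (free T⊆ tr) (ordered T⊆ tr ma mb le)
          ... | ℓ , rt , eq = ≤-trans (d-min rt) (+-cancelʳ-≤ (φ b) _ _ (≤-trans (≤-reflexive eq) h))

          module Insert (c : ℕ) (M : Mid c) (b : V) (todo : List V) (R : Round c M (b ∷ todo))
                        (rest : Trace Reached nx b (b ∷ todo) y) (rest⊆ : ∀ {v} → v ∈ b ∷ todo → v ∈ xs)
                        (b-col : colour b ≡ c) (ext : Extension (Round.s R) key F b) where
            module M = Mid M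
            module R = Round R

            from-start : P.s ⊆ˢ R.s
            from-start = ⊆ˢ-trans M.grow R.grow

            reached⇒touched : ∀ {v} → Reached v → Touched R.s key v
            reached⇒touched t = touched-mono from-start (P.touched t)

            module X = Extension ext

            sub : ∀ {v} → v ∈ X.xs → v ∈ xs
            sub = rest⊆ ∘ proj₁ (shorter reached⇒touched rest X.trace)

            stops : X.y ∈ xs ⊎ X.y ≡ y
            stops = [ inj₁ ∘ rest⊆ , inj₂ ]′ (proj₂ (shorter reached⇒touched rest X.trace))

            cl-stop : cl X.y ≡ cl y
            cl-stop = [ same , cong cl ]′ stops

            Pays : ℕ → Set
            Pays m = ∀ {p} → p ∈ X.xs → Cost X.s′ p (bound p m)

            pay : ∀ {q e} → In R.s q → key q ≡ key X.y → Cost R.s q e →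
                  ∀ {p m} → p ∈ X.xs → (∀ ℓ → ℓ + φ X.y ≡ φ p → ℓ + γ + e ≤ bound p m) → Cost X.s′ p (bound p m)
            pay {q} {e} iq eq co {p} m∈ arith f (g , j) i* clp with X.joins (chain-from X.trace m∈)
            ... | ℓ , eqℓ , jn = joined-≤ (arith ℓ eqℓ)
              (joined-trans (joined-trans (joined-mono g jn) (j (sym eq) (in-mono X.grow iq)))
                (co f (fits-anti X.grow (g , j)) i*
                  (trans (key⇒cl eq) (trans cl-stop (trans (sym (same (sub m∈))) clp)))))

            q : V
            q = proj₁ (trace-end X.trace)
            iq : In R.s q
            iq = proj₁ (proj₂ (trace-end X.trace))
            kq : key q ≡ key X.y
            kq = proj₂ (proj₂ (trace-end X.trace))

            q-drop : φ q ≤ D + φ X.y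
            q-drop = unit-drop kq

            pay-bound : ∀ m → Cost R.s q (bound q m) → Pays (suc m)
            pay-bound m co {p} m∈ = pay iq kq co {m = suc m} m∈ λ ℓ eq →
              lin 10 (λ ℓ γ BU o φq φp φy kκ mJ D →
                  (ℓ ⊕ φy ⊑ φp ∷ φq ⊑ D ⊕ φy ∷ []) ⊢
                  ℓ ⊕ γ ⊕ (BU ⊕ (o ⊕ φq) ⊕ kκ ⊕ mJ) ⊑ BU ⊕ (o ⊕ φp) ⊕ kκ ⊕ ((γ ⊕ D) ⊕ mJ))
                ℓ γ BU o (φ q) (φ p) (φ X.y) (k * κ) (m * J) D (≤-reflexive eq) q-drop

            b∉ : ∀ {p} → p ∈ X.xs → ¬ Touched R.s key b
            b∉ = trace-origin X.trace

            -- Pieces are inserted from the top down and contain every strand vertex between their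
            -- ends. If `b` were above the end of an earlier piece it would be on it, and its unit
            -- would be touched.
            behind : ∀ {p} → p ∈ X.xs → (pc : Piece c R.s q (b ∷ todo)) → φ b ≤ φ (Piece.stop′ pc)
            behind m∈ pc with φ b ≤? φ (Piece.stop′ pc)
            ... | yes le = le
            ... | no nle = contradiction
              (b , Piece.full pc (rest⊆ (here refl)) (≰⇒> nle) (Piece.above pc (here refl)) , refl) (b∉ m∈)

            -- A piece of the same colour that is met at `q` ended above `b`. As `q` shares a unit
            -- with the stopping vertex, the new piece descends by at most `D`. If the piece met
            -- were short as well, its start and `b` would be within 2D; equal colours would put
            -- them in one unit, but the unit of `b` was untouched.
            settle : Pays (1 + c * 2) ⊎ (φ b ≤ φ X.y + D × Pays (2 + c * 2))
            settle with empty? X.xs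
            ... | inj₁ none = inj₁ λ m∈ → contradiction m∈ none
            ... | inj₂ (e , e∈) = [ at-xs , at-end ]′ stops
              where
              old-q : In P.s q → ¬ Reached q → Pays (1 + c * 2)
              old-q i nt = pay-bound (c * 2) (cost-mono R.grow
                (≤-trans (m≤m+n BU _) (≤-trans (m≤m+n _ (k * κ)) (m≤m+n _ (c * 2 * J))))
                (base-cost (⊆ˢ-trans P.grow M.grow) (P.old i (bool-no nt))))
              at-xs : X.y ∈ xs → Pays (1 + c * 2) ⊎ (φ b ≤ φ X.y + D × Pays (2 + c * 2))
              at-xs my with R.info iq
              ... | inj₁ iM with M.old iM
              ... | inj₁ iP = inj₁ (old-q iP (trace-free tr my ∘ closed sc kq))
              ... | inj₂ mq = inj₁ (pay-bound (c * 2) (cost-mono R.grow ≤-refl (M.cost iM mq)))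
              at-xs my | inj₂ pc with Piece.price pc
              ... | inj₁ good = inj₂ (close , pay-bound (1 + c * 2) good)
                where
                close : φ b ≤ φ X.y + D
                close = lin 5 (λ b s q D y → (b ⊑ s ∷ # 1 ⊕ s ⊑ q ∷ q ⊑ D ⊕ y ∷ []) ⊢ b ⊑ y ⊕ D)
                  (φ b) (φ (Piece.stop′ pc)) (φ q) D (φ X.y) (behind e∈ pc) (Piece.lo pc) q-drop
              ... | inj₂ (short , _) = contradiction
                  (trans (Piece.a-col pc) (sym b-col))
                  (colour-far (ordered-d (Piece.a∈ pc) (rest⊆ (here refl)) (Piece.above pc (here refl)) {2 * D} near)
                     λ e → b∉ e∈ (Piece.a pc , Piece.full pc (Piece.a∈ pc)
                       (<-≤-trans (Piece.lo pc) (Piece.hi pc)) ≤-refl , e))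
                where
                near : φ (Piece.a pc) ≤ 2 * D + φ b
                near = lin 6 (λ a s q D y b →
                    (a ⊑ s ⊕ D ∷ # 1 ⊕ s ⊑ q ∷ q ⊑ D ⊕ y ∷ y ⊑ b ∷ []) ⊢ a ⊑ 2 ⊛ D ⊕ b)
                  (φ (Piece.a pc)) (φ (Piece.stop′ pc)) (φ q) D (φ X.y) (φ b) short (Piece.lo pc) q-drop
                  (trace-drop (reached⇒touched ∘ T⊆) X.trace)
              -- Here the way leaves this event for one of smaller rank: going from `rk q` to `k`
              -- frees `κ` = `J` + `λ′`, enough for the `λ′` in the price of `q`, and the entry `1`
              -- in the bound pays for the jump.
              at-end : X.y ≡ y → Pays (1 + c * 2) ⊎ (φ b ≤ φ X.y + D × Pays (2 + c * 2))
              at-end ey = inj₁ λ {p} m∈ → pay iq kq (cost-mono from-start ≤-refl (P.cost (q-old (R.info iq)) tq)) {m = 1 + c * 2} m∈ λ ℓ eq →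
                  lin 14 (λ ℓ γ BU o φq φp φy kκ cJ D Lq rκ κ λ′ →
                    (ℓ ⊕ φy ⊑ φp ∷ φq ⊑ D ⊕ φy ∷ Lq ⊑ o ⊕ φq ∷ (γ ⊕ D ⊕ λ′) ⊕ rκ ⊑ kκ ∷ []) ⊢
                    ℓ ⊕ γ ⊕ (BU ⊕ Lq ⊕ rκ ⊕ λ′) ⊑ BU ⊕ (o ⊕ φp) ⊕ kκ ⊕ ((γ ⊕ D) ⊕ cJ))
                  ℓ γ BU o (φ q) (φ p) (φ X.y) (k * κ) (c * 2 * J) D (L q) (rk q * κ) κ λ′
                  (≤-reflexive eq) q-drop (proj₁ (end kqy)) (*-monoˡ-≤ κ (proj₂ (end kqy)))
                where
                kqy : key q ≡ key y
                kqy = trans kq (cong key ey)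
                tq : Reached q
                tq = closed sc (sym kqy) (trace-end tr)
                q-old : In (Mid.s M) q ⊎ Piece c R.s q (b ∷ todo) → In P.s q
                q-old (inj₂ pc) = contradiction tq (trace-free tr (Piece.p∈ pc))
                q-old (inj₁ iM) with M.old iM
                ... | inj₁ iP = iP
                ... | inj₂ mq = contradiction tq (trace-free tr mq)

            new-piece : ∀ {p} → p ∈ X.xs → Piece c X.s′ p todo
            new-piece {p} m∈ = record
              { a = b ; stop′ = X.y ; p∈ = sub m∈ ; a∈ = rest⊆ (here refl) ; a-col = b-col
              ; lo = above-end (reached⇒touched ∘ T⊆) X.trace m∈ ; hi = below (reached⇒touched ∘ T⊆) X.trace m∈
              ; above = λ m → below T⊆ rest (there m) ; full = full
              ; price = [ (λ pays → inj₁ (pays m∈)) , (λ { (h , pays) → inj₂ (h , pays m∈) }) ]′ settle }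
              where
              full : ∀ {e} → e ∈ xs → φ X.y < φ e → φ e ≤ φ b → In X.s′ e
              full {e} me lo hi with trace-or-beyond X.trace (ordered T⊆ tr (rest⊆ (here refl)) me hi)
              ... | inj₁ m  = X.mem m
              ... | inj₂ ch with chain-route (free T⊆ tr) ch
              ... | _ , _ , eq = contradiction (summand≤ eq) (<⇒≱ lo)

            result : Round c M todo
            result = record
              { s = X.s′ ; grow = ⊆ˢ-trans R.grow X.grow ; geo = X.geo R.geo ; info = info ; done = done }
              where
              info : ∀ {p} → In X.s′ p → In M.s p ⊎ Piece c X.s′ p todo
              info i with X.new i
              ... | inj₂ m = inj₂ (new-piece m)
              ... | inj₁ j with R.info j
              ... | inj₁ k  = inj₁ k
              ... | inj₂ pc = inj₂ (piece-mono X.grow pc)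
              done : ∀ {a} → a ∈ xs → colour a ≡ c → Touched X.s′ key a ⊎ a ∈ todo
              done m e with R.done m e
              ... | inj₁ t            = inj₁ (touched-mono X.grow t)
              ... | inj₂ (here refl)  = inj₁ X.touch
              ... | inj₂ (there m′)   = inj₂ m′

          skip : ∀ {c M b todo} → colour b ≢ c → Round c M (b ∷ todo) → Round c M todo
          skip {c} {M} {b} {todo} ne R = record
            { s = s ; grow = grow ; geo = geo ; info = info′ ; done = done′ }
            where
            open Round R
            info′ : ∀ {p} → In s p → In (Mid.s M) p ⊎ Piece c s p todo
            info′ i with info i
            ... | inj₁ k  = inj₁ k
            ... | inj₂ pc = inj₂ (piece-mono ⊆ˢ-refl pc)
            done′ : ∀ {a} → a ∈ xs → colour a ≡ c → Touched s key a ⊎ a ∈ todo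
            done′ m e with done m e
            ... | inj₁ t           = inj₁ t
            ... | inj₂ (here refl) = contradiction e ne
            ... | inj₂ (there m′)  = inj₂ m′

          round : ∀ {c} M {b todo} → Trace Reached nx b todo y → (∀ {v} → v ∈ todo → v ∈ xs) →
                  Round c M todo → Round c M []
          round M (stop _) _ R = R
          round {c} M {b} t@(go _ rest) sub R with colour b ≟ c
          ... | yes e = round M rest (sub ∘ there) (Insert.result c M b _ R t sub e
            (extension (Round.s R) key F id proj₁ (touched-mono (⊆ˢ-trans (Mid.grow M) (Round.grow R)) ∘ P.touched ∘ T⊆) b))
          ... | no ne = round M rest (sub ∘ there) (skip {c} {M} ne R)

          first : Mid 0
          first = record
            { s = P.s ; grow = ⊆ˢ-refl ; geo = P.geo ; old = inj₁ ; done = λ _ ()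
            ; cost = λ {p} i m → cost-mono P.grow
                (≤-trans (m≤m+n BU _) (≤-trans (m≤m+n _ (k * κ)) (m≤m+n _ 0)))
                (B.cost (P.old i (bool-no (trace-free tr m)))) }

          next-colour : ∀ {c} → Mid c → Mid (suc c)
          next-colour {c} M = record
            { s = R.s ; grow = ⊆ˢ-trans M.grow R.grow ; geo = R.geo ; old = old ; cost = cost ; done = done }
            where
            module M = Mid M
            R₀ : Round c M xs
            R₀ = record { s = M.s ; grow = ⊆ˢ-refl ; geo = M.geo ; info = inj₁ ; done = λ m _ → inj₂ m }
            module R = Round (round M tr id R₀)
            old : ∀ {p} → In R.s p → In P.s p ⊎ p ∈ xs
            old i with R.info i
            ... | inj₁ j  = M.old j
            ... | inj₂ pc = inj₂ (Piece.p∈ pc)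
            raise : ∀ {p} i → i ≤ 2 → bound p (i + c * 2) ≤ bound p (2 + c * 2)
            raise {p} i le = +-monoʳ-≤ (BU + (o + φ p) + k * κ) (*-monoˡ-≤ J (+-monoˡ-≤ (c * 2) le))
            cost : ∀ {p} → In R.s p → p ∈ xs → Cost R.s p (bound p (suc c * 2))
            cost {p} i m with R.info i
            ... | inj₁ j = cost-mono R.grow (raise {p} 0 z≤n) (M.cost j m)
            ... | inj₂ pc with Piece.price pc
            ... | inj₁ co       = cost-mono ⊆ˢ-refl (raise {p} 1 (s≤s z≤n)) co
            ... | inj₂ (_ , co) = co
            done : ∀ {a} → a ∈ xs → colour a < suc c → Touched R.s key a
            done {a} m lt with m≤n⇒m<n∨m≡n (s≤s⁻¹ lt)
            ... | inj₁ lt′ = touched-mono R.grow (M.done m lt′)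
            ... | inj₂ e with R.done m e
            ... | inj₁ t = t

          mids : ∀ c → Mid c
          mids zero    = first
          mids (suc c) = next-colour (mids c)

          next : Run (reached τ xs) (λ v → if τ v then L v else o + φ v) (λ v → if τ v then rk v else k)
          next = record
            { s = M.s ; grow = ⊆ˢ-trans P.grow M.grow ; geo = M.geo ; touched = touched ; old = old ; cost = cost }
            where
            module M = Mid (mids Q)
            touched : ∀ {v} → reached τ xs v ≡ true → Touched M.s key v
            touched t with reached⁻ τ xs t
            ... | inj₁ h = touched-mono M.grow (P.touched h)
            ... | inj₂ (a , m , e) with M.done m (colour< a)
            ... | p , i , e′ = p , i , trans e′ e
            old : ∀ {p} → In M.s p → reached τ xs p ≡ false → In B.s p
            old {p} i ff with M.old i
            ... | inj₂ m = contradiction (trans (sym ff) (reached⁺ τ xs (inj₂ (p , m , refl)))) λ ()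
            ... | inj₁ j with τ p in eq
            ... | false = P.old j eq
            old i () | inj₁ j | true
            cost : ∀ {p} → In M.s p → reached τ xs p ≡ true →
                   Cost M.s p (BU + (if τ p then L p else o + φ p) + (if τ p then rk p else k) * κ + λ′)
            cost {p} i t with M.old i
            cost {p} i t | inj₂ m rewrite bool-no (trace-free tr m) = M.cost i m
            cost {p} i t | inj₁ j with τ p in eq
            ... | true  = cost-mono M.grow ≤-refl (P.cost j eq)
            ... | false = cost-mono (⊆ˢ-trans P.grow M.grow)
              (≤-trans (m≤m+n BU _) (≤-trans (m≤m+n _ (k * κ)) (m≤m+n _ λ′))) (B.cost (P.old j eq))

        start : ∀ {seed} → (∀ {v} → seed v ≡ true → key v ≡ key (cl v)) → Run seed (λ _ → 0) (λ _ → 0)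
        start seed⇒ = record
          { s = B.s ; grow = ⊆ˢ-refl ; geo = B.geo ; old = λ i _ → i ; touched = touched ∘ seed⇒
          ; cost = λ i _ → cost-mono ⊆ˢ-refl (≤-trans (m≤m+n BU 0) (≤-trans (m≤m+n _ 0) (m≤m+n _ λ′))) (B.cost i) }
          where
          touched : ∀ {v} → key v ≡ key (cl v) → Touched B.s key v
          touched {v} e with B.touched (∈-allFin v)
          ... | p , i , e′ = p , i , trans e′ (sym e)

        run : ∀ {τ L rk} → Script cl τ L rk → Run τ L rk
        run (seeds _ seed⇒) = start seed⇒
        run (event sc F T⊆ tr o k end same) = Event.next sc F T⊆ tr o k end same (run sc)

      refine : ∀ {τ L rk} → Script cl τ L rk → (∀ v → τ v ≡ true) → ∀ Lmax kmax →
               (∀ v → L v ≤ Lmax) → (∀ v → rk v ≤ kmax) →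
               Σ[ s ∈ State ] s₀ ⊆ˢ s × Ready s key ×
                 (∀ f → s ⊆ˢ f → Jump f s key γ → Jump f s₀ cl (γ + (BU + Lmax + kmax * κ + λ′)))
      refine sc all Lmax kmax L≤ rk≤ =
        R.s , ⊆ˢ-trans (Base.grow bs) R.grow , record { touched = λ x → R.touched (all x) ; geo = R.geo } , jump
        where
        bs = base (allFin n)
        open Runs bs
        module R = Run (run sc)
        jump : ∀ f → R.s ⊆ˢ f → Jump f R.s key γ → Jump f s₀ cl (γ + (BU + Lmax + kmax * κ + λ′))
        jump f g j {x} {p} e i with R.touched (all x)
        ... | q , iq , eq = joined-trans (j (sym eq) iq)
          (joined-≤ (+-monoˡ-≤ λ′ (+-mono-≤ (+-monoʳ-≤ BU (L≤ q)) (*-monoˡ-≤ κ (rk≤ q))))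
            (R.cost iq (all q) f (g , j) i (trans (key⇒cl eq) e)))


    -- Refining spots to units while serving one pair in each spot

    record Pair (cl : V → V) : Set where
      field
        u v   : V
        len   : ℕ
        route : Route (Inside cl) u v len

    -- From a ready state of the spots to a ready state of their units, with one
    -- pair of vertices per spot joined by an almost shortest path.
    module Settle (P : Split) (C : Palette P (Split.D′ P)) (α : ℕ)
                  (s₀ : State) (ready₀ : Ready s₀ (Split.cl P)) where
      open Split P
      open Palette C
      open Stage P α s₀ ready₀
      open Pair

      W X₀ : ℕ
      W  = D′ + α
      X₀ = W + (W + D′)

      -- The strands of `u` and `v` may each end in a unit without touching its committed piece: at
      -- most two jumps, and two displacements inside a unit.
      slack : ℕ
      slack = 2 * α + 2 * D

      record Legs (ps : List (Pair cl)) : Set where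
        field
          s      : State
          grow   : s₀ ⊆ˢ s
          geo    : Geo s key
          origin : ∀ {p} → In s p → In s₀ p ⊎ ∃[ pr ] pr ∈ ps × cl p ≡ cl (u pr)
          cost   : ∀ {p} → In s p → Cost s p X₀
          meets  : ∀ {pr} → pr ∈ ps → ∀ f → Fits f s → Joined f (u pr) (v pr) (len pr + slack)

      module Step (pr : Pair cl) {ps : List (Pair cl)} (Lg : Legs ps)
                  (other : ∀ {q} → q ∈ ps → cl (u pr) ≢ cl (u q)) where
        module L = Legs Lg

        A : V → Set
        A x = cl x ≡ cl (u pr)

        v∈A : A (v pr)
        v∈A = sym (inside-key (route pr))

        -- All strands so far belong to pairs in other spots, and they stay inside those.
        main : ∀ {p} → In L.s p → A p → In s₀ p
        main i e with L.origin i
        ... | inj₁ j            = j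
        ... | inj₂ (q , m , e′) = contradiction (trans (sym e) e′) (other m)

        -- A flow needs a target reachable from every vertex, so all vertices outside the spot count
        -- as targets; routes inside the spot never see them.
        Aim : V → V → Set
        Aim t x = x ≡ t ⊎ ¬ A x

        aim : ∀ t → A t → Flow (Inside cl) (Aim t)
        aim t et = flow (Inside cl) (inside? cl) (Aim t)
          (λ x → (x Fin.≟ t) ⊎-dec ¬? (cl x Fin.≟ cl (u pr))) reach
          where
          reach : ∀ x → ∃[ y ] ∃[ ℓ ] Aim t y × Route (Inside cl) x y ℓ
          reach x with cl x Fin.≟ cl (u pr)
          ... | no ne = x , 0 , inj₂ ne , nil
          ... | yes e with cl-conn (trans e (sym et))
          ... | ℓ , _ , rt = t , ℓ , inj₁ refl , rt

        aim-≤ : ∀ {t} (et : A t) {x} → A x → Flow.φ (aim t et) x ≤ D′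
        aim-≤ et ex with cl-conn (trans ex (sym et))
        ... | _ , le , rt = ≤-trans (Flow.boundᶠ (aim _ et) (inj₁ refl) rt) le

        aim-route : ∀ {t} (et : A t) {x} → A x → Route (Inside cl) x t (Flow.φ (aim t et) x)
        aim-route et {x} ex with Flow.routeᶠ (aim _ et) x
        ... | _ , inj₁ refl , rt = rt
        ... | _ , inj₂ ne , rt   = contradiction (trans (sym (inside-key rt)) ex) ne

        Aim? : ∀ t x → Dec (Aim t x)
        Aim? t x = (x Fin.≟ t) ⊎-dec ¬? (cl x Fin.≟ cl (u pr))

        AimHalt : State → (t : V) → A t → V → Set
        AimHalt s t et = Halt s key (aim t et) proj₁ inside⇒cl

        aim-end : ∀ {s t} (et : A t) {a xs y} → A a → Trace (AimHalt s t et) (Flow.nx (aim t et)) a xs y →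
                  A y × (Touched s key y ⊎ y ≡ t)
        aim-end et ea tr with inside-key (proj₁ (proj₂ (chain-route (free inj₂ tr) (trace-chain tr)))) | trace-end tr
          where open OnFlow (aim _ et)
        ... | e | inj₁ h         = trans (sym e) ea , inj₁ h
        ... | e | inj₂ (inj₁ e′) = trans (sym e) ea , inj₂ e′
        ... | e | inj₂ (inj₂ ne) = contradiction (trans (sym e) ea) ne

        aim-trace : ∀ s t (et : A t) a → ∃[ xs ] ∃[ y ] Trace (AimHalt s t et) (Flow.nx (aim t et)) a xs y
        aim-trace s t et a = halting s key (aim t et) proj₁ inside⇒cl (Aim? t) a

        aim-extension : ∀ {s t} (et : A t) {a} → A a → Touched s key t → Extension s key (aim t et) a
        aim-extension {s} {t} et {a} ea tt′ with aim-trace s t et a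
        ... | xs , y , tr = extend s key (aim t et) proj₁ inside⇒cl tr
          ([ id , (λ e → subst (Touched s key) (sym e) tt′) ]′ (proj₂ (aim-end {s} et ea tr)))

        end-joins : ∀ {s T} {F : Flow (Inside cl) T} {a} (X : Extension s key F a) (let open Extension X) →
                    ∃[ ℓ ] ℓ + Flow.φ F y ≡ Flow.φ F a × Joined s′ a y ℓ
        end-joins X = Extension.joins X (trace-chain (Extension.trace X))

        -- Two strands inserted one after the other into the spot of pr.
        module Two {T₁ T₂} {F₁ : Flow (Inside cl) T₁} {F₂ : Flow (Inside cl) T₂} {a b}
                   (X₁ : Extension L.s key F₁ a) (X₂ : Extension (Extension.s′ X₁) key F₂ b)
                   (ea : A a) (eb : A b)
                   (short₁ : ∀ {x} → A x → Flow.φ F₁ x ≤ D′) (short₂ : ∀ {x} → A x → Flow.φ F₂ x ≤ D′) where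
          module X₁ = Extension X₁
          module X₂ = Extension X₂

          in₁ : ∀ {p} → p ∈ X₁.xs → A p
          in₁ m = trans (ext-class X₁ m) ea
          in₂ : ∀ {p} → p ∈ X₂.xs → A p
          in₂ m = trans (ext-class X₂ m) eb
          end₁ : A X₁.y
          end₁ = trans (ext-end X₁) ea
          end₂ : A X₂.y
          end₂ = trans (ext-end X₂) eb

          cost₁ : ∀ {p} → p ∈ X₁.xs → Cost X₁.s′ p (W + D′)
          cost₁ m with trace-end X₁.trace
          ... | q , iq , kq = leg-cost X₁ m (short₁ (in₁ m)) (trans (in₁ m) (sym end₁)) iq kq
                                (strand-cost L.grow (main iq (trans (key⇒cl kq) end₁)))

          cost-in : ∀ {p} → In X₁.s′ p → A p → Cost X₁.s′ p (W + D′)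
          cost-in i e with X₁.new i
          ... | inj₁ j = cost-mono X₁.grow (m≤n+m D′ W) (strand-cost L.grow (main j e))
          ... | inj₂ m = cost₁ m

          cost₂ : ∀ {p} → p ∈ X₂.xs → Cost X₂.s′ p X₀
          cost₂ m with trace-end X₂.trace
          ... | q , iq , kq = leg-cost X₂ m (short₂ (in₂ m)) (trans (in₂ m) (sym end₂)) iq kq
                                (cost-in iq (trans (key⇒cl kq) end₂))

          legs : (∀ f → Fits f X₂.s′ → Joined f (u pr) (v pr) (len pr + slack)) → Legs (pr ∷ ps)
          legs join = record
            { s = X₂.s′ ; grow = ⊆ˢ-trans L.grow (⊆ˢ-trans X₁.grow X₂.grow) ; geo = X₂.geo (X₁.geo L.geo)
            ; origin = origin ; cost = cost
            ; meets = λ { (here refl) → join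
                        ; (there m) f fit → L.meets m f (fits-anti (⊆ˢ-trans X₁.grow X₂.grow) fit) } }
            where
            origin : ∀ {p} → In X₂.s′ p → In s₀ p ⊎ ∃[ q ] q ∈ pr ∷ ps × cl p ≡ cl (u q)
            origin i with X₂.new i
            ... | inj₂ m = inj₂ (pr , here refl , in₂ m)
            ... | inj₁ j with X₁.new j
            ... | inj₂ m = inj₂ (pr , here refl , in₁ m)
            ... | inj₁ k with L.origin k
            ... | inj₁ h            = inj₁ h
            ... | inj₂ (q , m , e) = inj₂ (q , there m , e)
            cost : ∀ {p} → In X₂.s′ p → Cost X₂.s′ p X₀
            cost i with X₂.new i
            ... | inj₂ m = cost₂ m
            ... | inj₁ j with X₁.new j
            ... | inj₂ m = cost-mono X₂.grow (m≤n+m (W + D′) W) (cost₁ m)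
            ... | inj₁ k = cost-mono (⊆ˢ-trans X₁.grow X₂.grow) ≤-refl (L.cost k)

        -- The geodesic from u meets the strand: v then heads for the vertex met.
        module Meeting (X₁ : Extension L.s key (aim (v pr) v∈A) (u pr)) where
          module X₁ = Extension X₁
          open Flow (aim (v pr) v∈A) using (φ; boundᶠ)

          end₁ : A X₁.y
          end₁ = ext-end X₁
          q₁ : V
          q₁ = proj₁ (trace-end X₁.trace)
          iq₁ : In L.s q₁
          iq₁ = proj₁ (proj₂ (trace-end X₁.trace))
          kq₁ : key q₁ ≡ key X₁.y
          kq₁ = proj₂ (proj₂ (trace-end X₁.trace))
          eq₁ : A q₁
          eq₁ = trans (key⇒cl kq₁) end₁

          -- The potential of `v` is at most that of the meeting point plus `D`. If the strand of
          -- `v` runs into that of `u`, it does so above the meeting point, and the two sections add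
          -- up to at most the pair's length. Otherwise it reaches the old strand, where `Geo` makes
          -- the section up to `q₁` no longer than the rest of the way of `v`.
          meeting : Extension X₁.s′ key (aim q₁ eq₁) (v pr) → Legs (pr ∷ ps)
          meeting X₂ = Two.legs X₁ X₂ refl v∈A (aim-≤ v∈A) (aim-≤ eq₁) join
            where
            module X₂ = Extension X₂
            open Flow (aim q₁ eq₁) using () renaming (φ to ψ; boundᶠ to boundψ)
            ψ-v : ψ (v pr) ≤ φ X₁.y + D
            ψ-v with unit-conn (sym kq₁)
            ... | ℓ , le , rt = ≤-trans (boundψ (inj₁ refl)
                    (reverseʳ inside-sym (aim-route v∈A end₁) ++ʳ mapʳ inside⇒cl rt))
                    (+-monoʳ-≤ (φ X₁.y) le)
            join : ∀ f → Fits f X₂.s′ → Joined f (u pr) (v pr) (len pr + slack)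
            join f (g , j) with end-joins X₁ | end-joins X₂ | trace-end X₂.trace
            ... | ℓ₁ , e₁ , j₁ | ℓ₂ , e₂ , j₂ | q₂ , iq₂ , kq₂ with X₁.new iq₂
            ... | inj₂ m with X₁.joins (chain-to X₁.trace m)
            ... | ℓ₃ , e₃ , j₃ =
              joined-≤ (lin 10 (λ ℓ₃ φq φu len ψv ℓ₂ ψy φy D α →
                  (ℓ₃ ⊕ φq ⊑ φu ∷ φu ⊑ len ∷ ℓ₂ ⊕ ψy ⊑ ψv ∷ ψv ⊑ φy ⊕ D ∷ # 1 ⊕ φy ⊑ φq ∷ []) ⊢
                  ℓ₃ ⊕ α ⊕ ℓ₂ ⊑ len ⊕ (2 ⊛ α ⊕ 2 ⊛ D))
                ℓ₃ (φ q₂) (φ (u pr)) (len pr) (ψ (v pr)) ℓ₂ (ψ X₂.y) (φ X₁.y) D α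
                (≤-reflexive e₃) (boundᶠ (inj₁ refl) (route pr)) (≤-reflexive e₂) ψ-v
                (after X₁.clear X₁.trace m))
              (joined-trans (joined-trans (joined-mono (⊆ˢ-trans X₂.grow g) j₃) (joined-sym (j (sym kq₂) (in-mono X₂.grow iq₂))))
                (joined-sym (joined-mono g j₂)))
              where
              after : ∀ {xs y p a} → (∀ {x} → x ∈ xs → ¬ Aim (v pr) x) →
                      Trace (Touched L.s key) (Flow.nx (aim (v pr) v∈A)) a xs y → p ∈ xs → φ y < φ p
              after cl′ t m′ with chain-from t m′
              ... | [] = contradiction (trace-end t) (trace-free t m′)
              ... | _∷_ {x = p} _ c with OnFlow.chain-route (aim (v pr) v∈A) cl′ c
              ... | ℓ , _ , eq = ≤-<-trans (summand≤ eq) (Flow.descend (aim (v pr) v∈A) p (cl′ m′))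
            join f (g , j) | ℓ₁ , e₁ , j₁ | ℓ₂ , e₂ , j₂ | q₂ , iq₂ , kq₂ | inj₁ iL
              with unit-conn kq₂
            ... | ℓ₃ , le₃ , rt₃ =
              joined-≤ (lin 12 (λ ℓ₁ φu len ψv ℓ₂ ψy φy D α ℓ₃ _ _ →
                  (ℓ₁ ⊕ φy ⊑ φu ∷ φu ⊑ len ∷ ℓ₂ ⊕ ψy ⊑ ψv ∷ ψv ⊑ φy ⊕ D ∷ ℓ₃ ⊑ D ∷ []) ⊢
                  ℓ₁ ⊕ α ⊕ (ℓ₃ ⊕ ψy) ⊕ α ⊕ ℓ₂ ⊑ len ⊕ (2 ⊛ α ⊕ 2 ⊛ D))
                ℓ₁ (φ (u pr)) (len pr) (ψ (v pr)) ℓ₂ (ψ X₂.y) (φ X₁.y) D α ℓ₃ 0 0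
                (≤-reflexive e₁) (boundᶠ (inj₁ refl) (route pr)) (≤-reflexive e₂) ψ-v le₃)
              (joined-trans (joined-trans (joined-trans (joined-trans
                (joined-mono (⊆ˢ-trans X₂.grow g) j₁)
                (j (sym kq₁) (in-mono (⊆ˢ-trans X₁.grow X₂.grow) iq₁)))
                (joined-sym (joined-mono (⊆ˢ-trans L.grow (⊆ˢ-trans X₁.grow (⊆ˢ-trans X₂.grow g)))
                  (Ready.geo ready₀ (main iL (trans (key⇒cl kq₂) end₂)) (main iq₁ eq₁)
                    (mapʳ inside⇒cl rt₃ ++ʳ aim-route eq₁ end₂)))))
                (joined-sym (j (sym kq₂) (in-mono X₂.grow iq₂))))
                (joined-sym (joined-mono g j₂)))
              where
              end₂ : A X₂.y
              end₂ = trans (ext-end X₂) v∈A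

        -- The geodesic from u to v avoids the strand: v goes home, u follows it.
        module Avoiding {xs} (tr : Trace (AimHalt L.s (v pr) v∈A) (Flow.nx (aim (v pr) v∈A)) (u pr) xs (v pr))
                        (far : ¬ Touched L.s key (v pr)) (X₁ : Extension L.s key home (v pr)) where
          module X₁ = Extension X₁
          open Flow (aim (v pr) v∈A) using (φ; boundᶠ)
          open Flow home using () renaming (φ to ψ; lipᶠ to lipψ)

          -- Nothing old lies on the path of `u`, so its strand can only end at the way of `v` home.
          -- That way is itself shortest: by the Lipschitz law its section from `v` is no longer
          -- than what `u` still had to go, up to `D`.
          avoiding : Extension X₁.s′ key (aim (v pr) v∈A) (u pr) → Legs (pr ∷ ps)
          avoiding X₂ = Two.legs X₁ X₂ v∈A refl (λ {x} _ → home-≤ x) (aim-≤ v∈A) join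
            where
            module X₂ = Extension X₂
            stops : X₂.y ∈ xs ⊎ X₂.y ≡ v pr
            stops = proj₂ (shorter [ touched-mono X₁.grow , (λ e → subst (Touched X₁.s′ key) (sym e) X₁.touch) ]′
              (relax {τ′ = λ x → Touched L.s key x ⊎ x ≡ v pr} [ inj₁ , inj₂ ∘ inj₁ ]′ tr (inj₂ refl)) X₂.trace)
            untouched : ¬ Touched L.s key X₂.y
            untouched t with stops
            ... | inj₁ m = trace-free tr m (inj₁ t)
            ... | inj₂ e = far (subst (Touched L.s key) e t)
            end₂ : A X₂.y
            end₂ = ext-end X₂
            join : ∀ f → Fits f X₂.s′ → Joined f (u pr) (v pr) (len pr + slack)
            join f (g , j) with end-joins X₂ | trace-end X₂.trace
            ... | ℓ₂ , e₂ , j₂ | q , iq , kq with X₁.new iq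
            ... | inj₁ iL = contradiction (q , iL , kq) untouched
            ... | inj₂ m with X₁.joins (chain-to X₁.trace m) | unit-conn (sym kq)
            ... | ℓ₁ , e₁ , j₁ | ℓ₃ , le₃ , rt₃ =
              joined-≤ (lin 10 (λ ℓ₂ φy φu len ℓ₁ ψq ψv D α ℓ₃ →
                  (ℓ₂ ⊕ φy ⊑ φu ∷ φu ⊑ len ∷ ℓ₁ ⊕ ψq ⊑ ψv ∷ ψv ⊑ φy ⊕ ℓ₃ ⊕ ψq ∷ ℓ₃ ⊑ D ∷ []) ⊢
                  ℓ₂ ⊕ α ⊕ ℓ₁ ⊑ len ⊕ (2 ⊛ α ⊕ 2 ⊛ D))
                ℓ₂ (φ X₂.y) (φ (u pr)) (len pr) ℓ₁ (ψ q) (ψ (v pr)) D α ℓ₃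
                (≤-reflexive e₂) (boundᶠ (inj₁ refl) (route pr)) (≤-reflexive e₁)
                (lipψ (reverseʳ inside-sym (aim-route v∈A end₂) ++ʳ mapʳ inside⇒cl rt₃)) le₃)
              (joined-trans (joined-trans (joined-mono g j₂) (j (sym kq) (in-mono X₂.grow iq)))
                (joined-sym (joined-mono (⊆ˢ-trans X₂.grow g) j₁)))

        step : Legs (pr ∷ ps)
        step with aim-trace L.s (v pr) v∈A (u pr)
        ... | xs , y , tr with touched? L.s key y | aim-end {L.s} v∈A refl tr
        ... | yes ty | _ = meeting (aim-extension eq₁ v∈A (q₁ , in-mono (Extension.grow X₁) iq₁ , refl))
          where
          X₁ = extend L.s key (aim (v pr) v∈A) proj₁ inside⇒cl tr ty
          open Meeting X₁
        ... | no far | _ , inj₁ ty   = contradiction ty far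
        ... | no far | _ , inj₂ refl = avoiding (aim-extension v∈A refl (Extension.touch X₁))
          where
          X₁ = home-extension L.grow (v pr)
          open Avoiding tr far X₁

      legs : ∀ ps → AllPairs (λ p q → cl (u p) ≢ cl (u q)) ps → Legs ps
      legs [] _ = record
        { s = s₀ ; grow = ⊆ˢ-refl ; geo = λ i i′ rt → Ready.geo ready₀ i i′ (mapʳ inside⇒cl rt)
        ; origin = inj₁ ; cost = λ i → cost-mono ⊆ˢ-refl (≤-trans (m≤n+m D′ W) (m≤n+m _ W)) (strand-cost ⊆ˢ-refl i)
        ; meets = λ () }
      legs (p ∷ ps) (a ∷ as) = Step.step p (legs ps as) (All.lookup a)

      -- Strands stay in their spot, and two units of one spot are within `D′`, hence differently
      -- coloured. So a strand never ends on another one of its own colour, and each colour adds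
      -- just one leg `W`.
      module Fill {ps : List (Pair cl)} (Lg : Legs ps) where
        module L = Legs Lg

        level : ℕ → ℕ
        level c = c * W + X₀

        record Mid (c : ℕ) : Set where
          field
            s    : State
            grow : L.s ⊆ˢ s
            geo  : Geo s key
            cost : ∀ {p} → In s p → Cost s p (level c)
            done : ∀ {a} → colour a < c → Touched s key a

        record Round {c} (M : Mid c) (todo : List V) : Set where
          field
            s    : State
            grow : Mid.s M ⊆ˢ s
            geo  : Geo s key
            cost : ∀ {p} → In s p → Cost s p (level (suc c))
            info : ∀ {p} → In s p → In (Mid.s M) p ⊎ ∃[ a ] colour a ≡ c × Touched s key a × cl a ≡ cl p
            done : ∀ {a} → colour a ≡ c → Touched s key a ⊎ a ∈ todo

        insert : ∀ {c M b todo} → (R : Round {c} M (b ∷ todo)) → colour b ≡ c →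
                 Extension (Round.s R) key home b → Round M todo
        insert {c} {M} {b} {todo} R b-col X = record
          { s = X.s′ ; grow = ⊆ˢ-trans R.grow X.grow ; geo = X.geo R.geo ; cost = cost ; info = info ; done = done }
          where
          module R = Round R
          module X = Extension X
          cost : ∀ {p} → In X.s′ p → Cost X.s′ p (level (suc c))
          cost i with X.new i
          ... | inj₁ j = cost-mono X.grow ≤-refl (R.cost j)
          cost {p} i | inj₂ m with trace-end X.trace
          ... | q , iq , kq with R.info iq
          ... | inj₁ iM = cost-mono ⊆ˢ-refl (≤-reflexive (sym (+-assoc W (c * W) X₀)))
                (leg-cost X m (home-≤ p) (trans (ext-class X m) (sym (ext-end X))) iq kq
                  (cost-mono R.grow ≤-refl (Mid.cost M iM)))
          ... | inj₂ (a , a-col , (p′ , ip , ep) , e) = contradiction (trans a-col (sym b-col))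
                (colour-far (≤-trans (d-min (mapʳ proj₁ (proj₂ (proj₂ conn)))) (proj₁ (proj₂ conn)))
                  λ ke → trace-origin X.trace m (p′ , ip , trans ep ke))
            where
            conn = cl-conn {a} {b} (trans e (trans (key⇒cl kq) (ext-end X)))
          info : ∀ {p} → In X.s′ p → In (Mid.s M) p ⊎ ∃[ a ] colour a ≡ c × Touched X.s′ key a × cl a ≡ cl p
          info i with X.new i
          ... | inj₂ m = inj₂ (b , b-col , X.touch , sym (ext-class X m))
          ... | inj₁ j with R.info j
          ... | inj₁ k = inj₁ k
          ... | inj₂ (a , e , t , e′) = inj₂ (a , e , touched-mono X.grow t , e′)
          done : ∀ {a} → colour a ≡ c → Touched X.s′ key a ⊎ a ∈ todo
          done e with R.done e
          ... | inj₁ t           = inj₁ (touched-mono X.grow t)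
          ... | inj₂ (here refl) = inj₁ X.touch
          ... | inj₂ (there m)   = inj₂ m

        skip : ∀ {c M b todo} → colour b ≢ c → Round {c} M (b ∷ todo) → Round M todo
        skip {c} {M} {b} {todo} ne R = record
          { s = s ; grow = grow ; geo = geo ; cost = cost ; info = info ; done = done′ }
          where
          open Round R
          done′ : ∀ {a} → colour a ≡ c → Touched s key a ⊎ a ∈ todo
          done′ e with done e
          ... | inj₁ t           = inj₁ t
          ... | inj₂ (here refl) = contradiction e ne
          ... | inj₂ (there m)   = inj₂ m

        round : ∀ {c M} todo → Round {c} M todo → Round M []
        round [] R = R
        round {c} {M} (b ∷ todo) R with colour b ≟ c
        ... | yes e = round todo (insert R e
                (home-extension {Round.s R} (⊆ˢ-trans L.grow (⊆ˢ-trans (Mid.grow M) (Round.grow R))) b))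
        ... | no ne = round todo (skip ne R)

        next-colour : ∀ {c} → Mid c → Mid (suc c)
        next-colour {c} M = record
          { s = R.s ; grow = ⊆ˢ-trans M.grow R.grow ; geo = R.geo ; cost = R.cost ; done = done }
          where
          module M = Mid M
          finished : Round M []
          finished = round {M = M} (allFin n) record
            { s = M.s ; grow = ⊆ˢ-refl ; geo = M.geo ; info = inj₁ ; done = λ _ → inj₂ (∈-allFin _)
            ; cost = λ i → cost-mono ⊆ˢ-refl (+-monoˡ-≤ X₀ (m≤n+m (c * W) W)) (M.cost i) }
          module R = Round finished
          done : ∀ {a} → colour a < suc c → Touched R.s key a
          done {a} lt with m≤n⇒m<n∨m≡n (s≤s⁻¹ lt)
          ... | inj₁ lt′ = touched-mono R.grow (M.done lt′)
          ... | inj₂ e with R.done e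
          ... | inj₁ t = t

        mids : ∀ c → Mid c
        mids zero    = record { s = L.s ; grow = ⊆ˢ-refl ; geo = L.geo ; cost = L.cost ; done = λ () }
        mids (suc c) = next-colour (mids c)

      settle : ∀ ps → AllPairs (λ p q → cl (u p) ≢ cl (u q)) ps →
               Σ[ s ∈ State ] s₀ ⊆ˢ s × Ready s key ×
                 (∀ f → s ⊆ˢ f → Jump f s key α →
                    Jump f s₀ cl (α + (Q * W + X₀)) ×
                    (∀ {pr} → pr ∈ ps → Joined f (u pr) (v pr) (len pr + slack)))
      settle ps ap = M.s , ⊆ˢ-trans (Legs.grow Lg) M.grow , ready , conclude
        where
        Lg = legs ps ap
        module M = Fill.Mid (Fill.mids Lg Q)
        ready : Ready M.s key
        ready = record { touched = λ x → M.done (colour< x) ; geo = M.geo }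
        jump : ∀ f → M.s ⊆ˢ f → Jump f M.s key α → Jump f s₀ cl (α + (Q * W + X₀))
        jump f g j {x} {p} e i with M.done (colour< x)
        ... | q , iq , eq = joined-trans (j (sym eq) iq) (M.cost iq f (g , j) i (trans (key⇒cl eq) e))
        conclude : ∀ f → M.s ⊆ˢ f → Jump f M.s key α →
                   Jump f s₀ cl (α + (Q * W + X₀)) ×
                   (∀ {pr} → pr ∈ ps → Joined f (u pr) (v pr) (len pr + slack))
        conclude f g j = jump f g j , λ m → Legs.meets Lg m f (fits-anti M.grow (g , j))


    bool-ext : ∀ {a b} → (a ≡ true → b ≡ true) → (b ≡ true → a ≡ true) → a ≡ b
    bool-ext {true}  {true}  f g = refl
    bool-ext {false} {false} f g = refl
    bool-ext {true}  {false} f g = contradiction (f refl) λ ()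
    bool-ext {false} {true}  f g = contradiction (g refl) λ ()

    -- Growing clusters from a net, with logged strands

    module _ (key : V → V) where
      open Scripts key

      -- A script constrains `cl` on treated units alone, so the labels of fresh units may still be
      -- changed by the next event.
      transport : ∀ {cl cl′ τ L rk} → (∀ {v} → τ v ≡ true → cl′ v ≡ cl v) → Script cl τ L rk → Script cl′ τ L rk
      transport agree (seeds cls h) = seeds cls λ t → trans (h t) (cong key (sym (agree t)))
      transport agree (event {τ = τ} sc F T⊆ {xs = xs} tr o k end same) =
        event (transport (agree ∘ reached⁺ τ xs ∘ inj₁) sc) F T⊆ tr o k end λ m →
          trans (agree (reached⁺ τ xs (inj₂ (_ , m , refl))))
            (trans (same m) (sym (agree (reached⁺ τ xs (inj₁ (trace-end tr))))))

      -- Following the strands leads to the centre of the cluster.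
      module Radius (cl : V → V) (key⇒cl : ∀ {u v} → key u ≡ key v → cl u ≡ cl v)
                    (D : ℕ) (unit-conn : Within-class key D) where

        unit : ∀ {u v} → key u ≡ key v → ∃[ ℓ ] ℓ ≤ D × Route (Inside cl) u v ℓ
        unit e with unit-conn e
        ... | ℓ , le , rt = ℓ , le , mapʳ (λ { (a , e′) → a , key⇒cl e′ }) rt

        inside-chain : ∀ {T} (F : Flow Adj T) {P : V → Set} {a b} → (∀ {v} → P v → ¬ T v) →
                       (∀ {v} → P v → cl v ≡ cl (Flow.nx F v)) → Chain P (Flow.nx F) a b →
                       ∃[ ℓ ] ℓ + Flow.φ F b ≡ Flow.φ F a × Route (Inside cl) a b ℓ
        inside-chain F h e [] = 0 , refl , nil
        inside-chain F {b = b} h e (_∷_ {x = a} p c) with inside-chain F h e c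
        ... | ℓ , eq , rt = w a (nx a) + ℓ ,
          trans (+-assoc (w a (nx a)) ℓ (φ b)) (trans (cong (w a (nx a) +_) eq) (sym (proj₂ (stepᶠ a (h p))))) ,
          (proj₁ (stepᶠ a (h p)) , e p) ∷ rt
          where open Flow F

        -- A strand costs 3D beyond the drop of its potential: `D` to reach it inside the unit of
        -- `v`, `D` because the potential varies within that unit, and the trailing `D` of the
        -- induction hypothesis.
        radius : ∀ {τ L rk} → Script cl τ L rk → ∀ v → τ v ≡ true →
                 ∃[ ℓ ] ℓ ≤ L v + rk v * (3 * D) + D × Route (Inside cl) v (cl v) ℓ
        radius (seeds _ h) v t = unit (h t)
        radius (event {τ} {L} {rk} sc F T⊆ {xs = xs} {y} tr o k end same) v t with reached⁻ τ xs {v} t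
        ... | inj₁ t′ rewrite t′ = radius sc v t′
        ... | inj₂ (a , m , e) rewrite bool-no (λ t′ → trace-free tr m (closed sc (sym e) t′))
          with unit (sym e) | radius sc y (trace-end tr) | inside-chain F (free T⊆ tr) forward (chain-from tr m)
          where
          open OnFlow F
          forward : ∀ {v} → v ∈ xs → cl v ≡ cl (Flow.nx F v)
          forward m with trace-next tr m
          ... | inj₁ m′ = trans (same m) (sym (same m′))
          ... | inj₂ e  = trans (same m) (cong cl (sym e))
        ... | ℓ₁ , le₁ , r₁ | ℓ₃ , le₃ , r₃ | ℓ₂ , e₂ , r₂ =
          ℓ₁ + (ℓ₂ + ℓ₃) ,
          lin 12 (λ ℓ₁ ℓ₂ ℓ₃ Ly rD D φy φa φv o kD ry →
              (ℓ₁ ⊑ D ∷ ℓ₃ ⊑ Ly ⊕ rD ⊕ D ∷ ℓ₂ ⊕ φy ⊑ φa ∷ φa ⊑ D ⊕ φv ∷ Ly ⊑ o ⊕ φy ∷ 3 ⊛ D ⊕ rD ⊑ kD ∷ []) ⊢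
              ℓ₁ ⊕ (ℓ₂ ⊕ ℓ₃) ⊑ o ⊕ φv ⊕ kD ⊕ D)
            ℓ₁ ℓ₂ ℓ₃ (L y) (rk y * (3 * D)) D (Flow.φ F y) (Flow.φ F a) (Flow.φ F v) o (k * (3 * D)) 0
            le₁ le₃ (≤-reflexive e₂) drop (proj₁ (end refl)) (*-monoˡ-≤ (3 * D) (proj₂ (end refl))) ,
          r₁ ++ʳ (r₂ ++ʳ subst (λ c → Route (Inside cl) y c ℓ₃) (sym clv) r₃)
          where
          clv : cl v ≡ cl y
          clv = trans (key⇒cl (sym e)) (same m)
          drop : Flow.φ F a ≤ D + Flow.φ F v
          drop with unit-conn e
          ... | _ , le , rt = ≤-trans (Flow.lipᶠ F (mapʳ proj₁ rt)) (+-monoˡ-≤ (Flow.φ F v) le)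

    record Clustered (key : V → V) (D ρ kmax : ℕ) : Set₁ where
      field
        {τ}      : V → Bool
        {L rk}   : V → ℕ
        cl       : V → V
        script   : Scripts.Script key cl τ L rk
        all      : ∀ v → τ v ≡ true
        L≤       : ∀ v → L v ≤ 0 + 2 * ρ
        rk≤      : ∀ v → rk v ≤ kmax
        key⇒cl   : ∀ {u v} → key u ≡ key v → cl u ≡ cl v
        cl-idem  : ∀ v → cl (cl v) ≡ cl v
        cl-apart : ∀ {u v} → cl u ≢ cl v → ρ < d (cl u) (cl v)
        cl-conn  : Within-class cl ((2 * ρ + kmax * (3 * D) + D) + (2 * ρ + kmax * (3 * D) + D))

    -- `g` is the radius scale of the units, `hs` the separation scale of their representatives. The
    -- colours must keep starting points of the last phase 2D + 2D = 8g apart, which is what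
    -- `jf-big` allows.
    module Clusters (dim : ℕ)
                 (halve : ∀ c h → Σ[ cs ∈ List V ] length cs ≤ 2 ^ dim ×
                                  (∀ x → d c x ≤ 2 * h → ∃[ c′ ] c′ ∈ cs × d c′ x ≤ h))
                 (key : V → V) (g : ℕ) (unit-conn : Within-class key (2 * g))
                 (key-idem : ∀ v → key (key v) ≡ key v)
                 (hs jf : ℕ) (key-apart : ∀ {u v} → key u ≢ key v → 2 * hs < d (key u) (key v))
                 (jf-big : 8 * g ≤ 2 ^ jf * hs) (jf≥ : 4 ≤ jf) where

      open Scripts key
      open Doubling dim halve

      D M : ℕ
      D = 2 * g
      M = 2 ^ (dim * jf)

      unit-d : ∀ {u v} → key u ≡ key v → d u v ≤ D
      unit-d e with unit-conn e
      ... | _ , le , rt = ≤-trans (d-min (mapʳ proj₁ rt)) le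

      g≤scaled : ∀ i → g ≤ scaled g i
      g≤scaled zero    = ≤-refl
      g≤scaled (suc i) = ≤-trans (g≤scaled i) (m≤m+n _ _)

      module _ (centres : List V) where

        record Partial (K : ℕ) : Set₁ where
          field
            τ    : V → Bool
            L rk : V → ℕ
            cl   : V → V
            script : Script cl τ L rk
            rk<  : ∀ {v} → τ v ≡ true → rk v < K
            key⇒cl : ∀ {u v} → key u ≡ key v → cl u ≡ cl v
            centred : ∀ {v} → τ v ≡ true → cl v ∈ centres
            centre  : ∀ {z} → z ∈ centres → τ z ≡ true × cl z ≡ z
        open Partial

        module Insert {K T} (B : Partial (suc K)) (F : Flow Adj T) (T⊆ : ∀ {v} → T v → τ B v ≡ true) (o : ℕ)
                      (low : ∀ {v} → τ B v ≡ true → L B v ≤ o + Flow.φ F v)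
                      {z xs y} (tr : Trace (λ v → τ B v ≡ true) (Flow.nx F) z xs y)
                      (rk-end : ∀ {v} → key v ≡ key y → rk B v < K) where
          open Flow F

          hit : V → Bool
          hit v = ⌊ Any.any? (λ a → key a Fin.≟ key v) xs ⌋

          hit⇒ : ∀ {u v} → key u ≡ key v → hit u ≡ true → hit v ≡ true
          hit⇒ {u} {v} e t with Any.any? (λ a → key a Fin.≟ key u) xs | Any.any? (λ a → key a Fin.≟ key v) xs
          ... | yes m | yes _  = refl
          ... | yes m | no ¬m = contradiction (Any.map (λ q → trans q e) m) ¬m

          hit-mem : ∀ {a} → a ∈ xs → hit a ≡ true
          hit-mem {a} m with Any.any? (λ b → key b Fin.≟ key a) xs
          ... | yes _ = refl
          ... | no ¬m = contradiction (lose m refl) ¬m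

          cl′ : V → V
          cl′ v = if τ B v then cl B v else (if hit v then cl B y else cl B v)

          fresh′ : ∀ {a} → a ∈ xs → τ B a ≡ false
          fresh′ m = bool-no (trace-free tr m)

          cl′-old : ∀ {v} → τ B v ≡ true → cl′ v ≡ cl B v
          cl′-old t rewrite t = refl

          cl′-new : ∀ {a} → a ∈ xs → cl′ a ≡ cl B y
          cl′-new m rewrite fresh′ m | hit-mem m = refl

          cl′-key : ∀ {u v} → key u ≡ key v → cl′ u ≡ cl′ v
          cl′-key {u} {v} e
            rewrite bool-ext (closed (script B) e) (closed (script B) (sym e))
                  | bool-ext (hit⇒ e) (hit⇒ (sym e)) | key⇒cl B e = refl

          τy : τ B y ≡ true
          τy = trace-end tr

          result : Partial (suc K)
          result = record
            { τ = reached (τ B) xs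
            ; L = λ v → if τ B v then L B v else o + φ v
            ; rk = λ v → if τ B v then rk B v else K
            ; cl = cl′
            ; script = event (transport key cl′-old (script B)) F T⊆ tr o K
                (λ e → low (closed (script B) (sym e) τy) , rk-end e)
                (λ m → trans (cl′-new m) (sym (cl′-old τy)))
            ; rk< = rk<′ ; key⇒cl = cl′-key ; centred = centred′
            ; centre = λ m → reached⁺ (τ B) xs (inj₁ (proj₁ (centre B m))) ,
                             trans (cl′-old (proj₁ (centre B m))) (proj₂ (centre B m)) }
            where
            rk<′ : ∀ {v} → reached (τ B) xs v ≡ true → (if τ B v then rk B v else K) < suc K
            rk<′ {v} _ with τ B v in eq
            ... | true  = rk< B eq
            ... | false = ≤-refl
            centred′ : ∀ {v} → reached (τ B) xs v ≡ true → cl′ v ∈ centres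
            centred′ {v} t with reached⁻ (τ B) xs {v} t
            ... | inj₁ t′ = subst (_∈ centres) (sym (cl′-old t′)) (centred B t′)
            ... | inj₂ (a , m , e) =
              subst (_∈ centres) (trans (sym (cl′-new m)) (cl′-key e)) (centred B τy)

        -- One phase: strands of length at most Lb, all flowing to what was
        -- reached when the phase began.
        module Phase {K₀} (B₀ : Partial K₀) (o Lb : ℕ) (L≤ : ∀ {v} → τ B₀ v ≡ true → L B₀ v ≤ o)
                     (dense : ∀ x → ∃[ v ] τ B₀ v ≡ true × d x v ≤ Lb)
                     (Z : List V) (palette : Colouring (λ u v → d u v ≤ 2 * Lb + 2 * D) M Z) where
          open Colouring palette

          F : Flow Adj (λ v → τ B₀ v ≡ true)
          F = flow Adj Adj? (λ v → τ B₀ v ≡ true) (λ v → τ B₀ v ≟ᵇ true)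
            (λ x → proj₁ (dense x) , d x (proj₁ (dense x)) , proj₁ (proj₂ (dense x)) , d-route x _)
          open Flow F
          open OnFlow F

          φ≤ : ∀ x → φ x ≤ Lb
          φ≤ x = ≤-trans (boundᶠ (proj₁ (proj₂ (dense x))) (d-route x _)) (proj₂ (proj₂ (dense x)))

          record Ongoing (K : ℕ) : Set₁ where
            field
              now  : Partial K
              keep : ∀ {v} → τ B₀ v ≡ true → τ now v ≡ true
              low  : ∀ {v} → τ now v ≡ true → L now v ≤ o + φ v
          open Ongoing

          record Round {K} (P : Ongoing K) (c : ℕ) (todo : List V) : Set₁ where
            field
              on   : Ongoing (suc K)
              more : ∀ {v} → τ (now P) v ≡ true → τ (now on) v ≡ true
              info : ∀ {v} → τ (now on) v ≡ true → (rk (now on) v < K) ⊎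
                       (∃[ z ] z ∈ Z × colour z ≡ c × τ (now on) z ≡ true × d z v ≤ Lb + D)
              done : ∀ {z} → z ∈ Z → colour z ≡ c → τ (now on) z ≡ true ⊎ z ∈ todo
          open Round

          -- Starting points of one colour are more than 2 `Lb` + 2 `D` apart, while strands have
          -- length at most `Lb`. So a strand does not end in a unit treated earlier under its own
          -- colour, its end has rank below `K`, and all strands of the colour can share rank `K`.
          insert : ∀ {K P c z todo} (R : Round {K} P c (z ∷ todo)) → z ∈ Z → colour z ≡ c →
                   τ (now (on R)) z ≡ false → Round P c todo
          insert {K} {P} {c} {z} {todo} R z∈ z-col fr
            with tracing (λ v → τ (now (on R)) v ≡ true) (λ v → τ (now (on R)) v ≟ᵇ true) (keep (on R)) z
          ... | xs , y , tr = record
            { on = record { now = I.result ; keep = reached⁺ (τ B) xs ∘ inj₁ ∘ keep (on R) ; low = low′ }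
            ; more = reached⁺ (τ B) xs ∘ inj₁ ∘ more R ; info = info′ ; done = done′ }
            where
            B = now (on R)
            from-z : ∀ {a} → Chain (_∈ xs) nx z a → d z a ≤ Lb
            from-z ch with chain-route (free (keep (on R)) tr) ch
            ... | ℓ , rt , eq = ≤-trans (d-min rt) (≤-trans (≤-trans (m≤m+n ℓ _) (≤-reflexive eq)) (φ≤ z))
            z-in : z ∈ xs
            z-in with trace-start tr
            ... | inj₁ t = contradiction (trans (sym t) fr) λ ()
            ... | inj₂ m = m
            rk-end : ∀ {v} → key v ≡ key y → rk B v < K
            rk-end {v} e with info R (closed (script B) (sym e) (trace-end tr))
            ... | inj₁ lt = lt
            ... | inj₂ (z′ , z′∈ , z′-col , t′ , near) =
              contradiction (trans z-col (sym z′-col)) (proper z∈ z′∈ z≢z′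
                (≤-trans (d-tri z v z′) (lin 6 (λ a b c L D e → (a ⊑ b ⊕ c ∷ b ⊑ L ∷ c ⊑ D ∷ e ⊑ L ⊕ D ∷ []) ⊢
                                                 a ⊕ e ⊑ 2 ⊛ L ⊕ 2 ⊛ D)
                  (d z v) (d z y) (d y v) Lb D (d v z′) (d-tri z y v) (from-z (trace-chain tr)) (unit-d (sym e))
                  (subst (_≤ Lb + D) (d-sym z′ v) near))))
              where
              z≢z′ : z ≢ z′
              z≢z′ refl = contradiction (trans (sym t′) fr) λ ()
            module I = Insert B F (keep (on R)) o (low (on R)) tr rk-end
            low′ : ∀ {v} → reached (τ B) xs v ≡ true → (if τ B v then L B v else o + φ v) ≤ o + φ v
            low′ {v} _ with τ B v in eq
            ... | true  = low (on R) eq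
            ... | false = ≤-refl
            info′ : ∀ {v} → reached (τ B) xs v ≡ true → (if τ B v then rk B v else K) < K ⊎
                    (∃[ z ] z ∈ Z × colour z ≡ c × reached (τ B) xs z ≡ true × d z v ≤ Lb + D)
            info′ {v} t with reached⁻ (τ B) xs {v} t
            ... | inj₂ (a , m , e) = inj₂ (z , z∈ , z-col , reached⁺ (τ B) xs (inj₂ (z , z-in , refl)) ,
                    ≤-trans (d-tri z a v) (+-mono-≤ (from-z (chain-to tr m)) (unit-d e)))
            ... | inj₁ t′ with info R t′
            ... | inj₂ (z′ , m , e , t″ , le) = inj₂ (z′ , m , e , reached⁺ (τ B) xs (inj₁ t″) , le)
            ... | inj₁ lt rewrite t′ = inj₁ lt
            done′ : ∀ {a} → a ∈ Z → colour a ≡ c → reached (τ B) xs a ≡ true ⊎ a ∈ todo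
            done′ m e with done R m e
            ... | inj₁ t           = inj₁ (reached⁺ (τ B) xs (inj₁ t))
            ... | inj₂ (here refl) = inj₁ (reached⁺ (τ B) xs (inj₂ (z , z-in , refl)))
            ... | inj₂ (there m′)  = inj₂ m′

          skip : ∀ {K P c z todo} (R : Round {K} P c (z ∷ todo)) → (colour z ≡ c → τ (now (on R)) z ≡ true) →
                 Round P c todo
          skip {c = c} {z} {todo} R h = record { on = on R ; more = more R ; info = info R ; done = done′ }
            where
            done′ : ∀ {a} → a ∈ Z → colour a ≡ c → τ (now (on R)) a ≡ true ⊎ a ∈ todo
            done′ m e with done R m e
            ... | inj₁ t           = inj₁ t
            ... | inj₂ (here refl) = inj₁ (h e)
            ... | inj₂ (there m′)  = inj₂ m′

          round : ∀ {K P c} todo → (∀ {z} → z ∈ todo → z ∈ Z) → Round {K} P c todo → Round P c []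
          round [] _ R = R
          round {c = c} (z ∷ todo) sub R with colour z ≟ c | τ (now (on R)) z in eq
          ... | yes e | false = round todo (sub ∘ there) (insert R (sub (here refl)) e eq)
          ... | yes _ | true  = round todo (sub ∘ there) (skip R λ _ → eq)
          ... | no ne | _     = round todo (sub ∘ there) (skip R λ e → contradiction e ne)

          record Coloured (c : ℕ) : Set₁ where
            field
              on   : Ongoing (c + K₀)
              done : ∀ {z} → z ∈ Z → colour z < c → τ (now on) z ≡ true

          next-colour : ∀ {c} → Coloured c → Coloured (suc c)
          next-colour {c} C = record { on = on R ; done = done′ }
            where
            P = Coloured.on C
            start : Round P c Z
            start = record
              { on = record { now = record
                  { τ = τ B ; L = L B ; rk = rk B ; cl = cl B ; script = script B ; rk< = m<n⇒m<1+n ∘ rk< B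
                  ; key⇒cl = key⇒cl B ; centred = centred B ; centre = centre B }
                ; keep = keep P ; low = low P }
              ; more = id ; info = inj₁ ∘ rk< B ; done = λ m _ → inj₂ m }
              where B = now P
            R : Round P c []
            R = round Z id start
            done′ : ∀ {z} → z ∈ Z → colour z < suc c → τ (now (on R)) z ≡ true
            done′ m lt with m≤n⇒m<n∨m≡n (s≤s⁻¹ lt)
            ... | inj₁ lt′ = more R (Coloured.done C m lt′)
            ... | inj₂ e with done R m e
            ... | inj₁ t = t

          coloured : ∀ c → Coloured c
          coloured zero    = record
            { on = record { now = B₀ ; keep = id ; low = λ t → ≤-trans (L≤ t) (m≤m+n o _) } ; done = λ _ () }
          coloured (suc c) = next-colour (coloured c)

          after : Partial (M + K₀)
          after = now (Coloured.on (coloured M))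

          after-done : ∀ {z} → z ∈ Z → τ after z ≡ true
          after-done m = Coloured.done (coloured M) m (colour< m)

          after-L : ∀ {v} → τ after v ≡ true → L after v ≤ o + Lb
          after-L {v} t = ≤-trans (low (Coloured.on (coloured M)) t) (+-monoʳ-≤ o (φ≤ v))

        record Complete (o k : ℕ) : Set₁ where
          field
            {rounds} : ℕ
            part : Partial rounds
            K≤   : rounds ≤ k
            all  : ∀ v → τ part v ≡ true
            L≤   : ∀ v → L part v ≤ o

        weaken : ∀ {R R′ : V → V → Set} {Q vs} → (∀ {u v} → R′ u v → R u v) → Colouring R Q vs → Colouring R′ Q vs
        weaken f C = record { colour = colour ; colour< = colour< ; proper = λ m m′ ne → proper m m′ ne ∘ f }
          where open Colouring C

        reps : List V
        reps = filter (λ v → key v Fin.≟ v) (allFin n)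

        reps-apart : Apart (2 * hs) reps
        reps-apart = spread reps (Uniqueₚ.filter⁺ (λ v → key v Fin.≟ v) (Uniqueₚ.allFin⁺ n))
                        (Allₚ.all-filter (λ v → key v Fin.≟ v) (allFin n))
          where
          spread : ∀ xs → AllPairs _≢_ xs → All (λ v → key v ≡ v) xs → Apart (2 * hs) xs
          spread [] _ _ = []
          spread (x ∷ xs) (ne ∷ u) (e ∷ es) = All.zipWith far (ne , es) ∷ spread xs u es
            where
            far : ∀ {y} → x ≢ y × key y ≡ y → 2 * hs < d x y
            far {y} (ne , ey) = subst₂ (λ a b → 2 * hs < d a b) e ey
              (key-apart λ eq → ne (trans (sym e) (trans eq ey)))

        -- Once the treated set is `D`-dense, every unit representative becomes a starting point; no
        -- unit is left over.
        last-phase : ∀ {K} (B : Partial K) o → (∀ {v} → τ B v ≡ true → L B v ≤ o) →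
                     (∀ x → ∃[ v ] τ B v ≡ true × d x v ≤ D) → Complete (o + 2 * D) (M + K)
        last-phase B o L≤ dense = record
          { part = after ; K≤ = ≤-refl ; all = all
          ; L≤ = λ v → ≤-trans (after-L (all v)) (+-monoʳ-≤ o (m≤m+n D _)) }
          where
          radius : 2 * D + 2 * D ≤ 2 ^ jf * hs
          radius = ≤-trans (lin 1 (λ g → [] ⊢ 2 ⊛ 2 ⊛ g ⊕ 2 ⊛ 2 ⊛ g ⊑ 8 ⊛ g) g) jf-big
          open Phase B o D L≤ dense reps (weaken (λ le → ≤-trans le radius) (near-colouring hs jf reps reps-apart))
          all : ∀ v → τ after v ≡ true
          all v = closed (script after) (key-idem v)
            (after-done (∈-filter⁺ (λ v → key v Fin.≟ v) (∈-allFin (key v)) (key-idem v)))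

        record Denser {K} (B : Partial K) (o s : ℕ) : Set₁ where
          field
            next  : Partial (M + K)
            L≤    : ∀ {v} → τ next v ≡ true → L next v ≤ o
            dense : ∀ x → ∃[ v ] τ next v ≡ true × d x v ≤ s

        module _ {K} (B : Partial K) (o h : ℕ) (g≤h : g ≤ h)
                 (L≤ : ∀ {v} → τ B v ≡ true → L B v ≤ o)
                 (dense : ∀ x → ∃[ v ] τ B v ≡ true × d x v ≤ 4 * h) where
          -- Starting from a 2h-net halves the density. The length 4h added to `o` halves as well
          -- from one phase to the next, so all phases together add at most 2 `ρ`.
          halve-phase : Denser B (o + 4 * h) (2 * h)
          halve-phase = record { next = after ; L≤ = after-L ; dense = dense′ }
            where
            radius : 2 * (4 * h) + 2 * D ≤ 2 ^ jf * h
            radius = ≤-trans (lin 2 (λ g h → (g ⊑ h ∷ g ⊑ h ∷ g ⊑ h ∷ g ⊑ h ∷ []) ⊢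
                                 2 ⊛ 4 ⊛ h ⊕ 2 ⊛ 2 ⊛ g ⊑ 16 ⊛ h) g h g≤h g≤h g≤h g≤h)
                             (*-monoˡ-≤ h (^-monoʳ-≤ 2 jf≥))
            Z : List V
            Z = net (2 * h) (allFin n)
            open Phase B o (4 * h) L≤ dense Z
              (weaken (λ le → ≤-trans le radius) (near-colouring h jf Z (net-apart (2 * h) (allFin n))))
            dense′ : ∀ x → ∃[ v ] τ after v ≡ true × d x v ≤ 2 * h
            dense′ x = let z , m , le = net-cover (2 * h) (allFin n) (∈-allFin x) in z , after-done m , le

        collect : ∀ i {K} o → Complete (o + 4 * scaled g i + 2 * (2 * scaled g i)) (suc i * M + (M + K)) →
                  Complete (o + 2 * (2 * scaled g (suc i))) (suc (suc i) * M + K)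
        collect i {K} o C = record
          { part = part ; all = all
          ; K≤ = ≤-trans K≤ (≤-reflexive (trans (sym (+-assoc (suc i * M) M K)) (cong (_+ K) (+-comm (suc i * M) M))))
          ; L≤ = λ v → ≤-trans (L≤ v) (lin 2 (λ o h → [] ⊢ o ⊕ 4 ⊛ h ⊕ 2 ⊛ 2 ⊛ h ⊑ o ⊕ 2 ⊛ 2 ⊛ 2 ⊛ h) o (scaled g i)) }
          where open Complete C

        phases : ∀ i {K} (B : Partial K) o → (∀ {v} → τ B v ≡ true → L B v ≤ o) →
                 (∀ x → ∃[ v ] τ B v ≡ true × d x v ≤ 2 * scaled g i) →
                 Complete (o + 2 * (2 * scaled g i)) (suc i * M + K)
        phases zero {K} B o L≤ dense =
          subst (Complete (o + 2 * D)) (cong (_+ K) (sym (+-identityʳ M))) (last-phase B o L≤ dense)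
        phases (suc i) B o L≤ dense =
          let N = halve-phase B o (scaled g i) (g≤scaled i) L≤
                    (λ x → proj₁ (dense x) , proj₁ (proj₂ (dense x)) ,
                           ≤-trans (proj₂ (proj₂ (dense x))) (≤-reflexive (sym (*-assoc 2 2 (scaled g i)))))
          in collect i o (phases i (Denser.next N) (o + 4 * scaled g i) (Denser.L≤ N) (Denser.dense N))

      apart-lookup : ∀ {s xs} → Apart s xs → ∀ {x y} → x ∈ xs → y ∈ xs → x ≢ y → s < d x y
      apart-lookup (a ∷ ap) (here refl) (here refl) ne = contradiction refl ne
      apart-lookup (a ∷ ap) (here refl) (there m)   ne = All.lookup a m
      apart-lookup {s} (a ∷ ap) {x} {y} (there m) (here refl) ne = subst (s <_) (d-sym y x) (All.lookup a m)
      apart-lookup (a ∷ ap) (there m) (there m′) ne = apart-lookup ap m m′ ne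

      module _ (i : ℕ) where

        ρ kmax : ℕ
        ρ = 2 * scaled g i
        kmax = suc i * M + 1

        centres : List V
        centres = net ρ (allFin n)

        D≤ρ : D ≤ ρ
        D≤ρ = *-monoʳ-≤ 2 (g≤scaled i)

        centre-unique : ∀ {u v} → u ∈ centres → v ∈ centres → key u ≡ key v → u ≡ v
        centre-unique {u} {v} mu mv e with u Fin.≟ v
        ... | yes p = p
        ... | no ne = contradiction (apart-lookup (net-apart ρ (allFin n)) mu mv ne) (≤⇒≯ (≤-trans (unit-d e) D≤ρ))

        near? : ∀ v → Dec (Any (λ z → key z ≡ key v) centres)
        near? v = Any.any? (λ z → key z Fin.≟ key v) centres

        seed : V → Bool
        seed v = ⌊ near? v ⌋

        pick : ∀ {v} → Dec (Any (λ z → key z ≡ key v) centres) → V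
        pick (yes a)     = proj₁ (find a)
        -- A placeholder for untreated units; the key is chosen so that the label is constant on
        -- each unit from the start.
        pick {v} (no _)  = key v

        pick-key : ∀ {u v} (p : Dec (Any (λ z → key z ≡ key u) centres)) (q : Dec (Any (λ z → key z ≡ key v) centres)) →
                   key u ≡ key v → pick {u} p ≡ pick {v} q
        pick-key (yes a) (yes b) e = centre-unique (proj₁ (proj₂ (find a))) (proj₁ (proj₂ (find b)))
          (trans (proj₂ (proj₂ (find a))) (trans e (sym (proj₂ (proj₂ (find b))))))
        pick-key (yes a) (no ¬b) e = contradiction (Any.map (λ q → trans q e) a) ¬b
        pick-key (no ¬a) (yes b) e = contradiction (Any.map (λ q → trans q (sym e)) b) ¬a
        pick-key (no _)  (no _)  e = e

        initial : Partial centres 1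
        initial = record
          { τ = seed ; L = λ _ → 0 ; rk = λ _ → 0 ; cl = λ v → pick {v} (near? v)
          ; script = seeds (λ {u} {v} → seed-closed {u} {v}) seed-key
          ; rk< = λ _ → s≤s z≤n
          ; key⇒cl = λ {u} {v} → pick-key (near? u) (near? v)
          ; centred = centred ; centre = λ {z} → centre z }
          where
          seed-closed : ∀ {u v} → key u ≡ key v → seed u ≡ true → seed v ≡ true
          seed-closed {u} {v} e t with near? u | near? v
          ... | yes a | yes _ = refl
          ... | yes a | no ¬b = contradiction (Any.map (λ q → trans q e) a) ¬b
          seed-key : ∀ {v} → seed v ≡ true → key v ≡ key (pick {v} (near? v))
          seed-key {v} t with near? v
          ... | yes a = sym (proj₂ (proj₂ (find a)))
          centred : ∀ {v} → seed v ≡ true → pick {v} (near? v) ∈ centres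
          centred {v} t with near? v
          ... | yes a = proj₁ (proj₂ (find a))
          centre : ∀ z → z ∈ centres → seed z ≡ true × pick {z} (near? z) ≡ z
          centre z m with near? z
          ... | yes a = refl , centre-unique (proj₁ (proj₂ (find a))) m (proj₂ (proj₂ (find a)))
          ... | no ¬a = contradiction (lose m refl) ¬a

        initial-dense : ∀ x → ∃[ v ] seed v ≡ true × d x v ≤ ρ
        initial-dense x with net-cover ρ (allFin n) (∈-allFin x)
        ... | z , m , le = z , proj₁ (Partial.centre initial m) , le

        complete : Complete centres (0 + 2 * ρ) kmax
        complete = phases centres i initial 0 (λ _ → z≤n) initial-dense

        module _ (K : Complete centres (0 + 2 * ρ) kmax) where
          open Complete K
          open Partial part

          cl-idem : ∀ v → cl (cl v) ≡ cl v
          cl-idem v = proj₂ (centre (centred (all v)))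

          cl-apart : ∀ {u v} → cl u ≢ cl v → ρ < d (cl u) (cl v)
          cl-apart {u} {v} = apart-lookup (net-apart ρ (allFin n)) (centred (all u)) (centred (all v))

          cl-radius : ℕ
          cl-radius = 2 * ρ + kmax * (3 * D) + D

          to-centre : ∀ v → ∃[ ℓ ] ℓ ≤ cl-radius × Route (Inside cl) v (cl v) ℓ
          to-centre v with Radius.radius key cl key⇒cl D unit-conn script v (all v)
          ... | ℓ , le , rt = ℓ , ≤-trans le (+-monoˡ-≤ D (+-mono-≤ (L≤ v)
                  (*-monoˡ-≤ (3 * D) (≤-trans (<⇒≤ (rk< (all v))) K≤)))) , rt

          cl-conn : Within-class cl (cl-radius + cl-radius)
          cl-conn {x} {y} e with to-centre x | to-centre y
          ... | ℓ , le , rt | ℓ′ , le′ , rt′ = ℓ + ℓ′ , +-mono-≤ le le′ ,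
            rt ++ʳ reverseʳ inside-sym (subst (λ c → Route (Inside cl) y c ℓ′) (sym e) rt′)

          result : Clustered key D ρ kmax
          result = record
            { cl = cl ; script = script ; all = all ; L≤ = L≤ ; rk≤ = λ v → ≤-trans (<⇒≤ (rk< (all v))) K≤
            ; key⇒cl = key⇒cl ; cl-idem = cl-idem ; cl-apart = cl-apart ; cl-conn = cl-conn }

        clustered : Clustered key D ρ kmax
        clustered = result complete

    -- A completed state is a spanning tree

    module Spanning (f : State) (full : ∀ v → In f v) (α : ℕ) (rooted : ∀ v → Joined f v r α) where

      edge? : ∀ u v → Dec (Edge f u v)
      edge? u v = half u v ⊎-dec half v u
        where
        half : ∀ u v → Dec (In f u × u ≢ r × par f u ≡ v)
        half u v = (S f u ≟ᵇ true) ×-dec (¬? (u Fin.≟ r) ×-dec (par f u Fin.≟ v))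

      tadj : V → V → Bool
      tadj u v = isYes (edge? u v)

      edge⇒tadj : ∀ {u v} → Edge f u v → tadj u v ≡ true
      edge⇒tadj {u} {v} e with edge? u v
      ... | yes _ = refl
      ... | no ne = contradiction e ne

      tadj⇒edge : ∀ {u v} → tadj u v ≡ true → Edge f u v
      tadj⇒edge {u} {v} t with edge? u v
      ... | yes e = e

      tadj-sym : ∀ u v → tadj u v ≡ tadj v u
      tadj-sym u v = bool-ext
        (edge⇒tadj ∘ edge-sym f ∘ tadj⇒edge) (edge⇒tadj ∘ edge-sym f ∘ tadj⇒edge)

      route-walk : ∀ {u v ℓ} → Route (Edge f) u v ℓ → D.Walk tadj u v
      route-walk nil     = D.here
      route-walk (e ∷ p) = D.step (edge⇒tadj e) (route-walk p)

      connected-tree : D.Connected tadj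
      connected-tree u v = route-walk (Joined.route (joined-trans (rooted u) (joined-sym (rooted v))))

      -- A `State` does not exclude cycles of parent pointers. They are excluded only now: along a
      -- route of parent edges to the root each step changes the depth by one, so every vertex has a
      -- depth.
      data Depth : V → ℕ → Set where
        root  : Depth r 0
        child : ∀ {x k} → x ≢ r → Depth (par f x) k → Depth x (suc k)

      depth-unique : ∀ {x k m} → Depth x k → Depth x m → k ≡ m
      depth-unique root         root         = refl
      depth-unique root         (child ne _) = contradiction refl ne
      depth-unique (child ne _) root         = contradiction refl ne
      depth-unique (child _ p)  (child _ q)  = cong suc (depth-unique p q)

      depth-along : ∀ {x ℓ} → Route (Edge f) x r ℓ → ∃[ k ] Depth x k
      depth-along nil = 0 , root
      depth-along (inj₁ (_ , ne , refl) ∷ p) = let k , dp = depth-along p in suc k , child ne dp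
      depth-along (inj₂ (_ , ne , refl) ∷ p) with depth-along p
      ... | 0     , root       = contradiction refl ne
      ... | suc k , child _ dp = k , dp

      depth : V → ℕ
      depth v = proj₁ (depth-along (Joined.route (rooted v)))

      has-depth : ∀ v → Depth v (depth v)
      has-depth v = proj₂ (depth-along (Joined.route (rooted v)))

      depth-par : ∀ {u} → u ≢ r → depth u ≡ suc (depth (par f u))
      depth-par {u} ne = depth-unique (has-depth u) (child ne (has-depth (par f u)))

      -- A simple path that starts downwards never turns upwards again, since the
      -- only way up leads back; likewise for a path whose way out leads up.
      descends : ∀ {u v} vs → D.Path tadj (v ∷ vs) → Unique (u ∷ v ∷ vs) → par f v ≡ u → v ≢ r →
                 depth (D.last v vs) ≡ suc (length vs) + depth u
      descends [] _ _ refl ne = depth-par ne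
      descends (x ∷ vs) (D.cons t p) ((_ ∷ ux ∷ _) ∷ uniq) refl ne with tadj⇒edge t
      ... | inj₁ (_ , _ , e)   = contradiction e ux
      ... | inj₂ (_ , ne′ , e) = trans (descends vs p uniq e ne′)
        (trans (cong (suc (length vs) +_) (depth-par ne)) (+-suc (suc (length vs)) _))

      next : V → List V → V
      next x []      = x
      next x (v ∷ _) = v

      ascends : ∀ {x} u vs → D.Path tadj (u ∷ vs) → Unique (u ∷ vs) → All (_≢ x) (u ∷ vs) → par f (D.last u vs) ≡ x →
                par f u ≡ next x vs × depth u ≡ length vs + depth (D.last u vs)
      ascends u [] _ _ _ e = e , refl
      ascends {x} u (v ∷ vs) (D.cons t p) (a ∷ uniq) (u≢x ∷ away) e with ascends v vs p uniq away e | tadj⇒edge t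
      ... | pv , dv | inj₁ (_ , ne , refl) = refl , trans (depth-par ne) (cong suc dv)
      ... | pv , dv | inj₂ (_ , _ , refl)  = contradiction pv (back vs a u≢x)
        where
        back : ∀ vs → All (par f v ≢_) (v ∷ vs) → par f v ≢ x → par f v ≢ next x vs
        back []       _           ne = ne
        back (_ ∷ _) (_ ∷ ne ∷ _) _  = ne

      last-∈ : ∀ v vs → D.last {n} v vs ∈ v ∷ vs
      last-∈ v []       = here refl
      last-∈ v (x ∷ vs) = there (last-∈ x vs)

      -- Four cases, by the directions of the first and the closing edge at `v`. If both lead to the
      -- parent of `v`, its two neighbours on the cycle coincide; otherwise the depths counted along
      -- the cycle disagree.
      no-cycle : D.HasCycle tadj → ⊥
      no-cycle (_ , [] , _ , _ , () , _)
      no-cycle (_ , _ ∷ [] , _ , _ , s≤s () , _)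
      no-cycle (v , x ∷ y ∷ vs , D.cons t p , (a ∷ uniq) , _ , closing) = turn (tadj⇒edge t) (tadj⇒edge closing)
        where
        z : V
        z = D.last y vs
        turn : Edge f v x → Edge f z v → ⊥
        turn (inj₂ (_ , ne , e)) (inj₁ (_ , ne′ , refl)) =
          m≢1+n+m (depth (par f z)) (suc-injective (trans (sym (depth-par ne′)) (descends (y ∷ vs) p (a ∷ uniq) e ne)))
        turn (inj₂ (_ , ne , e)) (inj₂ (_ , ne′ , e′)) =
          m≢1+n+m (depth v) (trans (depth-par ne′) (cong suc (trans (cong depth e′) (descends (y ∷ vs) p (a ∷ uniq) e ne))))
        turn (inj₁ (_ , _ , e)) (inj₂ (_ , _ , e′)) =
          All.lookup (AllPairs.head uniq) (last-∈ y vs) (trans (sym e) e′)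
        turn (inj₁ (_ , ne , e)) (inj₁ (_ , ne′ , e′)) =
          m≢1+n+m (depth v) (trans (depth-par ne) (cong suc (trans (cong depth e)
            (trans (proj₂ (ascends x (y ∷ vs) p uniq (All.map (λ ne → ne ∘ sym) a) e′))
              (trans (cong (suc (length vs) +_) (trans (depth-par ne′) (cong (suc ∘ depth) e′)))
                (+-suc (suc (length vs)) (depth v)))))))

    -- Partitions at one scale, spots, and the step to the next scale

    module Grains (dim : ℕ)
                  (halve : ∀ c h → Σ[ cs ∈ List V ] length cs ≤ 2 ^ dim ×
                                   (∀ x → d c x ≤ 2 * h → ∃[ c′ ] c′ ∈ cs × d c′ x ≤ h)) where

      open Doubling dim halve

      -- Both constants reproduce themselves: the next centres form a 2h′-net, and the next clusters
      -- have radius 4h′ + 4h′.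
      record Grain (h : ℕ) : Set where
        field
          key       : V → V
          key-idem  : ∀ v → key (key v) ≡ key v
          key-apart : ∀ {u v} → key u ≢ key v → 2 * h < d (key u) (key v)
          conn      : Within-class key (16 * h)

        key-d : ∀ {u v} → key u ≡ key v → d u v ≤ 16 * h
        key-d e with conn e
        ... | _ , le , rt = ≤-trans (d-min (mapʳ proj₁ rt)) le

        reps : List V
        reps = filter (λ v → key v Fin.≟ v) (allFin n)

        key∈reps : ∀ v → key v ∈ reps
        key∈reps v = ∈-filter⁺ (λ v → key v Fin.≟ v) (∈-allFin (key v)) (key-idem v)

        reps-apart : Apart (2 * h) reps
        reps-apart = spread reps (Uniqueₚ.filter⁺ (λ v → key v Fin.≟ v) (Uniqueₚ.allFin⁺ n))
                        (Allₚ.all-filter (λ v → key v Fin.≟ v) (allFin n))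
          where
          spread : ∀ xs → AllPairs _≢_ xs → All (λ v → key v ≡ v) xs → Apart (2 * h) xs
          spread [] _ _ = []
          spread (x ∷ xs) (ne ∷ u) (e ∷ es) = All.zipWith far (ne , es) ∷ spread xs u es
            where
            far : ∀ {y} → x ≢ y × key y ≡ y → 2 * h < d x y
            far {y} (ne , ey) = subst₂ (λ a b → 2 * h < d a b) e ey
              (key-apart λ eq → ne (trans (sym e) (trans eq ey)))

      -- From each vertex of a route to `q` the remaining part of the route leads to `q`.
      ball-route : ∀ {x q ℓ R} → Route Adj x q ℓ → ℓ ≤ R →
                   Route (λ u v → Adj u v × d u q ≤ R × d v q ≤ R) x q ℓ
      ball-route nil le = nil
      ball-route (_∷_ {u = x} {v = v} {ℓ = ℓ} a rt) le =
        (a , ≤-trans (d-min (a ∷ rt)) le , ≤-trans (d-min rt) le′) ∷ ball-route rt le′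
        where le′ = ≤-trans (m≤n+m ℓ (w x v)) le


      Full : State → Set
      Full f = ∀ v → In f v

      -- The statement carried up the tower. At the next level 80 is again the sum 16 + 16 + 4 + 44:
      -- two cluster diameters for a base strand, 2 `ρ` for the lengths in the script, and 44 for
      -- the jumps counted by `fit-cost`.
      Completes : ∀ {h} → Grain h → (State → Set) → Set
      Completes {h} gr Good =
        ∀ s → Ready s (Grain.key gr) → Σ[ f ∈ State ] s ⊆ˢ f × Full f × Jump f s (Grain.key gr) (80 * h) × Good f

      jump-≤ : ∀ {f s key} {α β} → α ≤ β → Jump f s key α → Jump f s key β
      jump-≤ le j e i = joined-≤ le (j e i)

      module Listing (i₁ i₂ : ℕ) (Near : V → List V) (cls : V → V) where
        open Pair

        Chosen : V → V → V → Set
        Chosen q u v = nth (Near q) i₁ ≡ just u × nth (Near q) i₂ ≡ just v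

        record Listed (key : V → V) (qs : List V) : Set where
          field
            pairs    : List (Pair cls)
            distinct : AllPairs (λ p q → cls (u p) ≢ cls (u q)) pairs
            from     : ∀ {p} → p ∈ pairs → ∃[ q ] q ∈ qs × cls (u p) ≡ key q
            has      : ∀ {q a b} → q ∈ qs → Chosen q a b → ∃[ p ] p ∈ pairs × u p ≡ a × v p ≡ b × len p ≡ d a b

        Choice : (V → V) → V → Set
        Choice key q = (∃[ a ] ∃[ b ] Chosen q a b × cls a ≡ key q × Route (Inside cls) a b (d a b)) ⊎
                       (∀ {a b} → ¬ Chosen q a b)

        choice : ∀ (key : V → V) q → (∀ {a} → a ∈ Near q → cls a ≡ key q) →
                 (∀ {a b} → a ∈ Near q → b ∈ Near q → Route (Inside cls) a b (d a b)) → Choice key q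
        choice key q near-cls near-route = choose (nth (Near q) i₁) (nth (Near q) i₂) refl refl
          where
          choose : ∀ m₁ m₂ → nth (Near q) i₁ ≡ m₁ → nth (Near q) i₂ ≡ m₂ → Choice key q
          choose nothing  _        e₁ e₂ = inj₂ λ (f₁ , _) → contradiction (trans (sym e₁) f₁) λ ()
          choose (just _) nothing  e₁ e₂ = inj₂ λ (_ , f₂) → contradiction (trans (sym e₂) f₂) λ ()
          choose (just a) (just b) e₁ e₂ = inj₁ (a , b , (e₁ , e₂) , near-cls (nth-∈ (Near q) i₁ e₁) ,
            near-route (nth-∈ (Near q) i₁ e₁) (nth-∈ (Near q) i₂ e₂))

        chosen-unique : ∀ {q a b a′ b′} → Chosen q a b → Chosen q a′ b′ → a ≡ a′ × b ≡ b′
        chosen-unique (e₁ , e₂) (f₁ , f₂) = just-injective (trans (sym e₁) f₁) , just-injective (trans (sym e₂) f₂)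

        module _ {key : V → V} {q : V} {qs : List V} (Ls : Listed key qs) where
          open Listed Ls

          add : (∀ {p} → p ∈ qs → key q ≢ key p) → Choice key q → Listed key (q ∷ qs)
          add other (inj₂ none) = record
            { pairs = pairs ; distinct = distinct
            ; from = λ m → let p , mp , e = from m in p , there mp , e
            ; has = λ { (there m) ch → has m ch ; (here refl) ch → contradiction ch none } }
          add other (inj₁ (a , b , ch , ec , rt)) = record
            { pairs = new ∷ pairs
            ; distinct = All.tabulate (λ m e → let p , mp , e′ = from m in other mp (trans (sym ec) (trans e e′))) ∷ distinct
            ; from = λ { (here refl) → q , here refl , ec ; (there m) → let p , mp , e = from m in p , there mp , e }
            ; has = λ { (there m) ch′ → let pr , mp , es = has m ch′ in pr , there mp , es
                      ; (here refl) ch′ → first (chosen-unique ch ch′) } }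
            where
            new : Pair cls
            new = record { u = a ; v = b ; len = d a b ; route = rt }
            first : ∀ {a′ b′} → a ≡ a′ × b ≡ b′ → ∃[ pr ] pr ∈ new ∷ pairs × u pr ≡ a′ × v pr ≡ b′ × len pr ≡ d a′ b′
            first (refl , refl) = new , here refl , refl , refl , refl

        listed : ∀ (key : V → V) qs → AllPairs (λ p q → key p ≢ key q) qs → (∀ {q} → q ∈ qs → Choice key q) → Listed key qs
        listed key []       _        _  = record { pairs = [] ; distinct = [] ; from = λ () ; has = λ () }
        listed key (q ∷ qs) (a ∷ ap) ch =
          add (listed key qs ap (ch ∘ there)) (All.lookup a) (ch (here refl))

      -- `hσ` is the scale of the distances served. Spot classes have diameter 128 `hσ`; colours
      -- must separate classes at distance twice that, hence representatives up to (1 + 2 + 1) · 128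
      -- = 512. Within 8 `hσ` of a net point lie the representatives of both ends of each pair
      -- assigned to it.
      module Level {h : ℕ} (gr : Grain h) (hσ jf jn i : ℕ) (h≤hσ : h ≤ hσ)
                   (jf-scale : 2 ^ jf * h ≡ 512 * hσ) (jn-scale : 2 ^ jn * h ≡ 8 * hσ)
                   (jf≥ : 4 ≤ jf) (i≡ : i ≡ doublings (dim * jf)) (c : ℕ) where
        open Grain gr

        σ-net : List V
        σ-net = net (2 * hσ) (allFin n)

        palette : Colouring (λ u v → d u v ≤ 2 ^ 7 * hσ) (2 ^ (dim * 7)) σ-net
        palette = near-colouring hσ 7 σ-net (net-apart (2 * hσ) (allFin n))
        open Colouring palette

        spots : List V
        spots = filter (λ q → colour q ≟ c) σ-net

        spots-far : ∀ {p q} → p ∈ spots → q ∈ spots → d p q ≤ 128 * hσ → p ≡ q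
        spots-far {p} {q} mp mq le with p Fin.≟ q
        ... | yes e = e
        ... | no ne with ∈-filter⁻ (λ q → colour q ≟ c) {xs = σ-net} mp | ∈-filter⁻ (λ q → colour q ≟ c) {xs = σ-net} mq
        ... | ip , ep | iq , eq = contradiction (trans ep (sym eq)) (proper ip iq ne le)

        spots-key : ∀ {p q} → p ∈ spots → q ∈ spots → key p ≡ key q → p ≡ q
        spots-key mp mq e = spots-far mp mq (≤-trans (key-d e)
          (lin 2 (λ h s → (16 ⊛ h ⊑ 16 ⊛ s ∷ []) ⊢ 16 ⊛ h ⊑ 128 ⊛ s) h hσ (*-monoʳ-≤ 16 h≤hσ)))

        -- The test ranges over the whole unit of `x`, so that `cls` is constant on units. The
        -- radius 32 leaves room for shortest paths between representatives within 8 `hσ` of `q`,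
        -- which stay within 24 `hσ`.
        Meets : V → V → Set
        Meets x q = ∃[ x′ ] key x′ ≡ key x × d x′ q ≤ 32 * hσ

        near? : ∀ x → Dec (Any (Meets x) spots)
        near? x = Any.any? (λ q → Finₚ.any? (λ x′ → (key x′ Fin.≟ key x) ×-dec (d x′ q ≤? 32 * hσ))) spots

        pick : ∀ {x} → Dec (Any (Meets x) spots) → V
        pick (yes a)    = key (proj₁ (find a))
        pick {x} (no _) = key x

        cls : V → V
        cls x = pick {x} (near? x)

        meets-unique : ∀ {x y p q} → key x ≡ key y → p ∈ spots → q ∈ spots → Meets x p → Meets y q → p ≡ q
        meets-unique {p = p} {q} e mp mq (x′ , ex , lx) (y′ , ey , ly) = spots-far mp mq
          (≤-trans (d-tri′ p x′ q) (≤-trans (+-monoʳ-≤ (d x′ p) (d-tri x′ y′ q))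
            (lin 5 (λ a b c h s → (a ⊑ 32 ⊛ s ∷ b ⊑ 16 ⊛ h ∷ c ⊑ 32 ⊛ s ∷ 16 ⊛ h ⊑ 16 ⊛ s ∷ []) ⊢ a ⊕ (b ⊕ c) ⊑ 128 ⊛ s)
              (d x′ p) (d x′ y′) (d y′ q) h hσ lx (key-d (trans ex (trans e (sym ey)))) ly (*-monoʳ-≤ 16 h≤hσ))))

        transfer : ∀ {x y} → key x ≡ key y → Any (Meets x) spots → Any (Meets y) spots
        transfer e = Any.map λ { (x′ , ex , le) → x′ , trans ex e , le }

        pick-key : ∀ {x y} (p : Dec (Any (Meets x) spots)) (q : Dec (Any (Meets y) spots)) →
                   key x ≡ key y → pick {x} p ≡ pick {y} q
        pick-key (yes a) (yes a′) e = cong key (meets-unique e (proj₁ (proj₂ (find a))) (proj₁ (proj₂ (find a′)))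
                                                  (proj₂ (proj₂ (find a))) (proj₂ (proj₂ (find a′))))
        pick-key (yes a) (no ¬a)  e = contradiction (transfer e a) ¬a
        pick-key (no ¬a) (yes a)  e = contradiction (transfer (sym e) a) ¬a
        pick-key (no _)  (no _)   e = e

        key⇒cls : ∀ {x y} → key x ≡ key y → cls x ≡ cls y
        key⇒cls {x} {y} = pick-key (near? x) (near? y)

        cls-near : ∀ {x q} → q ∈ spots → Meets x q → cls x ≡ key q
        cls-near {x} mq h with near? x
        ... | yes a = cong key (meets-unique refl (proj₁ (proj₂ (find a))) mq (proj₂ (proj₂ (find a))) h)
        ... | no ¬a = contradiction (lose mq h) ¬a

        cls-ball : ∀ {x q} → q ∈ spots → d x q ≤ 32 * hσ → cls x ≡ key q
        cls-ball {x} mq le = cls-near mq (x , refl , le)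

        cls-spot : ∀ {q} → q ∈ spots → cls q ≡ key q
        cls-spot {q} mq = cls-ball mq (subst (_≤ 32 * hσ) (sym (d-refl q)) z≤n)

        CaseOf : V → V → Set
        CaseOf x k = (∃[ q ] q ∈ spots × Meets x q × k ≡ key q) ⊎ (k ≡ key x)

        cls-case : ∀ x → CaseOf x (cls x)
        cls-case x with near? x
        ... | yes a = inj₁ (proj₁ (find a) , proj₁ (proj₂ (find a)) , proj₂ (proj₂ (find a)) , refl)
        ... | no _  = inj₂ refl

        cls-idem : ∀ x → cls (cls x) ≡ cls x
        cls-idem x with cls-case x
        ... | inj₁ (q , mq , _ , e) = trans (cong cls e) (trans (key⇒cls (key-idem q)) (trans (cls-spot mq) (sym e)))
        ... | inj₂ e = trans (cong cls e) (key⇒cls (key-idem x))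

        cls-key : ∀ x → ∃[ a ] cls x ≡ key a
        cls-key x with cls-case x
        ... | inj₁ (q , _ , _ , e) = q , e
        ... | inj₂ e               = x , e

        cls-apart : ∀ {u v} → cls u ≢ cls v → 2 * h < d (cls u) (cls v)
        cls-apart {u} {v} ne with cls-key u | cls-key v
        ... | a , ea | a′ , ea′ = subst₂ (λ x y → 2 * h < d x y) (sym ea) (sym ea′)
          (key-apart λ e → ne (trans ea (trans e (sym ea′))))

        inside⇒cls : ∀ {u v} → Inside key u v → Inside cls u v
        inside⇒cls (a , e) = a , key⇒cls e

        to-spot : ∀ {x q} → q ∈ spots → Meets x q → ∃[ ℓ ] ℓ ≤ 16 * h + 32 * hσ × Route (Inside cls) x q ℓ
        to-spot {x} {q} mq (x′ , e , le) with conn (sym e)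
        ... | ℓ , le′ , rt = ℓ + d x′ q , +-mono-≤ le′ le ,
          mapʳ inside⇒cls rt ++ʳ
          mapʳ (λ { (a , lu , lv) → a , trans (cls-ball mq lu) (sym (cls-ball mq lv)) }) (ball-route (d-route x′ q) le)

        Short : V → V → Set
        Short x y = ∃[ ℓ ] ℓ ≤ 2 * (64 * hσ) × Route (Inside cls) x y ℓ

        16h≤ : 16 * h ≤ 16 * hσ
        16h≤ = *-monoʳ-≤ 16 h≤hσ

        short-sym : ∀ {x y} → Short x y → Short y x
        short-sym (ℓ , le , rt) = ℓ , le , reverseʳ inside-sym rt

        unit-unit : ∀ {x y} → key x ≡ key y → Short x y
        unit-unit e = let ℓ , le , rt = conn e in ℓ ,
          ≤-trans le (lin 2 (λ h s → (16 ⊛ h ⊑ 16 ⊛ s ∷ []) ⊢ 16 ⊛ h ⊑ 2 ⊛ 64 ⊛ s) h hσ 16h≤) , mapʳ inside⇒cls rt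

        spot-unit : ∀ {x y q} → q ∈ spots → Meets x q → key q ≡ key y → Short x y
        spot-unit mq hx e = let ℓ , le , rt = to-spot mq hx ; ℓ′ , le′ , rt′ = conn e in ℓ + ℓ′ ,
          lin 4 (λ a b h s → (a ⊑ 16 ⊛ h ⊕ 32 ⊛ s ∷ b ⊑ 16 ⊛ h ∷ 16 ⊛ h ⊑ 16 ⊛ s ∷ 16 ⊛ h ⊑ 16 ⊛ s ∷ []) ⊢ a ⊕ b ⊑ 2 ⊛ 64 ⊛ s)
            ℓ ℓ′ h hσ le le′ 16h≤ 16h≤ ,
          rt ++ʳ mapʳ inside⇒cls rt′

        spot-spot : ∀ {x y q} → q ∈ spots → Meets x q → Meets y q → Short x y
        spot-spot mq hx hy = let ℓ , le , rt = to-spot mq hx ; ℓ′ , le′ , rt′ = to-spot mq hy in ℓ + ℓ′ ,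
          lin 4 (λ a b h s → (a ⊑ 16 ⊛ h ⊕ 32 ⊛ s ∷ b ⊑ 16 ⊛ h ⊕ 32 ⊛ s ∷ 16 ⊛ h ⊑ 16 ⊛ s ∷ 16 ⊛ h ⊑ 16 ⊛ s ∷ []) ⊢ a ⊕ b ⊑ 2 ⊛ 64 ⊛ s)
            ℓ ℓ′ h hσ le le′ 16h≤ 16h≤ ,
          rt ++ʳ reverseʳ inside-sym rt′

        short : ∀ {x y k} → CaseOf x k → CaseOf y k → Short x y
        short (inj₂ ex) (inj₂ ey) = unit-unit (trans (sym ex) ey)
        short (inj₁ (q , mq , hx , ex)) (inj₂ ey) = spot-unit mq hx (trans (sym ex) ey)
        short (inj₂ ex) (inj₁ (q , mq , hy , ey)) = short-sym (spot-unit mq hy (trans (sym ey) ex))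
        short {y = y} (inj₁ (q , mq , hx , ex)) (inj₁ (q′ , mq′ , hy , ey)) =
          spot-spot mq hx (subst (Meets y) (sym (spots-key mq mq′ (trans (sym ex) ey))) hy)

        cls-conn : Within-class cls (2 * (64 * hσ))
        cls-conn {x} {y} e = short (cls-case x) (subst (CaseOf y) (sym e) (cls-case y))

        spot-split : Split
        spot-split = record
          { key = key ; cl = cls ; key⇒cl = key⇒cls ; D = 16 * h ; D′ = 2 * (64 * hσ)
          ; unit-conn = conn ; cl-conn = cls-conn }

        Q : ℕ
        Q = 2 ^ (dim * jf)

        rep-palette : Colouring (λ u v → d u v ≤ 2 ^ jf * h) Q reps
        rep-palette = near-colouring h jf reps reps-apart

        module Rep = Colouring rep-palette

        unit-palette : Palette spot-split (2 * (64 * hσ))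
        unit-palette = record
          { colour = Rep.colour ∘ key ; Q = Q ; colour< = λ v → Rep.colour< (key∈reps v)
          ; colour-far = λ {x} {y} le ne → Rep.proper (key∈reps x) (key∈reps y) ne
              (≤-trans (d-tri (key x) x (key y)) (≤-trans (+-monoʳ-≤ (d (key x) x) (d-tri x y (key y)))
                (≤-trans (lin 5 (λ a c e h s → (a ⊑ 16 ⊛ h ∷ c ⊑ 2 ⊛ 64 ⊛ s ∷ e ⊑ 16 ⊛ h ∷ 16 ⊛ h ⊑ 16 ⊛ s ∷ 16 ⊛ h ⊑ 16 ⊛ s ∷ []) ⊢
                                   a ⊕ (c ⊕ e) ⊑ 512 ⊛ s)
                           (d (key x) x) (d x y) (d y (key y)) h hσ (key-d (key-idem x)) le (key-d (sym (key-idem y)))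
                           (*-monoʳ-≤ 16 h≤hσ) (*-monoʳ-≤ 16 h≤hσ))
                         (≤-reflexive (sym jf-scale))))) }

        cls-d : ∀ {u v} → cls u ≡ cls v → d u v ≤ 2 * (64 * hσ)
        cls-d e with cls-conn e
        ... | _ , le , rt = ≤-trans (d-min (mapʳ proj₁ rt)) le

        cls∈reps : ∀ v → cls v ∈ reps
        cls∈reps v with cls-key v
        ... | a , e = subst (_∈ reps) (sym e) (key∈reps a)

        class-colour-far : ∀ {x y} → d x y ≤ 2 * (2 * (64 * hσ)) → cls x ≢ cls y → Rep.colour (cls x) ≢ Rep.colour (cls y)
        class-colour-far {x} {y} le ne = Rep.proper (cls∈reps x) (cls∈reps y) ne
          (≤-trans (d-tri (cls x) x (cls y)) (≤-trans (+-monoʳ-≤ (d (cls x) x) (d-tri x y (cls y)))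
            (≤-trans (lin 4 (λ a c e s → (a ⊑ 2 ⊛ 64 ⊛ s ∷ c ⊑ 2 ⊛ 2 ⊛ 64 ⊛ s ∷ e ⊑ 2 ⊛ 64 ⊛ s ∷ []) ⊢ a ⊕ (c ⊕ e) ⊑ 512 ⊛ s)
                       (d (cls x) x) (d x y) (d y (cls y)) hσ (cls-d (cls-idem x)) le (cls-d (sym (cls-idem y))))
                     (≤-reflexive (sym jf-scale)))))

        Near : V → List V
        Near q = filter (λ v → d q v ≤? 8 * hσ) reps

        Near-length : ∀ q → length (Near q) ≤ 2 ^ (dim * jn)
        Near-length q = packing h jn q (Near q) (AllPairsₚ.filter⁺ _ reps-apart)
          (All.map (λ le → ≤-trans le (≤-reflexive (sym jn-scale)))
                   (Allₚ.all-filter (λ v → d q v ≤? 8 * hσ) reps))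

        near-route : ∀ {q u v} → q ∈ spots → u ∈ Near q → v ∈ Near q → Route (Inside cls) u v (d u v)
        near-route {q} {u} {v} mq mu mv =
          mapʳ (λ { (a , lx , ly) → a , trans (in-ball lx) (sym (in-ball ly)) }) (ball-route (d-route u v) ≤-refl)
          where
          du = proj₂ (∈-filter⁻ (λ v → d q v ≤? 8 * hσ) {xs = reps} mu)
          dv = proj₂ (∈-filter⁻ (λ v → d q v ≤? 8 * hσ) {xs = reps} mv)
          in-ball : ∀ {x} → d x v ≤ d u v → cls x ≡ key q
          in-ball {x} le = cls-ball mq (≤-trans (d-tri x v q)
            (lin 6 (λ xv uv vq uq qv s → (xv ⊑ uv ∷ uv ⊑ uq ⊕ qv ∷ uq ⊑ 8 ⊛ s ∷ qv ⊑ 8 ⊛ s ∷ vq ⊑ 8 ⊛ s ∷ []) ⊢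
                     xv ⊕ vq ⊑ 32 ⊛ s)
              (d x v) (d u v) (d v q) (d u q) (d q v) hσ le (d-tri u q v)
              (subst (_≤ 8 * hσ) (d-sym q u) du) dv (subst (_≤ 8 * hσ) (d-sym q v) dv)))

        D h′ kmax : ℕ
        D    = 2 * (64 * hσ)
        h′   = scaled (64 * hσ) i
        kmax = suc i * Q + 1

        α W γ J λ′ κ : ℕ
        α  = 80 * h
        W  = D + α
        γ  = α + (Q * W + (W + (W + D)))
        J  = γ + D
        λ′ = Q * 2 * J
        κ  = J + λ′

        clusters : Clustered cls D (2 * h′) kmax
        clusters = Clusters.clustered dim halve cls (64 * hσ) cls-conn cls-idem h jf cls-apart
          (≤-reflexive (trans (sym (*-assoc 8 64 hσ)) (sym jf-scale))) jf≥ i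

        fit-conn : kmax * (3 * D) + D ≤ 4 * h′
        fit-conn = subst₂ (λ k y → (suc k * 2 ^ (dim * jf) + 1) * (3 * (2 * (64 * hσ))) + 2 * (64 * hσ) ≤ 4 * y)
          (sym i≡) (sym (trans (scaled-^ _ i) (cong (λ k → 2 ^ k * (64 * hσ)) i≡)))
          (Numerics.conn-fits (dim * jf) hσ)

        fit-cost : γ + γ + kmax * κ + λ′ ≤ 44 * h′
        fit-cost = subst₂ (λ k y → γ + γ + (suc k * 2 ^ (dim * jf) + 1) * κ + λ′ ≤ 44 * y)
          (sym i≡) (sym (trans (scaled-^ _ i) (cong (λ k → 2 ^ k * (64 * hσ)) i≡)))
          (Numerics.Cost.cost-fits (dim * jf) h hσ h≤hσ)

        module Pairs (i₁ i₂ : ℕ) where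

          open Pair
          open Listing i₁ i₂ Near cls

          Served : State → Set
          Served f = ∀ {q u v} → q ∈ spots → Chosen q u v → ∀ {x y} → key x ≡ u → key y ≡ v →
                     Joined f x y (d u v + 512 * h)

          spots-distinct : AllPairs (λ p q → key p ≢ key q) spots
          spots-distinct = distinct spots id (AllPairsₚ.filter⁺ _ (net-apart (2 * hσ) (allFin n)))
            where
            distinct : ∀ qs → (∀ {q} → q ∈ qs → q ∈ spots) → Apart (2 * hσ) qs → AllPairs (λ p q → key p ≢ key q) qs
            distinct []       _   []       = []
            distinct (q ∷ qs) sub (a ∷ ap) =
              All.tabulate (λ m e → differ (All.lookup a m) (spots-key (sub (here refl)) (sub (there m)) e)) ∷
              distinct qs (sub ∘ there) ap
              where
              differ : ∀ {p} → 2 * hσ < d q p → q ≢ p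
              differ lt refl = contradiction (subst (2 * hσ <_) (d-refl q) lt) λ ()

          near-cls : ∀ {q a} → q ∈ spots → a ∈ Near q → cls a ≡ key q
          near-cls {q} {a} mq ma = cls-ball mq (≤-trans
            (subst (_≤ 8 * hσ) (d-sym q a) (proj₂ (∈-filter⁻ (λ v → d q v ≤? 8 * hσ) {xs = reps} ma)))
            (*-monoˡ-≤ hσ {8} {32} (m≤m+n 8 24)))

          spots-listed : Listed key spots
          spots-listed = listed key spots spots-distinct (λ {q} mq → choice key q (near-cls mq) (near-route mq))

          module _ (s : State) (ready : Ready s cls) where
            module Serve (Ls : Listed key spots) where
              open Listed Ls

              -- At either end two jumps lead to the representative, via the strand of its unit;
              -- with the slack this makes 4 · 80 + 2 · 80 + 2 · 16 = 512.
              served : ∀ s₂ → Ready s₂ key → ∀ f → Jump f s₂ key α →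
                       (∀ {pr} → pr ∈ pairs → Joined f (u pr) (v pr) (len pr + (2 * α + 2 * (16 * h)))) → Served f
              served s₂ ready₂ f j meets {q} {a} {b} mq ch {x} {y} ex ey =
                let pr , mp , eu , ev , el = has mq ch
                    middle = subst₂ (λ a b → Joined f a b (len pr + (2 * α + 2 * (16 * h)))) eu ev (meets mp)
                in joined-≤ (lin 3 (λ l k h → (l ⊑ k ∷ []) ⊢
                       (80 ⊛ h ⊕ 80 ⊛ h) ⊕ (l ⊕ (2 ⊛ 80 ⊛ h ⊕ 2 ⊛ 16 ⊛ h)) ⊕ (80 ⊛ h ⊕ 80 ⊛ h) ⊑ k ⊕ 512 ⊛ h)
                       (len pr) (d a b) h (≤-reflexive el))
                     (joined-trans (joined-trans (to-key ex) middle) (joined-sym (to-key ey)))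
                where
                to-key : ∀ {x a} → key x ≡ a → Joined f x a (α + α)
                to-key {x} refl = let p , ip , ep = Ready.touched ready₂ x in
                  joined-trans (j (sym ep) ip) (joined-sym (j (trans (key-idem x) (sym ep)) ip))

              settled : Σ[ s₂ ∈ State ] s ⊆ˢ s₂ × Ready s₂ key ×
                          (∀ f → s₂ ⊆ˢ f → Jump f s₂ key α → Jump f s cls γ × Served f)
              settled =
                let s₂ , g , ready₂ , j = Settle.settle spot-split unit-palette α s ready pairs distinct
                in s₂ , g , ready₂ , λ f g′ jf′ → proj₁ (j f g′ jf′) , served s₂ ready₂ f jf′ (proj₂ (j f g′ jf′))

        module Above (K : Clustered cls D (2 * h′) kmax) where
          module K = Clustered K

          next-conn : Within-class K.cl (16 * h′)
          next-conn e = let ℓ , le , rt = K.cl-conn e in ℓ ,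
            ≤-trans le (lin 3 (λ h x y → (x ⊕ y ⊑ 4 ⊛ h ∷ x ⊕ y ⊑ 4 ⊛ h ∷ []) ⊢
                          (2 ⊛ 2 ⊛ h ⊕ x ⊕ y) ⊕ (2 ⊛ 2 ⊛ h ⊕ x ⊕ y) ⊑ 16 ⊛ h) h′ (kmax * (3 * D)) D fit-conn fit-conn) , rt

          next : Grain h′
          next = record { key = K.cl ; key-idem = K.cl-idem ; key-apart = K.cl-apart ; conn = next-conn }

          cluster-split : Split
          cluster-split = record
            { key = cls ; cl = K.cl ; key⇒cl = K.key⇒cl ; D = D ; D′ = 16 * h′
            ; unit-conn = cls-conn ; cl-conn = next-conn }

          class-palette : Palette cluster-split (2 * D)
          class-palette = record
            { colour = Rep.colour ∘ cls ; Q = Q ; colour< = λ v → Rep.colour< (cls∈reps v)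
            ; colour-far = class-colour-far }

          refined : ∀ s → Ready s K.cl →
                    Σ[ s₁ ∈ State ] s ⊆ˢ s₁ × Ready s₁ cls ×
                      (∀ f → s₁ ⊆ˢ f → Jump f s₁ cls γ → Jump f s K.cl (80 * h′))
          refined s ready =
            let s₁ , g , ready₁ , j = Refine.refine cluster-split K.cl-idem class-palette γ s ready
                                        K.script K.all (0 + 2 * (2 * h′)) kmax K.L≤ K.rk≤
            in s₁ , g , ready₁ , λ f g′ jf′ → jump-≤ {f} {s} {K.cl} total (j f g′ jf′)
            where
            total : γ + (16 * h′ + γ + 16 * h′ + (0 + 2 * (2 * h′)) + kmax * κ + λ′) ≤ 80 * h′
            total = lin 4 (λ g h x l → (g ⊕ g ⊕ x ⊕ l ⊑ 44 ⊛ h ∷ []) ⊢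
                      g ⊕ (16 ⊛ h ⊕ g ⊕ 16 ⊛ h ⊕ (# 0 ⊕ 2 ⊛ 2 ⊛ h) ⊕ x ⊕ l) ⊑ 80 ⊛ h) γ h′ (kmax * κ) λ′ fit-cost

          completes : ∀ i₁ i₂ {Good} → Completes gr Good → Completes next (λ f → Good f × Pairs.Served i₁ i₂ f)
          completes i₁ i₂ comp s ready =
            let s₁ , g₁ , ready₁ , j₁ = refined s ready
                s₂ , g₂ , ready₂ , j₂ = Pairs.Serve.settled i₁ i₂ s₁ ready₁ (Pairs.spots-listed i₁ i₂)
                f , g , full , j , good = comp s₂ ready₂
                jc , served = j₂ f g j
            in f , ⊆ˢ-trans g₁ (⊆ˢ-trans g₂ g) , full , j₁ f (⊆ˢ-trans g₂ g) jc , good , served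

        coarser : Grain h′
        coarser = Above.next clusters

        completes : ∀ i₁ i₂ {Good} → Completes gr Good → Completes coarser (λ f → Good f × Pairs.Served i₁ i₂ f)
        completes i₁ i₂ {Good} = Above.completes clusters i₁ i₂ {Good}

        -- Moving both ends to their representatives changes the distance by at most 2 · 16h, so the
        -- error 512h becomes 544h. Since 16h ≤ 4 `hσ`, the representatives are still listed near
        -- `q`; the indices are their positions there.
        pair-served : 4 * h ≤ hσ → ∀ {q x y} → q ∈ net (2 * hσ) (allFin n) → Colouring.colour palette q ≡ c →
                      d x q ≤ 2 * hσ → d x y ≤ 2 * hσ →
                      ∃[ i₁ ] ∃[ i₂ ] i₁ < 2 ^ (dim * jn) × i₂ < 2 ^ (dim * jn) ×
                        (∀ f → Pairs.Served i₁ i₂ f → Joined f x y (d x y + 544 * h))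
        pair-served 4h≤σ {q} {x} {y} mq cq xq xy =
          let i₁ , l₁ , e₁ = ∈-nth (near x qx) ; i₂ , l₂ , e₂ = ∈-nth (near y qy)
          in i₁ , i₂ , ≤-trans l₁ (Near-length q) , ≤-trans l₂ (Near-length q) , λ f served →
            joined-≤ close (served (∈-filter⁺ (λ q → Colouring.colour palette q ≟ c) mq cq) (e₁ , e₂) refl refl)
          where
          key-near : ∀ v → d v (key v) ≤ 16 * h
          key-near v = key-d (sym (key-idem v))
          qx : d q x ≤ 4 * hσ
          qx = lin 3 (λ a b s → (a ⊑ b ∷ b ⊑ 2 ⊛ s ∷ []) ⊢ a ⊑ 4 ⊛ s) (d q x) (d x q) hσ (≤-reflexive (d-sym q x)) xq
          qy : d q y ≤ 4 * hσ
          qy = lin 5 (λ a b c e s → (a ⊑ b ⊕ c ∷ b ⊑ e ∷ e ⊑ 2 ⊛ s ∷ c ⊑ 2 ⊛ s ∷ []) ⊢ a ⊑ 4 ⊛ s)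
                 (d q y) (d q x) (d x y) (d x q) hσ (d-tri q x y) (≤-reflexive (d-sym q x)) xq xy
          near : ∀ v → d q v ≤ 4 * hσ → key v ∈ Near q
          near v le = ∈-filter⁺ (λ v → d q v ≤? 8 * hσ) (key∈reps v)
            (lin 5 (λ a b c h s → (a ⊑ b ⊕ c ∷ b ⊑ 4 ⊛ s ∷ c ⊑ 16 ⊛ h ∷ 4 ⊛ 4 ⊛ h ⊑ 4 ⊛ s ∷ []) ⊢ a ⊑ 8 ⊛ s)
              (d q (key v)) (d q v) (d v (key v)) h hσ (d-tri q v (key v)) le (key-near v) (*-monoʳ-≤ 4 4h≤σ))
          close : d (key x) (key y) + 512 * h ≤ d x y + 544 * h
          close = lin 6 (λ kk kx xk xy yk h → (kk ⊑ kx ⊕ xk ∷ kx ⊑ 16 ⊛ h ∷ xk ⊑ xy ⊕ yk ∷ yk ⊑ 16 ⊛ h ∷ []) ⊢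
                            kk ⊕ 512 ⊛ h ⊑ xy ⊕ 544 ⊛ h)
            (d (key x) (key y)) (d (key x) x) (d x (key y)) (d x y) (d y (key y)) h
            (d-tri (key x) x (key y)) (key-d (key-idem x)) (d-tri x y (key y)) (key-near y)

      -- The tower of scales and its offsets

      module Towers (b jf jn i : ℕ) (2≤b : 2 ≤ b)
                    (jf-scale : ∀ h → 2 ^ jf * h ≡ 512 * (2 ^ b * h)) (jn-scale : ∀ h → 2 ^ jn * h ≡ 8 * (2 ^ b * h))
                    (jf≥ : 4 ≤ jf) (i≡ : i ≡ doublings (dim * jf)) where

        up : ℕ → ℕ
        up h = scaled (64 * (2 ^ b * h)) i

        h≤σ : ∀ h → h ≤ 2 ^ b * h
        h≤σ h = ≤-trans (≤-reflexive (sym (*-identityˡ h))) (*-monoˡ-≤ h (1≤2^ b))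

        coarser : ℕ → ∀ {h} → Grain h → Grain (up h)
        coarser c {h} gr = Level.coarser gr (2 ^ b * h) jf jn i (h≤σ h) (jf-scale h) (jn-scale h) jf≥ i≡ c

        Served : ∀ c {h} → Grain h → ℕ → ℕ → State → Set
        Served c {h} gr = Level.Pairs.Served gr (2 ^ b * h) jf jn i (h≤σ h) (jf-scale h) (jn-scale h) jf≥ i≡ c

        completes : ∀ c {h} (gr : Grain h) i₁ i₂ {Good} → Completes gr Good →
                    Completes (coarser c gr) (λ f → Good f × Served c gr i₁ i₂ f)
        completes c {h} gr i₁ i₂ {Good} =
          Level.completes gr (2 ^ b * h) jf jn i (h≤σ h) (jf-scale h) (jn-scale h) jf≥ i≡ c i₁ i₂ {Good}

        4h≤σ : ∀ h → 4 * h ≤ 2 ^ b * h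
        4h≤σ h = *-monoˡ-≤ h (^-monoʳ-≤ 2 2≤b)

        module Built (h₀ : ℕ) (1≤h₀ : 1 ≤ h₀) (apart : ∀ {u v} → u ≢ v → 2 * h₀ < d u v)
                     (Δ : ℕ) (diameter : ∀ u v → d u v ≤ Δ) where

          height : ℕ → ℕ
          height zero    = h₀
          height (suc ℓ) = up (height ℓ)

          -- This lets `Δ` levels suffice: at the top the separation exceeds the diameter, which
          -- leaves a single class, and a pair served at level ℓ has ℓ < `Δ`.
          height-grows : ∀ ℓ → ℓ < height ℓ
          height-grows zero    = 1≤h₀
          height-grows (suc ℓ) = ≤-trans
            (lin 2 (λ ℓ h → (64 ⊛ (# 1 ⊕ ℓ) ⊑ 64 ⊛ h ∷ []) ⊢ # 2 ⊕ ℓ ⊑ 64 ⊛ h) ℓ (height ℓ) (*-monoʳ-≤ 64 (height-grows ℓ)))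
            (≤-trans (*-monoʳ-≤ 64 (h≤σ (height ℓ)))
              (≤-trans (≤-trans (≤-reflexive (sym (*-identityˡ t))) (*-monoˡ-≤ t (1≤2^ i))) (≤-reflexive (sym (scaled-^ t i)))))
            where
            t : ℕ
            t = 64 * (2 ^ b * height ℓ)

          singletons : Grain h₀
          singletons = record
            { key = id ; key-idem = λ _ → refl ; key-apart = apart ; conn = λ { refl → 0 , z≤n , nil } }

          start : State
          start = record
            { S = λ x → isYes (x Fin.≟ r) ; par = id
            ; par-adj = λ e ne → contradiction (yes-≡ e) ne ; root-in = is-yes }
            where
            yes-≡ : ∀ {x} → isYes (x Fin.≟ r) ≡ true → x ≡ r
            yes-≡ {x} e with x Fin.≟ r
            ... | yes p = p
            is-yes : isYes (r Fin.≟ r) ≡ true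
            is-yes with r Fin.≟ r
            ... | yes _ = refl
            ... | no ne = contradiction refl ne

          start-only : ∀ {x} → In start x → x ≡ r
          start-only {x} e with x Fin.≟ r
          ... | yes p = p

          start-ready : ∀ {key} → (∀ u v → key u ≡ key v) → Ready start key
          start-ready const = record
            { touched = λ x → r , root-in start , const r x
            ; geo = λ {p} {p′} i i′ _ → subst₂ (λ a b → Joined start a b _) (sym (start-only i)) (sym (start-only i′)) (joined z≤n nil) }

          module _ (c : ℕ) where
            grain : ∀ ℓ → Grain (height ℓ)
            grain zero    = singletons
            grain (suc ℓ) = coarser c (grain ℓ)

            top-constant : ∀ u v → Grain.key (grain Δ) u ≡ Grain.key (grain Δ) v
            top-constant u v with Grain.key (grain Δ) u Fin.≟ Grain.key (grain Δ) v
            ... | yes e = e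
            ... | no ne = contradiction
              (≤-trans (Grain.key-apart (grain Δ) ne) (≤-trans (diameter _ _)
                (≤-trans (<⇒≤ (height-grows Δ)) (m≤n*m (height Δ) 2)))) (n≮n (2 * height Δ))

            module _ (i₁ i₂ : ℕ) where

              Good : ℕ → State → Set
              Good zero    f = ⊤
              Good (suc ℓ) f = Good ℓ f × Served c (grain ℓ) i₁ i₂ f

              good : ∀ ℓ → Completes (grain ℓ) (Good ℓ)
              good zero s ready =
                s , ⊆ˢ-refl , full , (λ { refl _ → joined z≤n nil }) , tt
                where
                full : Full s
                full v with Ready.touched ready v
                ... | p , ip , refl = ip
              good (suc ℓ) = completes c (grain ℓ) i₁ i₂ {Good ℓ} (good ℓ)

              good-below : ∀ {ℓ k f} → ℓ <′ k → Good k f → Served c (grain ℓ) i₁ i₂ f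
              good-below ≤′-refl       (_ , served) = served
              good-below (≤′-step lt) (good , _)   = good-below lt good

              whole : Σ[ f ∈ State ] Full f × Jump f start (Grain.key (grain Δ)) (80 * height Δ) × Good Δ f
              whole = let f , _ , full , j , good′ = good Δ start (start-ready top-constant) in f , full , j , good′

              tree : State
              tree = proj₁ whole

              tree-full : Full tree
              tree-full = proj₁ (proj₂ whole)

              tree-joined : ∀ v → Joined tree v r (80 * height Δ)
              tree-joined v = proj₁ (proj₂ (proj₂ whole)) (top-constant v r) (root-in start)

              tree-served : ∀ {ℓ} → ℓ < Δ → Served c (grain ℓ) i₁ i₂ tree
              tree-served lt = good-below (≤⇒≤′ lt) (proj₂ (proj₂ (proj₂ whole)))

          covered : ∀ ℓ {x y} → 2 ^ b * height ℓ < d x y → d x y ≤ 2 * (2 ^ b * height ℓ) →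
                    ∃[ c ] ∃[ i₁ ] ∃[ i₂ ] c < 2 ^ (dim * 7) × i₁ < 2 ^ (dim * jn) × i₂ < 2 ^ (dim * jn) ×
                      Joined (tree c i₁ i₂) x y (d x y + 544 * height ℓ)
          covered ℓ {x} {y} far near =
            let q , mq , xq = net-cover (2 * (2 ^ b * height ℓ)) (allFin n) (∈-allFin x)
                c = Colouring.colour colours q
                i₁ , i₂ , l₁ , l₂ , result = Level.pair-served (grain c ℓ) (2 ^ b * height ℓ) jf jn i (h≤σ (height ℓ))
                                          (jf-scale (height ℓ)) (jn-scale (height ℓ)) jf≥ i≡ c (4h≤σ (height ℓ)) mq refl xq near
            in c , i₁ , i₂ , Colouring.colour< colours mq , l₁ , l₂ , result (tree c i₁ i₂)
                 (tree-served c i₁ i₂ (≤-trans (height-grows ℓ) (≤-trans (h≤σ (height ℓ)) (≤-trans (<⇒≤ far) (diameter x y)))))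
            where
            colours = Doubling.near-colouring dim halve (2 ^ b * height ℓ) 7 (net (2 * (2 ^ b * height ℓ)) (allFin n))
                        (net-apart (2 * (2 ^ b * height ℓ)) (allFin n))

        -- Consecutive heights have ratio 2 ^ i · 64 · 2 ^ b = 2 ^ `A`, so the offsets below `A`
        -- together reach every power of two. The lower bound in `apart` makes the singletons a
        -- grain for every offset, and puts every positive distance above 2 ^ b.
        module Covering (A : ℕ) (A≡ : A ≡ i + (6 + b)) .{{_ : NonZero A}}
                        (apart : ∀ {u v} → u ≢ v → 2 * 2 ^ A < d u v)
                        (Δ : ℕ) (diameter : ∀ u v → d u v ≤ Δ) where

          Index : Set
          Index = Fin A × ℕ × ℕ × ℕ

          C N : ℕ
          C = 2 ^ (dim * 7)
          N = 2 ^ (dim * jn)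

          indices : List Index
          indices = cartesianProduct (allFin A) (cartesianProduct (upTo C) (cartesianProduct (upTo N) (upTo N)))

          indices-length : length indices ≡ A * (C * (N * N))
          indices-length = begin
            length indices
              ≡⟨ length-cartesianProduct (allFin A) (cartesianProduct (upTo C) (cartesianProduct (upTo N) (upTo N))) ⟩
            length (allFin A) * length (cartesianProduct (upTo C) (cartesianProduct (upTo N) (upTo N)))
              ≡⟨ cong₂ _*_ (Listₚ.length-tabulate {n = A} id) (length-cartesianProduct (upTo C) (cartesianProduct (upTo N) (upTo N))) ⟩
            A * (length (upTo C) * length (cartesianProduct (upTo N) (upTo N)))
              ≡⟨ cong (A *_) (cong₂ _*_ (Listₚ.length-upTo C) (length-cartesianProduct (upTo N) (upTo N))) ⟩
            A * (C * (length (upTo N) * length (upTo N)))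
              ≡⟨ cong (λ t → A * (C * (t * t))) (Listₚ.length-upTo N) ⟩
            A * (C * (N * N)) ∎
            where open ≡-Reasoning

          index-∈ : ∀ a {c i₁ i₂} → c < C → i₁ < N → i₂ < N → (a , c , i₁ , i₂) ∈ indices
          index-∈ a lc l₁ l₂ = ∈-cartesianProduct⁺ (∈-allFin a)
            (∈-cartesianProduct⁺ (∈-upTo⁺ lc) (∈-cartesianProduct⁺ (∈-upTo⁺ l₁) (∈-upTo⁺ l₂)))

          2^<A : ∀ {a} → a < A → 2 ^ a ≤ 2 ^ A
          2^<A lt = ^-monoʳ-≤ 2 (<⇒≤ lt)

          module At (a : Fin A) = Built (2 ^ toℕ a) (1≤2^ (toℕ a))
            (λ ne → ≤-<-trans (*-monoʳ-≤ 2 (2^<A (Finₚ.toℕ<n a))) (apart ne)) Δ diameter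

          tree : Index → State
          tree (a , c , i₁ , i₂) = At.tree a c i₁ i₂

          tree-full : ∀ ix v → In (tree ix) v
          tree-full (a , c , i₁ , i₂) = At.tree-full a c i₁ i₂

          tree-joined : ∀ ix → ∃[ α ] ∀ v → Joined (tree ix) v r α
          tree-joined (a , c , i₁ , i₂) = _ , At.tree-joined a c i₁ i₂

          up-^ : ∀ h → up h ≡ 2 ^ A * h
          up-^ h = begin
            up h                          ≡⟨ scaled-^ (64 * (2 ^ b * h)) i ⟩
            2 ^ i * (64 * (2 ^ b * h))    ≡⟨ regroup (2 ^ i) (2 ^ b) h ⟩
            2 ^ i * (64 * 2 ^ b) * h      ≡⟨ cong (λ t → 2 ^ i * t * h) (sym (^-distribˡ-+-* 2 6 b)) ⟩
            2 ^ i * 2 ^ (6 + b) * h       ≡⟨ cong (_* h) (sym (^-distribˡ-+-* 2 i (6 + b))) ⟩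
            2 ^ (i + (6 + b)) * h         ≡⟨ cong (λ t → 2 ^ t * h) (sym A≡) ⟩
            2 ^ A * h                     ∎
            where
            open ≡-Reasoning
            regroup : ∀ x y h → x * (64 * (y * h)) ≡ x * (64 * y) * h
            regroup = solve-∀

          height-^ : ∀ a ℓ → At.height a ℓ ≡ 2 ^ (toℕ a + ℓ * A)
          height-^ a zero    = cong (2 ^_) (sym (+-identityʳ (toℕ a)))
          height-^ a (suc ℓ) = begin
            up (At.height a ℓ)              ≡⟨ up-^ (At.height a ℓ) ⟩
            2 ^ A * At.height a ℓ           ≡⟨ cong (2 ^ A *_) (height-^ a ℓ) ⟩
            2 ^ A * 2 ^ (toℕ a + ℓ * A)     ≡⟨ sym (^-distribˡ-+-* 2 A (toℕ a + ℓ * A)) ⟩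
            2 ^ (A + (toℕ a + ℓ * A))       ≡⟨ cong (2 ^_) (regroup A (toℕ a) (ℓ * A)) ⟩
            2 ^ (toℕ a + (A + ℓ * A))       ∎
            where
            open ≡-Reasoning
            regroup : ∀ x y z → x + (y + z) ≡ y + (x + z)
            regroup = solve-∀

          scale-found : ∀ k → ∃[ a ] ∃[ ℓ ] At.height a ℓ ≡ 2 ^ k
          scale-found k = a , k / A , trans (height-^ a (k / A))
            (cong (2 ^_) (trans (cong (_+ k / A * A) (Finₚ.toℕ-fromℕ< (m%n<n k A))) (sym (m≡m%n+[m/n]*n k A))))
            where
            a : Fin A
            a = Fin.fromℕ< (m%n<n k A)

          b≤A : b ≤ A
          b≤A = subst (b ≤_) (sym A≡) (≤-trans (m≤n+m b 6) (m≤n+m (6 + b) i))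

          covered : ∀ x y → ∃[ ix ] ix ∈ indices × ∃[ L ] 2 ^ b * L ≤ (2 ^ b + 544) * d x y × Joined (tree ix) x y L
          covered x y with x Fin.≟ y
          ... | yes refl = (Fin.fromℕ< (m%n<n 0 A) , 0 , 0 , 0) , index-∈ _ (1≤2^ (dim * 7)) (1≤2^ (dim * jn)) (1≤2^ (dim * jn)) ,
            0 , ≤-trans (≤-reflexive (*-zeroʳ (2 ^ b))) z≤n , joined-refl
          ... | no ne =
            let k , far , near = octave (2 ^ b) (1≤2^ b) (d x y) (≤-<-trans (≤-trans (^-monoʳ-≤ 2 b≤A) (m≤n*m (2 ^ A) 2)) (apart ne))
                a , ℓ , e = scale-found k
                h = At.height a ℓ
                e′ = trans (*-comm (2 ^ k) (2 ^ b)) (cong (2 ^ b *_) (sym e))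
                c , i₁ , i₂ , lc , l₁ , l₂ , j = At.covered a ℓ (subst (_< d x y) e′ far) (subst (λ t → d x y ≤ 2 * t) e′ near)
            in (a , c , i₁ , i₂) , index-∈ a lc l₁ l₂ , d x y + 544 * h , stretch (2 ^ b) (d x y) h (subst (_< d x y) e′ far) , j
            where
            stretch : ∀ β D h → β * h < D → β * (D + 544 * h) ≤ (β + 544) * D
            stretch β D h lt = subst₂ _≤_ (sym (expand β D h)) (sym (*-distribʳ-+ D β 544))
              (+-monoʳ-≤ (β * D) (*-monoʳ-≤ 544 (<⇒≤ lt)))
              where
              expand : ∀ β D h → β * (D + 544 * h) ≡ β * D + 544 * (β * h)
              expand = solve-∀

          spanning : Index → Tree G
          spanning ix = record
            { tadj = tadj ; tadj-sym = tadj-sym ; tadj-adj = λ t → edge-adj (tree ix) (tadj⇒edge t)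
            ; connected = connected-tree ; acyclic = no-cycle }
            where open Spanning (tree ix) (tree-full ix) (proj₁ (tree-joined ix)) (proj₂ (tree-joined ix))

          family : TreeFamily G (A * (C * (N * N))) (2 ^ b)
          family = record
            { trees = map spanning indices
            ; size  = trans (Listₚ.length-map spanning indices) indices-length
            ; short = λ x y → let ix , m , L , le , j = covered x y in
                spanning ix , ∈-map⁺ spanning m , Joined.len j , ≤-trans (*-monoʳ-≤ (2 ^ b) (Joined.len≤ j)) le ,
                mapʳ (λ {u} {v} → Spanning.edge⇒tadj (tree ix) (tree-full ix) (proj₁ (tree-joined ix)) (proj₂ (tree-joined ix)) {u} {v}) (Joined.route j) }


  -- Naturals in the rationals, and the size of the cover

  ι : ℕ → ℚ
  ι n = (ℤ.+ n) ℚ./ 1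

  toℚᵘ-ι : ∀ n → ℚ.toℚᵘ (ι n) ℚᵘ.≃ mkℚᵘ (ℤ.+ n) 0
  toℚᵘ-ι n = ℚₚ.toℚᵘ-fromℚᵘ (mkℚᵘ (ℤ.+ n) 0)

  ι-+ : ∀ m n → ι (m + n) ≡ ι m ℚ.+ ι n
  ι-+ m n = ℚₚ.toℚᵘ-injective (begin
    ℚ.toℚᵘ (ι (m + n))                  ≈⟨ toℚᵘ-ι (m + n) ⟩
    mkℚᵘ (ℤ.+ (m + n)) 0                  ≈⟨ *≡* (cong (ℤ._* (ℤ.+ 1)) (trans (ℤₚ.pos-+ m n) (sym (cong₂ ℤ._+_ (ℤₚ.*-identityʳ (ℤ.+ m)) (ℤₚ.*-identityʳ (ℤ.+ n)))))) ⟩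
    mkℚᵘ (ℤ.+ m) 0 ℚᵘ.+ mkℚᵘ (ℤ.+ n) 0      ≈⟨ ℚᵘₚ.+-cong (ℚᵘₚ.≃-sym (toℚᵘ-ι m)) (ℚᵘₚ.≃-sym (toℚᵘ-ι n)) ⟩
    ℚ.toℚᵘ (ι m) ℚᵘ.+ ℚ.toℚᵘ (ι n)      ≈⟨ ℚᵘₚ.≃-sym (ℚₚ.toℚᵘ-homo-+ (ι m) (ι n)) ⟩
    ℚ.toℚᵘ (ι m ℚ.+ ι n)                ∎)
    where open ℚᵘₚ.≃-Reasoning

  ι-* : ∀ m n → ι (m * n) ≡ ι m ℚ.* ι n
  ι-* m n = ℚₚ.toℚᵘ-injective (begin
    ℚ.toℚᵘ (ι (m * n))                  ≈⟨ toℚᵘ-ι (m * n) ⟩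
    mkℚᵘ (ℤ.+ (m * n)) 0                  ≈⟨ *≡* (cong (ℤ._* (ℤ.+ 1)) (ℤₚ.pos-* m n)) ⟩
    mkℚᵘ (ℤ.+ m) 0 ℚᵘ.* mkℚᵘ (ℤ.+ n) 0      ≈⟨ ℚᵘₚ.*-cong (ℚᵘₚ.≃-sym (toℚᵘ-ι m)) (ℚᵘₚ.≃-sym (toℚᵘ-ι n)) ⟩
    ℚ.toℚᵘ (ι m) ℚᵘ.* ℚ.toℚᵘ (ι n)      ≈⟨ ℚᵘₚ.≃-sym (ℚₚ.toℚᵘ-homo-* (ι m) (ι n)) ⟩
    ℚ.toℚᵘ (ι m ℚ.* ι n)                ∎)
    where open ℚᵘₚ.≃-Reasoning

  ι-mono : ∀ {m n} → m ≤ n → ι m ℚ.≤ ι n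
  ι-mono {m} {n} le = ℚₚ.toℚᵘ-cancel-≤ (ℚᵘₚ.≤-respʳ-≃ (ℚᵘₚ.≃-sym (toℚᵘ-ι n))
    (ℚᵘₚ.≤-respˡ-≃ (ℚᵘₚ.≃-sym (toℚᵘ-ι m)) (*≤* (ℤₚ.*-monoʳ-≤-nonNeg (ℤ.+ 1) (ℤ.+≤+ le)))))

  ι-cancel : ∀ {m n} → ι m ℚ.≤ ι n → m ≤ n
  ι-cancel {m} {n} le with ℚᵘₚ.≤-respʳ-≃ (toℚᵘ-ι n) (ℚᵘₚ.≤-respˡ-≃ (toℚᵘ-ι m) (ℚₚ.toℚᵘ-mono-≤ le))
  ... | *≤* le′ = ℤₚ.drop‿+≤+ (subst₂ ℤ._≤_ (ℤₚ.*-identityʳ (ℤ.+ m)) (ℤₚ.*-identityʳ (ℤ.+ n)) le′)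

  0≤ι : ∀ n → 0ℚ ℚ.≤ ι n
  0≤ι n = ι-mono {0} {n} z≤n

  /-ι : ∀ p n .{{_ : NonZero n}} → ((ℤ.+ p) ℚ./ n) ℚ.* ι n ≡ ι p
  /-ι p (suc n) = ℚₚ.toℚᵘ-injective (begin
    ℚ.toℚᵘ (((ℤ.+ p) ℚ./ suc n) ℚ.* ι (suc n))           ≈⟨ ℚₚ.toℚᵘ-homo-* ((ℤ.+ p) ℚ./ suc n) (ι (suc n)) ⟩
    ℚ.toℚᵘ ((ℤ.+ p) ℚ./ suc n) ℚᵘ.* ℚ.toℚᵘ (ι (suc n))   ≈⟨ ℚᵘₚ.*-cong (ℚₚ.toℚᵘ-fromℚᵘ (mkℚᵘ (ℤ.+ p) n)) (toℚᵘ-ι (suc n)) ⟩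
    mkℚᵘ (ℤ.+ p) n ℚᵘ.* mkℚᵘ (ℤ.+ suc n) 0                 ≈⟨ *≡* (ℤₚ.*-assoc (ℤ.+ p) (ℤ.+ suc n) (ℤ.+ 1)) ⟩
    mkℚᵘ (ℤ.+ p) 0                                       ≈⟨ ℚᵘₚ.≃-sym (toℚᵘ-ι p) ⟩
    ℚ.toℚᵘ (ι p)                                       ∎)
    where open ℚᵘₚ.≃-Reasoning

  -- q s, provided that q ≥ 0 and the denominator of q divides s.
  over : ℕ → ℚ → ℕ
  over s q = ℤ.∣ ℚ.↥ q ∣ * (s / ℚ.↧ₙ q)

  over-ι : ∀ s q → 0ℚ ℚ.≤ q → ℚ.↧ₙ q ∣ s → ι (over s q) ≡ q ℚ.* ι s
  over-ι s q@(mkℚ (ℤ.+ p) n′ _) _ div = begin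
    ι (p * (s / suc n′))                         ≡⟨ ι-* p (s / suc n′) ⟩
    ι p ℚ.* ι (s / suc n′)                       ≡⟨ cong (ℚ._* ι (s / suc n′)) (trans (sym (/-ι p (suc n′))) (cong (ℚ._* ι (suc n′)) (ℚₚ.↥p/↧p≡p q))) ⟩
    q ℚ.* ι (suc n′) ℚ.* ι (s / suc n′)          ≡⟨ ℚₚ.*-assoc q (ι (suc n′)) (ι (s / suc n′)) ⟩
    q ℚ.* (ι (suc n′) ℚ.* ι (s / suc n′))        ≡⟨ cong (q ℚ.*_) (trans (sym (ι-* (suc n′) (s / suc n′))) (cong ι (m*[n/m]≡n div))) ⟩
    q ℚ.* ι s                                    ∎
    where open ≡-Reasoning
  over-ι s (mkℚ ℤ.-[1+ p ] n′ c) 0≤q _ = contradiction 0≤q λ { (ℚ.*≤* ()) }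

  *-mono-nonNeg : ∀ {p q r s} → 0ℚ ℚ.≤ q → 0ℚ ℚ.≤ r → p ℚ.≤ q → r ℚ.≤ s → p ℚ.* r ℚ.≤ q ℚ.* s
  *-mono-nonNeg {p} {q} {r} {s} 0≤q 0≤r p≤q r≤s = ℚₚ.≤-trans
    (ℚₚ.*-monoʳ-≤-nonNeg r {{ℚ.nonNegative 0≤r}} p≤q) (ℚₚ.*-monoˡ-≤-nonNeg q {{ℚ.nonNegative 0≤q}} r≤s)

  *-nonNeg : ∀ {p q} → 0ℚ ℚ.≤ p → 0ℚ ℚ.≤ q → 0ℚ ℚ.≤ p ℚ.* q
  *-nonNeg {p} {q} 0≤p 0≤q = subst (ℚ._≤ p ℚ.* q) (ℚₚ.*-zeroˡ q)
    (ℚₚ.*-monoʳ-≤-nonNeg q {{ℚ.nonNegative 0≤q}} 0≤p)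

  ^ℚ-nonNeg : ∀ {p} e → 0ℚ ℚ.≤ p → 0ℚ ℚ.≤ p D.^ℚ e
  ^ℚ-nonNeg zero    _   = 0≤ι 1
  ^ℚ-nonNeg (suc e) 0≤p = *-nonNeg 0≤p (^ℚ-nonNeg e 0≤p)

  ^ℚ-mono : ∀ {p q} e → 0ℚ ℚ.≤ p → p ℚ.≤ q → p D.^ℚ e ℚ.≤ q D.^ℚ e
  ^ℚ-mono zero    _   _   = ℚₚ.≤-refl
  ^ℚ-mono (suc e) 0≤p p≤q = *-mono-nonNeg (ℚₚ.≤-trans 0≤p p≤q) (^ℚ-nonNeg e 0≤p) p≤q (^ℚ-mono e 0≤p p≤q)

  ^ℚ-* : ∀ p q e → (p ℚ.* q) D.^ℚ e ≡ p D.^ℚ e ℚ.* q D.^ℚ e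
  ^ℚ-* p q zero    = sym (ℚₚ.*-identityˡ 1ℚ)
  ^ℚ-* p q (suc e) = begin
    p ℚ.* q ℚ.* (p ℚ.* q) D.^ℚ e                   ≡⟨ cong (p ℚ.* q ℚ.*_) (^ℚ-* p q e) ⟩
    p ℚ.* q ℚ.* (p D.^ℚ e ℚ.* q D.^ℚ e)            ≡⟨ ℚₚ.*-assoc p q _ ⟩
    p ℚ.* (q ℚ.* (p D.^ℚ e ℚ.* q D.^ℚ e))          ≡⟨ cong (p ℚ.*_) (swap q (p D.^ℚ e) (q D.^ℚ e)) ⟩
    p ℚ.* (p D.^ℚ e ℚ.* (q ℚ.* q D.^ℚ e))          ≡⟨ sym (ℚₚ.*-assoc p _ _) ⟩
    p ℚ.* p D.^ℚ e ℚ.* (q ℚ.* q D.^ℚ e)            ∎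
    where
    open ≡-Reasoning
    swap : ∀ x y z → x ℚ.* (y ℚ.* z) ≡ y ℚ.* (x ℚ.* z)
    swap x y z = trans (sym (ℚₚ.*-assoc x y z)) (trans (cong (ℚ._* z) (ℚₚ.*-comm x y)) (ℚₚ.*-assoc y x z))

  ι-^ : ∀ k e → ι (k ^ e) ≡ ι k D.^ℚ e
  ι-^ k zero    = refl
  ι-^ k (suc e) = trans (ι-* k (k ^ e)) (cong (ι k ℚ.*_) (ι-^ k e))

  count-bound : ∀ N β K ε e → N ≤ β ^ e → 0ℚ ℚ.≤ ε → ι β ℚ.* ε ℚ.≤ ι K → ι N ℚ.* ε D.^ℚ e ℚ.≤ ι K D.^ℚ e
  count-bound N β K ε e N≤ 0≤ε βε≤ = begin
    ι N ℚ.* ε D.^ℚ e              ≤⟨ ℚₚ.*-monoʳ-≤-nonNeg (ε D.^ℚ e) {{ℚ.nonNegative (^ℚ-nonNeg e 0≤ε)}} (ι-mono N≤) ⟩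
    ι (β ^ e) ℚ.* ε D.^ℚ e        ≡⟨ cong (ℚ._* ε D.^ℚ e) (ι-^ β e) ⟩
    ι β D.^ℚ e ℚ.* ε D.^ℚ e       ≡⟨ sym (^ℚ-* (ι β) ε e) ⟩
    (ι β ℚ.* ε) D.^ℚ e            ≤⟨ ^ℚ-mono e (*-nonNeg (0≤ι β) 0≤ε) βε≤ ⟩
    ι K D.^ℚ e                    ∎
    where open ℚₚ.≤-Reasoning

  -- Crudely `A` ≤ 2 ^ `A`, which is affordable because `A` is itself linear in d b. The exponents
  -- of two add up to 16 + 67d + 8db + b; by 1 ≤ b the summand 67d is at most 67db, and 67 + 8 = 75.
  index-count : ∀ dim b → 1 ≤ b →
    suc (doublings (dim * (9 + b)) + (5 + b)) * (2 ^ (dim * 7) * (2 ^ (dim * (3 + b)) * 2 ^ (dim * (3 + b)))) ≤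
    (2 ^ b) ^ (75 * (dim + 1) * 1)
  index-count dim b 1≤b = begin
    A * (2 ^ x * (2 ^ y * 2 ^ y))       ≤⟨ *-monoˡ-≤ _ (<⇒≤ (n<2^n A)) ⟩
    2 ^ A * (2 ^ x * (2 ^ y * 2 ^ y))   ≡⟨ cong (λ t → 2 ^ A * (2 ^ x * t)) (sym (^-distribˡ-+-* 2 y y)) ⟩
    2 ^ A * (2 ^ x * 2 ^ (y + y))       ≡⟨ cong (2 ^ A *_) (sym (^-distribˡ-+-* 2 x (y + y))) ⟩
    2 ^ A * 2 ^ (x + (y + y))           ≡⟨ sym (^-distribˡ-+-* 2 A (x + (y + y))) ⟩
    2 ^ (A + (x + (y + y)))             ≤⟨ ^-monoʳ-≤ 2 exponent ⟩
    2 ^ (b * (75 * (dim + 1) * 1))      ≡⟨ sym (^-*-assoc 2 b (75 * (dim + 1) * 1)) ⟩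
    (2 ^ b) ^ (75 * (dim + 1) * 1)      ∎
    where
    open ≤-Reasoning
    A x y : ℕ
    A = suc (doublings (dim * (9 + b)) + (5 + b))
    x = dim * 7
    y = dim * (3 + b)
    sum : ∀ d b → suc (suc (d * (9 + b) + (d * (9 + b) + d * (9 + b))) +
                       (suc (d * (9 + b) + (d * (9 + b) + d * (9 + b))) + 8) + (5 + b)) +
                  (d * 7 + (d * (3 + b) + d * (3 + b))) ≡ 16 + 67 * d + 8 * (d * b) + b
    sum = solve-∀
    expand : ∀ d b → b * (75 * (d + 1) * 1) ≡ 75 * (d * b) + 75 * b
    expand = solve-∀
    d≤ : dim ≤ dim * b
    d≤ = ≤-trans (≤-reflexive (sym (*-identityʳ dim))) (*-monoʳ-≤ dim 1≤b)
    exponent : A + (x + (y + y)) ≤ b * (75 * (dim + 1) * 1)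
    exponent = subst₂ _≤_ (sym (sum dim b)) (sym (expand dim b))
      (lin 3 (λ d b db → (67 ⊛ d ⊑ 67 ⊛ db ∷ 16 ⊛ # 1 ⊑ 16 ⊛ b ∷ b ⊑ b ∷ []) ⊢ # 16 ⊕ 67 ⊛ d ⊕ 8 ⊛ db ⊕ b ⊑ 75 ⊛ db ⊕ 75 ⊛ b)
        dim b (dim * b) (*-monoʳ-≤ 67 d≤) (*-monoʳ-≤ 16 1≤b) ≤-refl)

  -- `b` is the first exponent at which the doublings of p reach kq. As p < q and 2 ≤ k, one
  -- doubling is not enough; the resulting 2 ≤ b is what makes a served distance at least four times
  -- the height.
  power-between : ∀ k p q → 2 ≤ k → 1 ≤ p → p < q → ∃[ b ] 2 ≤ b × k * q ≤ 2 ^ b * p × 2 ^ b * p ≤ 2 * k * q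
  power-between k p q 2≤k 1≤p p<q = found (octave p 1≤p (k * q) (≤-trans p<q (≤-trans (m≤m+n q (q + 0)) 2q≤kq)))
    where
    2q≤kq : 2 * q ≤ k * q
    2q≤kq = *-monoˡ-≤ q 2≤k
    found : ∃[ j ] 2 ^ j * p < k * q × k * q ≤ 2 * (2 ^ j * p) → ∃[ b ] 2 ≤ b × k * q ≤ 2 ^ b * p × 2 ^ b * p ≤ 2 * k * q
    found (zero , _ , le)   = contradiction (≤-trans 2q≤kq le)
      (<⇒≱ (*-monoʳ-< 2 (subst (_< q) (sym (*-identityˡ p)) p<q)))
    found (suc j , lt , le) = 2 + j , s≤s (s≤s z≤n) ,
      ≤-trans le (≤-reflexive (sym (*-assoc 2 (2 ^ suc j) p))) ,
      subst₂ _≤_ (sym (*-assoc 2 (2 ^ suc j) p)) (sym (*-assoc 2 k q)) (*-monoʳ-≤ 2 (<⇒≤ lt))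

  precision : ∀ k → 2 ≤ k → ∀ ε → 0ℚ ℚ.< ε → ε ℚ.< 1ℚ →
              ∃[ b ] 2 ≤ b × ι k ℚ.≤ ι (2 ^ b) ℚ.* ε × ι (2 ^ b) ℚ.* ε ℚ.≤ ι (2 * k)
  precision k 2≤k ε@(mkℚ (ℤ.+ zero) _ _) (ℚ.*<* lt) _ = contradiction lt λ { (ℤ.+<+ ()) }
  precision k 2≤k ε@(mkℚ ℤ.-[1+ _ ] _ _) (ℚ.*<* ()) _
  precision k 2≤k ε@(mkℚ (ℤ.+ suc p) q-1 _) _ (ℚ.*<* lt) =
    let b , 2≤b , enough , fits = power-between k (suc p) q 2≤k (s≤s z≤n) p<q
    in b , 2≤b , cancel (subst₂ ℚ._≤_ (ι-* k q) (product-ι b) (ι-mono enough)) ,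
         cancel (subst₂ ℚ._≤_ (product-ι b) (ι-* (2 * k) q) (ι-mono fits))
    where
    q : ℕ
    q = suc q-1
    p<q : suc p < q
    p<q = ℤₚ.drop‿+<+ (subst₂ ℤ._<_ (ℤₚ.*-identityʳ (ℤ.+ suc p)) (ℤₚ.*-identityˡ (ℤ.+ q)) lt)
    cancel : ∀ {x y} → x ℚ.* ι q ℚ.≤ y ℚ.* ι q → x ℚ.≤ y
    cancel = ℚₚ.*-cancelʳ-≤-pos (ι q) {{ℚₚ.normalize-pos q 1}}
    product-ι : ∀ b → ι (2 ^ b * suc p) ≡ ι (2 ^ b) ℚ.* ε ℚ.* ι q
    product-ι b = trans (ι-* (2 ^ b) (suc p)) (trans
      (cong (ι (2 ^ b) ℚ.*_) (trans (sym (/-ι (suc p) q)) (cong (ℚ._* ι q) (ℚₚ.↥p/↧p≡p ε))))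
      (sym (ℚₚ.*-assoc (ι (2 ^ b)) ε (ι q))))

  bounded : ∀ {k} (f : Fin k → ℕ) → ∃[ b ] ∀ i → f i ≤ b
  bounded {zero}  f = 0 , λ ()
  bounded {suc k} f = let b , h = bounded (f ∘ Fin.suc) in f Fin.zero + b ,
    λ { Fin.zero → m≤m+n (f Fin.zero) b ; (Fin.suc i) → ≤-trans (h i) (m≤n+m b (f Fin.zero)) }

  -- Clearing denominators turns G into a network over ℕ in which distinct
  -- vertices are at distance at least 2 ^ B.
  module Integral {m : ℕ} (G : D.WGraph (suc m)) (conn : D.Connected (D.adj G)) (B : ℕ) where

    Vertex : Set
    Vertex = Fin (suc m)

    denominator : Vertex × Vertex → ℕ
    denominator (u , v) = ℚ.↧ₙ (D.w G u v)

    pairs : List (Vertex × Vertex)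
    pairs = cartesianProduct (allFin (suc m)) (allFin (suc m))

    scale U : ℕ
    scale = product (map denominator pairs)
    U     = 2 ^ B * scale

    instance
      scale-nonZero : NonZero scale
      scale-nonZero = product≢0 {map denominator pairs} (Allₚ.map⁺ {xs = pairs} (All.universal nonZero-at pairs))
        where
        nonZero-at : ∀ e → NonZero (denominator e)
        nonZero-at _ = _

      U-nonZero : NonZero U
      U-nonZero = m*n≢0 (2 ^ B) scale {{m^n≢0 2 B}}

    -- Pairs that are not edges may carry any rational; the maximum with 1 makes their weights
    -- positive and changes no edge.
    weight : Vertex → Vertex → ℕ
    weight u v = 2 ^ B * (over scale (D.w G u v) ⊔ 1)

    weight-≥ : ∀ u v → 2 ^ B ≤ weight u v
    weight-≥ u v = ≤-trans (≤-reflexive (sym (*-identityʳ (2 ^ B)))) (*-monoʳ-≤ (2 ^ B) (m≤n⊔m (over scale (D.w G u v)) 1))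

    weight-ι : ∀ {u v} → D.adj G u v ≡ true → ι (weight u v) ≡ D.w G u v ℚ.* ι U
    weight-ι {u} {v} a = begin
      ι (2 ^ B * (over scale q ⊔ 1))         ≡⟨ cong (λ t → ι (2 ^ B * t)) (m≥n⇒m⊔n≡m (positive-≥1 numerator-positive)) ⟩
      ι (2 ^ B * over scale q)               ≡⟨ ι-* (2 ^ B) (over scale q) ⟩
      ι (2 ^ B) ℚ.* ι (over scale q)         ≡⟨ cong (ι (2 ^ B) ℚ.*_) numerator ⟩
      ι (2 ^ B) ℚ.* (q ℚ.* ι scale)          ≡⟨ sym (ℚₚ.*-assoc (ι (2 ^ B)) q (ι scale)) ⟩
      ι (2 ^ B) ℚ.* q ℚ.* ι scale            ≡⟨ cong (ℚ._* ι scale) (ℚₚ.*-comm (ι (2 ^ B)) q) ⟩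
      q ℚ.* ι (2 ^ B) ℚ.* ι scale            ≡⟨ ℚₚ.*-assoc q (ι (2 ^ B)) (ι scale) ⟩
      q ℚ.* (ι (2 ^ B) ℚ.* ι scale)          ≡⟨ cong (q ℚ.*_) (sym (ι-* (2 ^ B) scale)) ⟩
      q ℚ.* ι U                              ∎
      where
      open ≡-Reasoning
      q : ℚ
      q = D.w G u v
      numerator : ι (over scale q) ≡ q ℚ.* ι scale
      numerator = over-ι scale q (ℚₚ.<⇒≤ (D.w-pos G u v a))
        (∈⇒∣product (∈-map⁺ denominator (∈-cartesianProduct⁺ (∈-allFin u) (∈-allFin v))))
      numerator-positive : 0ℚ ℚ.< ι (over scale q)
      numerator-positive = subst₂ ℚ._<_ (ℚₚ.*-zeroˡ (ι scale)) (sym numerator)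
        (ℚₚ.*-monoˡ-<-pos (ι scale) {{ℚₚ.normalize-pos scale 1}} (D.w-pos G u v a))
      positive-≥1 : ∀ {k} → 0ℚ ℚ.< ι k → 1 ≤ k
      positive-≥1 {zero}  lt = contradiction lt (ℚₚ.<-irrefl refl)
      positive-≥1 {suc k} _  = s≤s z≤n

    module R = Routes weight (λ u v → ≤-trans (1≤2^ B) (weight-≥ u v))
      (λ u v → cong (λ q → 2 ^ B * (over scale q ⊔ 1)) (D.w-sym G u v))

    Adj : R.Rel
    Adj u v = D.adj G u v ≡ true

    walk-route : ∀ {u v} (p : D.Walk (D.adj G) u v) →
                 ∃[ ℓ ] R.Route Adj u v ℓ × D.walkWeight (D.w G) p ℚ.* ι U ≡ ι ℓ
    walk-route D.here = 0 , R.nil , ℚₚ.*-zeroˡ (ι U)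
    walk-route (D.step {u} {v} a p) =
      let ℓ , rt , e = walk-route p in weight u v + ℓ , a R.∷ rt ,
        trans (ℚₚ.*-distribʳ-+ (ι U) (D.w G u v) (D.walkWeight (D.w G) p))
          (trans (cong₂ ℚ._+_ (sym (weight-ι a)) e) (sym (ι-+ (weight u v) ℓ)))

    route-walk : ∀ {E : R.Rel} {A : Vertex → Vertex → Bool} → (∀ {u v} → E u v → A u v ≡ true × Adj u v) →
                 ∀ {u v ℓ} → R.Route E u v ℓ → ∃[ p ] D.walkWeight {A = A} (D.w G) {u} {v} p ℚ.* ι U ≡ ι ℓ
    route-walk sub R.nil = D.here , ℚₚ.*-zeroˡ (ι U)
    route-walk sub (R._∷_ {u} {v} {ℓ = ℓ} e rt) =
      let p , eq = route-walk sub rt in D.step (proj₁ (sub e)) p ,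
        trans (ℚₚ.*-distribʳ-+ (ι U) (D.w G u v) (D.walkWeight (D.w G) p))
          (trans (cong₂ ℚ._+_ (sym (weight-ι (proj₂ (sub e)))) eq) (sym (ι-+ (weight u v) ℓ)))

    cancel-U : ∀ {p q} → p ℚ.* ι U ℚ.≤ q ℚ.* ι U → p ℚ.≤ q
    cancel-U = ℚₚ.*-cancelʳ-≤-pos (ι U) {{ℚₚ.normalize-pos U 1}}

    network : Network
    network = record
      { w = weight ; w-pos = λ u v → ≤-trans (1≤2^ B) (weight-≥ u v)
      ; w-sym = λ u v → cong (λ q → 2 ^ B * (over scale q ⊔ 1)) (D.w-sym G u v)
      ; Adj = Adj ; Adj? = λ u v → D.adj G u v ≟ᵇ true ; Adj-sym = λ {u} {v} a → trans (D.adj-sym G v u) a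
      ; connected = λ u v → let ℓ , rt , _ = walk-route (conn u v) in ℓ , rt }

    open Metric network using (d; d-route; d-min)

    apart : ∀ {u v} → u ≢ v → 2 ^ B ≤ d u v
    apart {u} {v} ne = far ne (d-route u v)
      where
      far : ∀ {u v ℓ} → u ≢ v → R.Route Adj u v ℓ → 2 ^ B ≤ ℓ
      far ne R.nil = contradiction refl ne
      far ne (R._∷_ {u} {v} {ℓ = ℓ} _ _) = ≤-trans (weight-≥ u v) (m≤m+n (weight u v) ℓ)

    diameter : ∃[ Δ ] ∀ u v → d u v ≤ Δ
    diameter = let f , h = rows ; b , h′ = bounded f in b , λ u v → ≤-trans (h u v) (h′ u)
      where
      rows : Σ[ f ∈ (Vertex → ℕ) ] (∀ u v → d u v ≤ f u)
      rows = (λ u → proj₁ (bounded (d u))) , λ u → proj₂ (bounded (d u))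

    module _ (dim : ℕ) (doubling : D.DoublingDim≤ G dim) where

      halve : ∀ c h → Σ[ cs ∈ List Vertex ] length cs ≤ 2 ^ dim ×
                      (∀ x → d c x ≤ 2 * h → ∃[ c′ ] c′ ∈ cs × d c′ x ≤ h)
      -- The doubling hypothesis speaks of positive radii; at radius 0 the ball around `c` covers
      -- itself.
      halve c zero = c ∷ [] , 1≤2^ dim , λ x le → c , here refl , le
      halve c h@(suc _) =
        let cs , len , cover = doubling c radius 0<radius
        in cs , len , λ x le →
          let p , e = route-walk (λ a → a , a) (d-route c x)
              c′ , m , p′ , le′ = cover x (p , cancel-U (subst₂ ℚ._≤_ (sym e) (sym (/-ι (2 * h) U)) (ι-mono le)))
              ℓ , rt , e′ = walk-route p′
          in c′ , m , ≤-trans (d-min rt) (ι-cancel (subst₂ ℚ._≤_ e′ half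
               (ℚₚ.*-monoʳ-≤-nonNeg (ι U) {{ℚ.nonNegative (0≤ι U)}} le′)))
        where
        radius : ℚ
        radius = (ℤ.+ (2 * h)) ℚ./ U
        0<radius : 0ℚ ℚ.< radius
        0<radius = ℚₚ.positive⁻¹ radius {{ℚₚ.normalize-pos (2 * h) U}}
        half : ½ ℚ.* radius ℚ.* ι U ≡ ι h
        half = begin
          ½ ℚ.* radius ℚ.* ι U        ≡⟨ ℚₚ.*-assoc ½ radius (ι U) ⟩
          ½ ℚ.* (radius ℚ.* ι U)      ≡⟨ cong (½ ℚ.*_) (trans (/-ι (2 * h) U) (ι-* 2 h)) ⟩
          ½ ℚ.* (ι 2 ℚ.* ι h)         ≡⟨ sym (ℚₚ.*-assoc ½ (ι 2) (ι h)) ⟩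
          ½ ℚ.* ι 2 ℚ.* ι h           ≡⟨ ℚₚ.*-identityˡ (ι h) ⟩
          ι h                         ∎
          where open ≡-Reasoning

    spanning : Tree network → D.SpanningTree G
    spanning t = record
      { sub = record { tadj = tadj ; tadj-sym = tadj-sym ; tadj-sub = λ u v → tadj-adj }
      ; connected = connected ; acyclic = acyclic }
      where open Tree t

    stretch-ι : ∀ {β ℓ D ε} → .{{NonZero β}} → β * ℓ ≤ (β + 544) * D → ι 544 ℚ.≤ ι β ℚ.* ε → ι ℓ ℚ.≤ (1ℚ ℚ.+ ε) ℚ.* ι D
    stretch-ι {β} {ℓ} {D} {ε} le fine = ℚₚ.*-cancelˡ-≤-pos (ι β) {{ℚₚ.normalize-pos β 1}} (begin
      ι β ℚ.* ι ℓ                        ≡⟨ sym (ι-* β ℓ) ⟩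
      ι (β * ℓ)                          ≤⟨ ι-mono le ⟩
      ι ((β + 544) * D)                  ≡⟨ trans (ι-* (β + 544) D) (cong (ℚ._* ι D) (ι-+ β 544)) ⟩
      (ι β ℚ.+ ι 544) ℚ.* ι D            ≤⟨ ℚₚ.*-monoʳ-≤-nonNeg (ι D) {{ℚ.nonNegative (0≤ι D)}} (ℚₚ.+-monoʳ-≤ (ι β) fine) ⟩
      (ι β ℚ.+ ι β ℚ.* ε) ℚ.* ι D        ≡⟨ cong (λ t → (t ℚ.+ ι β ℚ.* ε) ℚ.* ι D) (sym (ℚₚ.*-identityʳ (ι β))) ⟩
      (ι β ℚ.* 1ℚ ℚ.+ ι β ℚ.* ε) ℚ.* ι D ≡⟨ cong (ℚ._* ι D) (sym (ℚₚ.*-distribˡ-+ (ι β) 1ℚ ε)) ⟩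
      ι β ℚ.* (1ℚ ℚ.+ ε) ℚ.* ι D         ≡⟨ ℚₚ.*-assoc (ι β) (1ℚ ℚ.+ ε) (ι D) ⟩
      ι β ℚ.* ((1ℚ ℚ.+ ε) ℚ.* ι D)       ∎)
      where open ℚₚ.≤-Reasoning

    module _ {N β : ℕ} .{{_ : NonZero β}} (F : TreeFamily network N β) (ε : ℚ) (precise : ι 544 ℚ.≤ ι β ℚ.* ε) where
      open TreeFamily F

      family-cover : Σ[ Ts ∈ List (D.SpanningTree G) ] D.IsTreeCover G (1ℚ ℚ.+ ε) Ts × length Ts ≡ N
      family-cover = map spanning trees , cover , trans (Listₚ.length-map spanning trees) size
        where
        cover : D.IsTreeCover G (1ℚ ℚ.+ ε) (map spanning trees)
        cover u v =
          let t , m , ℓ , le , rt = short u v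
              q , eq = route-walk (λ e → e , Tree.tadj-adj t e) rt
          in spanning t , ∈-map⁺ spanning m , λ p →
            let k , rt′ , ep = walk-route p
            in q , cancel-U (subst₂ ℚ._≤_ (sym eq)
                 (trans (cong ((1ℚ ℚ.+ ε) ℚ.*_) (sym ep)) (sym (ℚₚ.*-assoc (1ℚ ℚ.+ ε) (D.walkWeight (D.w G) p) (ι U))))
                 (stretch-ι {β} {ℓ} {k} {ε} (≤-trans le (*-monoʳ-≤ (β + 544) (d-min rt′))) precise))

  -- Choice of the parameters and conclusion

  tree-family : (G : Network) (r : Network.V G) (dim : ℕ) →
    (∀ c h → Σ[ cs ∈ List (Network.V G) ] length cs ≤ 2 ^ dim ×
             (∀ x → Metric.d G c x ≤ 2 * h → ∃[ c′ ] c′ ∈ cs × Metric.d G c′ x ≤ h)) →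
    ∀ b → 2 ≤ b →
    (∀ {u v} → u ≢ v → 2 * 2 ^ suc (doublings (dim * (9 + b)) + (5 + b)) < Metric.d G u v) →
    ∀ Δ → (∀ u v → Metric.d G u v ≤ Δ) →
    TreeFamily G (suc (doublings (dim * (9 + b)) + (5 + b)) * (2 ^ (dim * 7) * (2 ^ (dim * (3 + b)) * 2 ^ (dim * (3 + b))))) (2 ^ b)
  tree-family G r dim halve b 2≤b apart Δ diameter =
    -- 512 = 2 ^ 9 and 8 = 2 ^ 3 turn the radii 512 `hσ` and 8 `hσ` into 2 ^ (9 + b) h and 2 ^ (3 +
    -- b) h.
    States.Grains.Towers.Covering.family G r dim halve b (9 + b) (3 + b) (doublings (dim * (9 + b))) 2≤b (shift 9 b) (shift 3 b)
      (m≤m+n 4 (5 + b)) refl (suc (doublings (dim * (9 + b)) + (5 + b))) (sym (+-suc (doublings (dim * (9 + b))) (5 + b)))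
      apart Δ diameter
    where
    shift : ∀ j b h → 2 ^ (j + b) * h ≡ 2 ^ j * (2 ^ b * h)
    shift j b h = trans (cong (_* h) (^-distribˡ-+-* 2 j b)) (*-assoc (2 ^ j) (2 ^ b) h)

  2^-gap : ∀ A → 2 * 2 ^ A < 2 ^ (2 + A)
  2^-gap A = *-monoʳ-< 2 (lin 1 (λ p → (# 1 ⊑ p ∷ []) ⊢ # 1 ⊕ p ⊑ 2 ⊛ p) (2 ^ A) (1≤2^ A))

  tree-cover : ∀ n (G : D.WGraph n) → D.Connected (D.adj G) → ∀ dim → D.DoublingDim≤ G dim → ∀ ε → 0ℚ ℚ.< ε → ε ℚ.< 1ℚ →
               Σ[ Ts ∈ List (D.SpanningTree G) ] D.IsTreeCover G (1ℚ ℚ.+ ε) Ts ×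
                 ι (length Ts) ℚ.* ε D.^ℚ (75 * (dim + 1) * 1) ℚ.≤ ι 1088 D.^ℚ (75 * (dim + 1) * 1)
  -- Without vertices there is no root to grow from, and the empty list is a cover.
  tree-cover zero    G conn dim doubling ε 0<ε ε<1 =
    [] , (λ ()) , subst (ℚ._≤ _) (sym (ℚₚ.*-zeroˡ (ε D.^ℚ (75 * (dim + 1) * 1)))) (^ℚ-nonNeg (75 * (dim + 1) * 1) (0≤ι 1088))
  tree-cover (suc m) G conn dim doubling ε 0<ε ε<1 =
    let b , 2≤b , precise , coarse = precision 544 (s≤s (s≤s z≤n)) ε 0<ε ε<1
        Ts , cover , len = build b 2≤b precise
    in Ts , cover , count-bound (length Ts) (2 ^ b) 1088 ε (75 * (dim + 1) * 1)
         (≤-trans (≤-reflexive len) (index-count dim b (≤-trans (s≤s z≤n) 2≤b))) (ℚₚ.<⇒≤ 0<ε) coarse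
    where
    build : ∀ b → 2 ≤ b → ι 544 ℚ.≤ ι (2 ^ b) ℚ.* ε →
            Σ[ Ts ∈ List (D.SpanningTree G) ] D.IsTreeCover G (1ℚ ℚ.+ ε) Ts ×
              length Ts ≡ suc (doublings (dim * (9 + b)) + (5 + b)) * (2 ^ (dim * 7) * (2 ^ (dim * (3 + b)) * 2 ^ (dim * (3 + b))))
    build b 2≤b precise = family-cover {{m^n≢0 2 b}}
      (tree-family network Fin.zero dim (halve dim doubling) b 2≤b
        (λ ne → ≤-trans (2^-gap (suc (doublings (dim * (9 + b)) + (5 + b)))) (apart ne)) (proj₁ diameter) (proj₂ diameter))
      ε precise
      -- Rescaling by 2 ^ (`A` + 2) puts distinct vertices strictly more than 2 · 2 ^ `A` apart, as
      -- the tower of scales requires.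
      where open Integral G conn (2 + suc (doublings (dim * (9 + b)) + (5 + b)))

open import Defs
open import Data.Nat using (ℕ; _+_; _*_; _^_)
open import Data.Nat.Logarithm using (⌊log₂_⌋)
open import Data.Integer using (+_)
open import Data.List using (List; length)
open import Data.Product using (Σ; _×_; _,_)
open import Data.Rational using (ℚ; 0ℚ; 1ℚ; _/_; _<_; _≤_) renaming (_+_ to _+ℚ_; _*_ to _*ℚ_)

theorem1p2 : Σ ℕ λ C → Σ ℕ λ k → Σ ℕ λ K →
    ∀ (n : ℕ) (G : WGraph n) → Connected (adj G) →
    ∀ (d : ℕ) → DoublingDim≤ G d →
    ∀ (ε : ℚ) → 0ℚ < ε → ε < 1ℚ →
    Σ (List (SpanningTree G)) λ Ts →
      IsTreeCover G (1ℚ +ℚ ε) Ts ×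
      (((+ length Ts) / 1) *ℚ (ε ^ℚ (C * (d + 1) * ((⌊log₂ (d + 2) ⌋ + 1) ^ k)))
        ≤ ((+ K) / 1) ^ℚ (C * (d + 1) * ((⌊log₂ (d + 2) ⌋ + 1) ^ k)))
-- 75 comes from `index-count`. 1088 = 2 · 544, because rounding 544/ε up to a power of two at most
-- doubles it. With `k` = 0 the exponent is 75 (d + 1), linear in d.
theorem1p2 = 75 , 0 , 1088 , Development.tree-cover
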